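{- Let $n\ge1$ and let $\mathscr A$ be a symmetric orientation of $A_{2n-1}$. Then the convex hull of $\{M_{\mathscr A}(T):T\in\mathcal T^B_{2n+2}\}\subset\mathbb R^{2n}$ is a realization of the cyclohedron $\mathrm{Ass}(B_n)$ (a convex polytope combinatorially equivalent to the $n$-dimensional cyclohedron), and all these points have integer coordinates.
   Context: Set $m=2n$. $A_{m-1}$ is the path with vertices $\tau_1,\dots,\tau_{m-1}$ and edges $\{\tau_i,\tau_{i+1}\}$; an orientation $\mathscr A$ directs each edge. It is symmetric if for every $i\in[2n-2]$ the edges $\{\tau_i,\tau_{i+1}\}$ and $\{\tau_{2n-i-1},\tau_{2n-i}\}$ are oriented in opposite directions (i.e. $\tau_i\to\tau_{i+1}$ iff $\tau_{2n-i}\to\tau_{2n-i-1}$); these correspond bijectively to orientations of the Coxeter graph $B_n$. $i\in\{2,\dots,m-1\}$ is up if $\{\tau_{i-1},\tau_i\}$ is directed from $\tau_i$ to $\tau_{i-1}$, down otherwise; $1,m$ are down. Labelled polygon: in a convex $(m+2)$-gon $P$ label a vertex $0$, then counterclockwise the down elements increasingly, then $m+1$, then the up elements decreasingly. A triangulation $T$ is a set of $m-1$ non-crossing diagonals, viewed as a graph together with the boundary edges; $\{a,b\}\in T$ means it is an edge of this graph; $\mathcal T_{m+2}$ is the set of triangulations. $T$ is centrally symmetric if, viewing the labelled polygon as a regular $(2n+2)$-gon, $T$ is invariant under the central symmetry; $\mathcal T^B_{2n+2}$ is the set of centrally symmetric triangulations. $\mu_i(j)$ ($i\in[m]$, $0\le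 j\le m+1$) is the number of edges of the boundary path of $P$ from $i$ to $j$ using only labels $\le i$ if $j<i$, only labels $\ge i$ if $j\ge i$. $p^T_\ell(i)=\max\{\mu_i(a):0\le a<i,\{a,i\}\in T\}$, $p^T_r(i)=\max\{\mu_i(b):i<b\le m+1,\{i,b\}\in T\}$, $\omega_i=p^T_\ell(i)p^T_r(i)$, $x_i=\omega_i$ ($i$ down) or $m+1-\omega_i$ ($i$ up), $M_{\mathscr A}(T)=(x_1,\dots,x_m)$. The cyclohedron $\mathrm{Ass}(B_n)$ is (up to combinatorial equivalence) the $n$-dimensional simple polytope whose face lattice is isomorphic to the poset of centrally symmetric sets of pairwise non-crossing diagonals of a regular $(2n+2)$-gon, ordered by reverse inclusion (vertices correspond to centrally symmetric triangulations).
   Formalization: The convex hull is treated over the rationals: its faces are the sets of points M(T) maximising a linear functional with rational coefficients, instead of real functionals on R^{2n}; as the points are integral, the face lattice is the same. -}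

module Defs where

open import Data.Bool using (Bool; true; false; not; _∧_; _∨_; if_then_else_)
open import Data.Nat as ℕ using (ℕ; zero; suc; _+_; _*_; _∸_; _≤_; _<_; _⊔_; _≡ᵇ_; _<ᵇ_; _≤ᵇ_)
open import Data.Nat.DivMod using (_%_)
open import Data.Integer as ℤ using (ℤ; +_)
open import Data.Rational as ℚ using (ℚ; 0ℚ)
open import Data.List using (List; []; _∷_; map; filter; length; foldr; upTo; applyUpTo)
open import Data.Vec as Vec using (Vec; tabulate; lookup)
open import Data.Fin using (Fin; toℕ)
open import Data.Product using (Σ; ∃; ∃-syntax; _×_; _,_)
open import Relation.Binary.PropositionalEquality using (_≡_)
open import Function.Bundles using (_⇔_)
open import Relation.Nullary using (¬_)

-- Orientations of A_{m-1}, m = 2n.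
-- An orientation is a function  dir : ℕ → Bool  where, for 1 ≤ i ≤ m-2,
-- dir i ≡ true  means the edge {τ_i, τ_{i+1}} is directed τ_i → τ_{i+1}.
-- (Values outside 1..m-2 are irrelevant.)

Orientation : Set
Orientation = ℕ → Bool

-- symmetric orientation of A_{2n-1}:  τ_i → τ_{i+1}  iff  τ_{2n-i} → τ_{2n-i-1},
-- i.e. edge i and edge 2n-i-1 are oriented in opposite directions.
SymmetricOrientation : ℕ → Orientation → Set
SymmetricOrientation n dir =
  ∀ i → 1 ≤ i → i ≤ 2 * n ∸ 2 → dir (2 * n ∸ i ∸ 1) ≡ not (dir i)

-- i ∈ {2,…,m-1} is up iff {τ_{i-1},τ_i} is directed τ_i → τ_{i-1};
-- 1 and m are down.
isUp : (m : ℕ) → Orientation → ℕ → Bool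
isUp m dir i = (1 <ᵇ i) ∧ (i <ᵇ m) ∧ not (dir (i ∸ 1))

isDown : (m : ℕ) → Orientation → ℕ → Bool
isDown m dir i = not (isUp m dir i)

range : ℕ → ℕ → List ℕ
range a b = applyUpTo (λ k → a + k) (suc b ∸ a)

-- Labelled (m+2)-gon.  Positions 0,…,m+1 counterclockwise.
-- Position 0 carries 0, then the down elements increasingly, then m+1,
-- then the up elements decreasingly.

countDownIn : (m : ℕ) → Orientation → ℕ → ℕ → ℕ
countDownIn m dir a b = length (filter (λ j → isDown m dir j Data.Bool.≟ true) (range a b))
  where import Data.Bool

countUpIn : (m : ℕ) → Orientation → ℕ → ℕ → ℕ
countUpIn m dir a b = length (filter (λ j → isUp m dir j Data.Bool.≟ true) (range a b))
  where import Data.Bool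

pos : (m : ℕ) → Orientation → ℕ → ℕ
pos m dir a =
  if a ≡ᵇ 0 then 0
  else if a ≡ᵇ suc m then suc (countDownIn m dir 1 m)
  else if isDown m dir a then countDownIn m dir 1 a
  else suc (countDownIn m dir 1 m) + countUpIn m dir a m

lab : (m : ℕ) → Orientation → ℕ → ℕ
lab m dir p = foldr (λ a r → if pos m dir a ≡ᵇ p then a else r) 0 (range 0 (suc m))

-- Sets of diagonals of the N-gon (N = m+2), by positions.
-- A set S is a function with S p q ≡ true meaning the diagonal {p,q}
-- (stored with p < q) belongs to S.

DiagSet : Set
DiagSet = ℕ → ℕ → Bool

_∈D_ : ℕ × ℕ → DiagSet → Set
(p , q) ∈D S = S p q ≡ true

IsDiagonal : ℕ → ℕ → ℕ → Set
IsDiagonal N p q = (2 + p ≤ q) × (q < N) × ¬ (p ≡ 0 × suc q ≡ N)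

WellFormed : ℕ → DiagSet → Set
WellFormed N S = ∀ p q → (p , q) ∈D S → IsDiagonal N p q

Cross : ℕ → ℕ → ℕ → ℕ → Set
Cross p q r s = (p < r × r < q × q < s) Data.Sum.⊎ (r < p × p < s × s < q)
  where import Data.Sum

NonCrossing : DiagSet → Set
NonCrossing S = ∀ p q r s → (p , q) ∈D S → (r , s) ∈D S → ¬ Cross p q r s

countD : ℕ → DiagSet → ℕ
countD N S = length (filter (λ pq → S (Data.Product.proj₁ pq) (Data.Product.proj₂ pq) Data.Bool.≟ true)
                    (Data.List.cartesianProduct (range 0 N) (range 0 N)))
  where import Data.Bool
        import Data.Product
        import Data.List

memU : DiagSet → ℕ → ℕ → Bool
memU S a b = S (a ℕ.⊓ b) (a ⊔ b)

-- central symmetry of the regular (2n+2)-gon: rotation by n+1 positions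
rot : ℕ → ℕ → ℕ
rot n p = (p + suc n) % suc (suc (2 * n))

CentrallySymmetric : ℕ → DiagSet → Set
CentrallySymmetric n S = ∀ p q → (p , q) ∈D S → memU S (rot n p) (rot n q) ≡ true

IsCSNC : ℕ → DiagSet → Set
IsCSNC n S = WellFormed (2 * n + 2) S × NonCrossing S × CentrallySymmetric n S

IsTriangulation : ℕ → DiagSet → Set
IsTriangulation m S = WellFormed (m + 2) S × NonCrossing S × countD (m + 2) S ≡ m ∸ 1

IsTriB : ℕ → DiagSet → Set
IsTriB n S = IsTriangulation (2 * n) S × CentrallySymmetric n S

_⊆D_ : DiagSet → DiagSet → Set
S ⊆D S′ = ∀ p q → (p , q) ∈D S → (p , q) ∈D S′

allB : (ℕ → Bool) → List ℕ → Bool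
allB f = foldr (λ x r → f x ∧ r) true

edgeP : ℕ → DiagSet → ℕ → ℕ → Bool
edgeP N S p q =
  let a = p ℕ.⊓ q ; b = p ⊔ q in
  ((suc a ≡ᵇ b) ∨ ((a ≡ᵇ 0) ∧ (suc b ≡ᵇ N))) ∨ S a b

edgeL : (m : ℕ) → Orientation → DiagSet → ℕ → ℕ → Bool
edgeL m dir T a b = edgeP (m + 2) T (pos m dir a) (pos m dir b)

-- μ_i(j): length of the boundary path from i to j using only labels ≤ i
-- (if j < i), resp. only labels ≥ i (if j ≥ i).  Of the two boundary
-- paths (counterclockwise, clockwise) we take the one satisfying the
-- label condition.
μ : (m : ℕ) → Orientation → ℕ → ℕ → ℕ
μ m dir i j =
  if allB ok ccwVerts then ccwLen else cwLen
  where
  N = suc (suc m)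
  pi = pos m dir i
  pj = pos m dir j
  ok : ℕ → Bool
  ok v = let l = lab m dir v in if j <ᵇ i then l ≤ᵇ i else i ≤ᵇ l
  ccwLen = (pj + N ∸ pi) % N
  cwLen = (pi + N ∸ pj) % N
  ccwVerts = map (λ k → (pi + k) % N) (range 0 ccwLen)

maxL : List ℕ → ℕ
maxL = foldr _⊔_ 0

pℓ : (m : ℕ) → Orientation → DiagSet → ℕ → ℕ
pℓ m dir T i = maxL (map (μ m dir i) (filter (λ a → edgeL m dir T a i Data.Bool.≟ true) (range 0 (i ∸ 1))))
  where import Data.Bool

pr : (m : ℕ) → Orientation → DiagSet → ℕ → ℕ
pr m dir T i = maxL (map (μ m dir i) (filter (λ b → edgeL m dir T i b Data.Bool.≟ true) (range (suc i) (suc m))))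
  where import Data.Bool

ω : (m : ℕ) → Orientation → DiagSet → ℕ → ℕ
ω m dir T i = pℓ m dir T i * pr m dir T i

xcoord : (m : ℕ) → Orientation → DiagSet → ℕ → ℤ
xcoord m dir T i =
  if isDown m dir i then + ω m dir T i else (+ suc m) ℤ.- (+ ω m dir T i)

M : (m : ℕ) → Orientation → DiagSet → Vec ℤ m
M m dir T = tabulate (λ k → xcoord m dir T (suc (toℕ k)))

toℚ : ℤ → ℚ
toℚ z = z ℚ./ 1

dot : ∀ {k} → Vec ℚ k → Vec ℚ k → ℚ
dot u v = Vec.foldr _ ℚ._+_ 0ℚ (Vec.zipWith ℚ._*_ u v)

-- The face of conv{P T : T ∈ 𝒯^B} in direction c, represented by the set of
-- (indices of) points of the family lying on it: the maximisers of ⟨c,·⟩.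
Face : (n : ℕ) → (DiagSet → Vec ℚ (2 * n)) → Vec ℚ (2 * n) → DiagSet → Set
Face n P c T = IsTriB n T × (∀ T′ → IsTriB n T′ → dot c (P T′) ℚ.≤ dot c (P T))

_⊆F_ : (DiagSet → Set) → (DiagSet → Set) → Set
F ⊆F G = ∀ T → F T → G T

-- The convex hull of the points {P T : T ∈ 𝒯^B_{2n+2}} realises the
-- cyclohedron Ass(B_n): there is an order isomorphism between the poset of
-- centrally symmetric non-crossing diagonal sets (reverse inclusion) and the
-- poset of nonempty faces of the hull (inclusion).  Each face is given by a
-- linear functional c; S ↦ Face (φ S) is order-reflecting/preserving
-- (hence injective) and hits every nonempty face.
RealizesCyclohedron : (n : ℕ) → (DiagSet → Vec ℚ (2 * n)) → Set
RealizesCyclohedron n P =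
  Σ (DiagSet → Vec ℚ (2 * n)) λ φ →
    (∀ (c : Vec ℚ (2 * n)) → ∃[ S ] (IsCSNC n S × (Face n P c ⊆F Face n P (φ S)) × (Face n P (φ S) ⊆F Face n P c)))
    × (∀ S S′ → IsCSNC n S → IsCSNC n S′ → (S ⊆D S′ ⇔ (Face n P (φ S′) ⊆F Face n P (φ S))))

-- A chord {a < b} separates the labels 1, …, m into those below and those above it.  For a weight
-- c on the labels let T_c be the set of chords whose lower labels in [a, b] all weigh less than the
-- upper ones.  If c is injective, T_c is the triangulation swept out by the monotone paths P_J from
-- 0 to m + 1 belonging to the sets J = {c < t}: when the label j enters J, the path crosses the
-- triangle with middle label j, and 2 x_j is the increment of a cost f(J) of the path.  These
-- increments grow with J, so 2 Σ_{j ∈ J} x_j ≥ f(J) − f(∅) for every J, with equality exactly when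
-- the triangulation contains all diagonals on P_J.
--
-- If S is non-crossing and c(j) is the number of its diagonals lying below j, then S ⊆ T_c.  Made
-- antisymmetric under the half turn and injective by a tie-break, c yields a centrally symmetric
-- triangulation containing S; the two opposite tie-breaks yield two whose only common diagonals are
-- those of S.  Since all T_c have m − 1 diagonals, every triangulation is of this form.
--
-- On symmetric triangulations x_j + x_{m+1−j} is constant, so every linear functional amounts to a
-- nonnegative one, that is, to a sum of indicators of complements of sets J.  Its maximisers are
-- the triangulations containing the diagonals on the paths P_J.
module Submission where

open import Defs
open import Data.Bool using (Bool; true; false; not; if_then_else_; _∧_; _∨_; T)
import Data.Bool.Properties as Bool
open import Data.Bool.Properties using (not-involutive)
open import Data.Empty using (⊥; ⊥-elim)
open import Data.Fin using (toℕ)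
open import Data.Integer as ℤ using (ℤ; +_; 0ℤ; 1ℤ; ∣_∣)
import Data.Integer.Properties as ℤ
open import Algebra.Properties.AbelianGroup ℤ.+-0-abelianGroup using (∙-cancelˡ; ∙-cancelʳ)
open import Data.Integer.Tactic.RingSolver using (solve-∀)
open import Data.List as List using (List; []; _∷_; filter; length; foldr; applyUpTo; _∷ʳ_; cartesianProduct)
open import Data.List.Properties using (applyUpTo-∷ʳ; filter-++; length-++; map-applyUpTo)
open import Data.Nat as ℕ using (ℕ; zero; suc; _*_; _∸_; _⊓_; _⊔_; _≤_; _<_; _≥_; z≤n; s≤s; _≤?_; _<?_; _≟_; _≤ᵇ_; _<ᵇ_; _≡ᵇ_)
open import Data.Nat.Coprimality as Coprimality using (Coprime)
open import Data.Nat.DivMod using (_%_; m<n⇒m%n≡m; [m+n]%n≡m%n)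
open import Data.Nat.Properties
open import Data.Product using (Σ; _×_; _,_; proj₁; proj₂; ∃)
open import Data.Rational as ℚ using (ℚ; mkℚ; ↥_; ↧_; ↧ₙ_; toℚᵘ)
import Data.Rational.Properties as ℚ
open import Data.Rational.Unnormalised as ℚᵘ using (mkℚᵘ; *≡*; *≤*)
import Data.Rational.Unnormalised.Properties as ℚᵘ
open import Data.Sum using (_⊎_; inj₁; inj₂)
open import Data.Vec as Vec using (Vec; map; tabulate; []; _∷_)
open import Function using (_∘_; flip)
open import Function.Bundles using (_⇔_; mk⇔)
open import Relation.Binary.Definitions using (tri<; tri≈; tri>)
open import Relation.Binary.PropositionalEquality hiding (J)
open import Relation.Nullary using (yes; no; ¬_; Dec; does; ¬?)
open import Relation.Nullary.Decidable using (dec-true; dec-false; _×-dec_)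

-- Finite sums of integers

-- The lever is that `{a, b}` is an edge of the path of `J` exactly when `J` agrees with `R a b` on
-- the inner labels of `[a, b]`. Thresholds, membership in T_c and crossing thus become statements
-- about one Boolean function of labels; positions matter only at the interface with the
-- definitions. The cost comes from a polarisation: for `g s = s (s - 1)`,
-- `g (s + s′) - g s - g s′ = 2 s s′`, twice a product of two boundary lengths, which is what ω is.
-- Lengths must add along a path, so positions are unrolled: `π` lies in `[0, N)` and serves right
-- ends, `ρ` is negative on up labels and serves left ends. At an up label the two differ by `N`,
-- and charging `(N - 1)(N - 2)` there turns the increment into `2 (N - 1 - ω)`. The increments grow
-- because the path rises with `J`: `ρ` of left neighbours falls and `π` of right neighbours rises.
-- An obstacle is that the half turn does not reverse the order of the labels, as it exchanges 0
-- with `m` and 1 with `m + 1`. The only chords affected are the sides `{0, 1}` and `{m, m + 1}`.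

∑ : ℕ → (ℕ → ℤ) → ℤ
∑ zero    f = 0ℤ
∑ (suc k) f = f 0 ℤ.+ ∑ k (f ∘ suc)

∑-cong : ∀ k {f g : ℕ → ℤ} → (∀ i → i ℕ.< k → f i ≡ g i) → ∑ k f ≡ ∑ k g
∑-cong zero    e = refl
∑-cong (suc k) e = cong₂ ℤ._+_ (e 0 (s≤s z≤n)) (∑-cong k λ i i<k → e (suc i) (s≤s i<k))

+-interchange : ∀ a b c d → (a ℤ.+ b) ℤ.+ (c ℤ.+ d) ≡ (a ℤ.+ c) ℤ.+ (b ℤ.+ d)
+-interchange = solve-∀

∑-+ : ∀ k (f g : ℕ → ℤ) → ∑ k (λ i → f i ℤ.+ g i) ≡ ∑ k f ℤ.+ ∑ k g
∑-+ zero    f g = refl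
∑-+ (suc k) f g = trans (cong (ℤ._+_ (f 0 ℤ.+ g 0)) (∑-+ k (f ∘ suc) (g ∘ suc)))
                        (+-interchange (f 0) (g 0) _ _)

∑-*ˡ : ∀ k c (f : ℕ → ℤ) → ∑ k (λ i → c ℤ.* f i) ≡ c ℤ.* ∑ k f
∑-*ˡ zero    c f = sym (ℤ.*-zeroʳ c)
∑-*ˡ (suc k) c f = trans (cong (ℤ._+_ (c ℤ.* f 0)) (∑-*ˡ k c (f ∘ suc))) (sym (ℤ.*-distribˡ-+ c (f 0) _))

∑-const : ∀ k c → ∑ k (λ _ → c) ≡ + k ℤ.* c
∑-const zero    c = refl
∑-const (suc k) c = trans (cong (ℤ._+_ c) (∑-const k c)) (sym (ℤ.suc-* (+ k) c))

∑-0 : ∀ k → ∑ k (λ _ → 0ℤ) ≡ 0ℤ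
∑-0 k = trans (∑-const k 0ℤ) (ℤ.*-zeroʳ (+ k))

∑-mono : ∀ k {f g : ℕ → ℤ} → (∀ i → i ℕ.< k → f i ℤ.≤ g i) → ∑ k f ℤ.≤ ∑ k g
∑-mono zero    e = ℤ.≤-refl
∑-mono (suc k) e = ℤ.+-mono-≤ (e 0 (s≤s z≤n)) (∑-mono k λ i i<k → e (suc i) (s≤s i<k))

+-tight : ∀ {a b c d} → a ℤ.≤ b → c ℤ.≤ d → a ℤ.+ c ≡ b ℤ.+ d → a ≡ b × c ≡ d
+-tight {a} {b} {c} {d} a≤b c≤d e with a ℤ.≟ b | c ℤ.≟ d
... | yes p | yes q = p , q
... | yes p | no  q = ⊥-elim (ℤ.<-irrefl e (ℤ.+-mono-≤-< a≤b (ℤ.≤∧≢⇒< c≤d q)))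
... | no  p | _     = ⊥-elim (ℤ.<-irrefl e (ℤ.+-mono-<-≤ (ℤ.≤∧≢⇒< a≤b p) c≤d))

-- Source of the equality cases for sums: equal cardinalities, equal weights and vanishing slack are
-- all resolved termwise through it.
∑-tight : ∀ k {f g : ℕ → ℤ} → (∀ i → i ℕ.< k → f i ℤ.≤ g i) → ∑ k f ≡ ∑ k g →
          ∀ i → i ℕ.< k → f i ≡ g i
∑-tight (suc k) le e i i<k
  with +-tight (le 0 (s≤s z≤n)) (∑-mono k λ i i<k → le (suc i) (s≤s i<k)) e
∑-tight (suc k) le e zero    _         | p , _ = p
∑-tight (suc k) le e (suc i) (s≤s i<k) | _ , q = ∑-tight k (λ i i<k → le (suc i) (s≤s i<k)) q i i<k

∑-last : ∀ k (f : ℕ → ℤ) → ∑ (suc k) f ≡ ∑ k f ℤ.+ f k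
∑-last zero    f = trans (ℤ.+-identityʳ (f 0)) (sym (ℤ.+-identityˡ (f 0)))
∑-last (suc k) f = trans (cong (ℤ._+_ (f 0)) (∑-last k (f ∘ suc))) (sym (ℤ.+-assoc (f 0) _ _))

∑-reverse : ∀ k (f : ℕ → ℤ) → ∑ k f ≡ ∑ k (λ i → f (k ∸ suc i))
∑-reverse zero    f = refl
∑-reverse (suc k) f = begin
  ∑ (suc k) f                        ≡⟨ ∑-last k f ⟩
  ∑ k f ℤ.+ f k                      ≡⟨ cong (λ z → z ℤ.+ f k) (∑-reverse k f) ⟩
  ∑ k (λ i → f (k ∸ suc i)) ℤ.+ f k  ≡⟨ ℤ.+-comm _ (f k) ⟩
  f k ℤ.+ ∑ k (λ i → f (k ∸ suc i))  ∎
  where open ≡-Reasoning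

∑-swap : ∀ k l (f : ℕ → ℕ → ℤ) → ∑ k (λ i → ∑ l (f i)) ≡ ∑ l (λ j → ∑ k (λ i → f i j))
∑-swap zero    l f = sym (∑-0 l)
∑-swap (suc k) l f = trans (cong (ℤ._+_ (∑ l (f 0))) (∑-swap k l (f ∘ suc)))
                           (sym (∑-+ l (f 0) (λ j → ∑ k (λ i → f (suc i) j))))

∑-update : ∀ k {f g : ℕ → ℤ} {v} i → i ℕ.< k → (∀ j → j ℕ.< k → j ≢ i → f j ≡ g j) →
           f i ≡ g i ℤ.+ v → ∑ k f ≡ ∑ k g ℤ.+ v
∑-update (suc k) {f} {g} {v} zero _ e e₀ =
  trans (cong₂ ℤ._+_ e₀ (∑-cong k λ j j<k → e (suc j) (s≤s j<k) λ ()))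
        (lem (g 0) v _)
  where
  lem : ∀ a b c → (a ℤ.+ b) ℤ.+ c ≡ (a ℤ.+ c) ℤ.+ b
  lem = solve-∀
∑-update (suc k) {f} {g} {v} (suc i) (s≤s i<k) e e₀ =
  trans (cong₂ ℤ._+_ (e 0 (s≤s z≤n) λ ())
                   (∑-update k i i<k (λ j j<k ne → e (suc j) (s≤s j<k) (ne ∘ suc-injective)) e₀))
        (sym (ℤ.+-assoc (g 0) _ v))

∑₂-update : ∀ k {f g : ℕ → ℕ → ℤ} {v} i₀ j₀ → i₀ ℕ.< k → j₀ ℕ.< k →
            (∀ i j → i ℕ.< k → j ℕ.< k → ¬ (i ≡ i₀ × j ≡ j₀) → f i j ≡ g i j) →
            f i₀ j₀ ≡ g i₀ j₀ ℤ.+ v →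
            ∑ k (λ i → ∑ k (f i)) ≡ ∑ k (λ i → ∑ k (g i)) ℤ.+ v
∑₂-update k i₀ j₀ i₀<k j₀<k e e₀ = ∑-update k i₀ i₀<k
  (λ i i<k ne → ∑-cong k λ j j<k → e i j i<k j<k (ne ∘ proj₁))
  (∑-update k j₀ j₀<k (λ j j<k ne → e i₀ j i₀<k j<k (ne ∘ proj₂)) e₀)

∑₂-cong : ∀ k {f g : ℕ → ℕ → ℤ} → (∀ i j → i ℕ.< k → j ℕ.< k → f i j ≡ g i j) →
          ∑ k (λ i → ∑ k (f i)) ≡ ∑ k (λ i → ∑ k (g i))
∑₂-cong k e = ∑-cong k λ i i<k → ∑-cong k λ j j<k → e i j i<k j<k

∑₂-+ : ∀ k l (f g : ℕ → ℕ → ℤ) →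
       ∑ k (λ i → ∑ l (λ j → f i j ℤ.+ g i j)) ≡ ∑ k (λ i → ∑ l (f i)) ℤ.+ ∑ k (λ i → ∑ l (g i))
∑₂-+ k l f g = trans (∑-cong k λ i _ → ∑-+ l (f i) (g i)) (∑-+ k _ _)

true≢false : ∀ {b} → b ≡ true → b ≡ false → ⊥
true≢false refl ()

bool : ∀ b → b ≡ true ⊎ b ≡ false
bool true  = inj₁ refl
bool false = inj₂ refl

agree : Bool → Bool → Bool
agree true  v = v
agree false v = not v

agree-true : ∀ u {v} → agree u v ≡ true → v ≡ u
agree-true true  {true}  e = refl
agree-true false {false} e = refl

agree-false : ∀ u {v} → agree u v ≡ false → v ≡ not u
agree-false true  {false} e = refl
agree-false false {true}  e = refl

agree-refl : ∀ u → agree u u ≡ true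
agree-refl true  = refl
agree-refl false = refl

agree-not : ∀ u → agree u (not u) ≡ false
agree-not true  = refl
agree-not false = refl

-- Chords and monotone paths on labels

data Zone (a b j : ℕ) : Set where
  left  : j ≤ a → Zone a b j
  mid   : a < j → j < b → Zone a b j
  right : b ≤ j → Zone a b j

zone : ∀ a b j → Zone a b j
zone a b j with j ≤? a | b ≤? j
... | yes p | _     = left p
... | no  p | yes q = right q
... | no  p | no  q = mid (≰⇒> p) (≰⇒> q)

module Labels (m : ℕ) (up : ℕ → Bool) where

  Inner : ℕ → Set
  Inner j = 1 ≤ j × j ≤ m

  inner? : ∀ j → Dec (Inner j)
  inner? j = (1 ≤? j) ×-dec (j ≤? m)

  opaque
    -- R a b j: the vertex j lies below the chord {a, b}, prolonged at each end
    -- to −∞ or +∞ so as to leave the polygon on the side of the endpoint.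
    R : ℕ → ℕ → ℕ → Bool
    R a b j = if does (j ≤? a) then up a else if does (j <? b) then not (up j) else up b

    R-left : ∀ {a b j} → j ≤ a → R a b j ≡ up a
    R-left {a} {b} {j} p rewrite dec-true (j ≤? a) p = refl

    R-mid : ∀ {a b j} → a < j → j < b → R a b j ≡ not (up j)
    R-mid {a} {b} {j} p q rewrite dec-false (j ≤? a) (<⇒≱ p) | dec-true (j <? b) q = refl

    R-right : ∀ {a b j} → a < b → b ≤ j → R a b j ≡ up b
    R-right {a} {b} {j} p q
      rewrite dec-false (j ≤? a) (<⇒≱ (<-≤-trans p q)) | dec-false (j <? b) (≤⇒≯ q) = refl

  -- Only labels of `[a, b]` count, but its ends do count: an up end lies on the lower side and a
  -- down end on the upper side, standing for the vertices beyond it. With this convention a chord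
  -- has labels on both sides exactly when it is a diagonal.
  InL InU : ℕ → ℕ → ℕ → Set
  InL a b j = Inner j × a ≤ j × j ≤ b × R a b j ≡ true
  InU a b j = Inner j × a ≤ j × j ≤ b × R a b j ≡ false

  -- The chords {a, b} with Chk c a b make up T_c.
  Chk : (ℕ → ℕ) → ℕ → ℕ → Set
  Chk c a b = ∀ {j k} → InL a b j → InU a b k → c j < c k

  opaque
    -- The path of J ⊆ [1, m] visits the down labels outside J and the up labels in J.
    alive : (ℕ → Bool) → ℕ → Bool
    alive J i = if does (inner? i) then agree (up i) (J i) else true

    alive-inner : ∀ J {i} → Inner i → alive J i ≡ agree (up i) (J i)
    alive-inner J {i} p rewrite dec-true (inner? i) p = refl

    alive-outer : ∀ J {i} → ¬ Inner i → alive J i ≡ true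
    alive-outer J {i} p rewrite dec-false (inner? i) p = refl

    alive-cong : ∀ J J′ {i} → (Inner i → J i ≡ J′ i) → alive J i ≡ alive J′ i
    alive-cong J J′ {i} e with inner? i
    ... | yes p = trans (alive-inner J p) (trans (cong (agree (up i)) (e p)) (sym (alive-inner J′ p)))
    ... | no ¬p = trans (alive-outer J ¬p) (sym (alive-outer J′ ¬p))

  alive-zero : ∀ J → alive J 0 ≡ true
  alive-zero J = alive-outer J {0} λ { (() , _) }

  alive-top : ∀ J → alive J (suc m) ≡ true
  alive-top J = alive-outer J {suc m} λ { (_ , p) → 1+n≰n p }

  alive⇒ : ∀ J {i} → Inner i → alive J i ≡ true → J i ≡ up i
  alive⇒ J {i} p e = agree-true (up i) (trans (sym (alive-inner J p)) e)

  dead⇒ : ∀ J {i} → Inner i → alive J i ≡ false → J i ≡ not (up i)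
  dead⇒ J {i} p e = agree-false (up i) (trans (sym (alive-inner J p)) e)

  ⇒alive : ∀ J {i} → Inner i → J i ≡ up i → alive J i ≡ true
  ⇒alive J {i} p e = trans (alive-inner J p) (trans (cong (agree (up i)) e) (agree-refl (up i)))

  ⇒dead : ∀ J {i} → Inner i → J i ≡ not (up i) → alive J i ≡ false
  ⇒dead J {i} p e = trans (alive-inner J p) (trans (cong (agree (up i)) e) (agree-not (up i)))

  record Edge (J : ℕ → Bool) (a b : ℕ) : Set where
    constructor edge
    field
      a<b     : a < b
      b≤      : b ≤ suc m
      alive-a : alive J a ≡ true
      alive-b : alive J b ≡ true
      dead    : ∀ i → a < i → i < b → alive J i ≡ false

  between-inner : ∀ {a b i} → b ≤ suc m → a < i → i < b → Inner i
  between-inner b≤ a<i i<b = ≤-trans (s≤s z≤n) a<i , ≤-pred (≤-trans i<b b≤)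

  -- At the ends, being alive says that `J` has the value `up`; strictly inside, being dead says
  -- that it has the value `not up`. These are the values of `R a b`, so being an edge is a local
  -- condition on `J`.
  Edge⇒R : ∀ {J a b j} → Edge J a b → Inner j → a ≤ j → j ≤ b → J j ≡ R a b j
  Edge⇒R {J} {a} {b} {j} E in-j a≤j j≤b with zone a b j
  ... | left j≤a rewrite ≤-antisym j≤a a≤j =
          trans (alive⇒ J in-j (Edge.alive-a E)) (sym (R-left {b = b} ≤-refl))
  ... | mid p q = trans (dead⇒ J in-j (Edge.dead E j p q)) (sym (R-mid p q))
  ... | right b≤j rewrite ≤-antisym j≤b b≤j =
          trans (alive⇒ J in-j (Edge.alive-b E)) (sym (R-right (Edge.a<b E) ≤-refl))

  R⇒Edge : ∀ {J a b} → a < b → b ≤ suc m →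
           (∀ j → Inner j → a ≤ j → j ≤ b → J j ≡ R a b j) → Edge J a b
  R⇒Edge {J} {a} {b} a<b b≤ h = edge a<b b≤ al-a al-b de
    where
    al-a : alive J a ≡ true
    al-a with inner? a
    ... | yes p = ⇒alive J p (trans (h a p ≤-refl (<⇒≤ a<b)) (R-left {b = b} ≤-refl))
    ... | no ¬p = alive-outer J ¬p
    al-b : alive J b ≡ true
    al-b with inner? b
    ... | yes p = ⇒alive J p (trans (h b p (<⇒≤ a<b) ≤-refl) (R-right a<b ≤-refl))
    ... | no ¬p = alive-outer J ¬p
    de : ∀ i → a < i → i < b → alive J i ≡ false
    de i p q = ⇒dead J in-i (trans (h i in-i (<⇒≤ p) (<⇒≤ q)) (R-mid p q))
      where in-i = between-inner b≤ p q

  Edge-inL : ∀ {J a b j} → Edge J a b → InL a b j → J j ≡ true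
  Edge-inL E (p , q , r , e) = trans (Edge⇒R E p q r) e

  Edge-inU : ∀ {J a b j} → Edge J a b → InU a b j → J j ≡ false
  Edge-inU E (p , q , r , e) = trans (Edge⇒R E p q r) e

  LU⇒Edge : ∀ {J a b} → a < b → b ≤ suc m → (∀ j → InL a b j → J j ≡ true) →
            (∀ j → InU a b j → J j ≡ false) → Edge J a b
  LU⇒Edge {J} {a} {b} a<b b≤ hL hU = R⇒Edge a<b b≤ λ j p q r → lem j p q r
    where
    lem : ∀ j → Inner j → a ≤ j → j ≤ b → J j ≡ R a b j
    lem j p q r with bool (R a b j)
    ... | inj₁ e = trans (hL j (p , q , r , e)) (sym e)
    ... | inj₂ e = trans (hU j (p , q , r , e)) (sym e)

  opaque
    below : (ℕ → ℕ) → ℕ → ℕ → Bool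
    below K t i = does (K i <? t)

    below-true : ∀ K {t i} → K i < t → below K t i ≡ true
    below-true K {t} {i} p = dec-true (K i <? t) p

    below-false : ∀ K {t i} → t ≤ K i → below K t i ≡ false
    below-false K {t} {i} p = dec-false (K i <? t) (≤⇒≯ p)

    below⇒< : ∀ K {t i} → below K t i ≡ true → K i < t
    below⇒< K {t} {i} e with <-cmp (K i) t
    ... | tri< p _ _ = p
    ... | tri≈ _ p _ = ⊥-elim (true≢false e (dec-false (K i <? t) (<-irrefl p)))
    ... | tri> ¬p _ _ = ⊥-elim (true≢false e (dec-false (K i <? t) ¬p))

    below⇒≥ : ∀ K {t i} → below K t i ≡ false → t ≤ K i
    below⇒≥ K {t} {i} e = ≮⇒≥ λ p → true≢false (dec-true (K i <? t) p) e

  Edge-below⇒Chk : ∀ {K t a b} → Edge (below K t) a b → Chk K a b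
  Edge-below⇒Chk {K} E p q =
    <-≤-trans (below⇒< K (Edge-inL E p)) (below⇒≥ K (Edge-inU E q))

  search : ∀ {P : ℕ → Set} → (∀ j → Dec (P j)) → (∃ λ j → Inner j × P j) ⊎ (∀ j → Inner j → ¬ P j)
  search {P} P? with anyUpTo? (λ j → inner? j ×-dec P? j) (suc m)
  ... | yes (j , _ , p) = inj₁ (j , p)
  ... | no ¬p = inj₂ λ j p q → ¬p (j , s≤s (proj₂ p) , p , q)

  -- Two labels common to both chords and separated by them in opposite ways would have to be
  -- ordered by `c` in opposite ways.
  Chk-opposite : ∀ {c a b e f} j k → Inner j → Inner k → a ≤ j × j ≤ b → a ≤ k × k ≤ b →
                 e ≤ j × j ≤ f → e ≤ k × k ≤ f → R a b j ≡ not (R a b k) →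
                 R e f j ≡ not (R a b j) → R e f k ≡ not (R a b k) → Chk c a b → Chk c e f → ⊥
  Chk-opposite {c} {a} {b} j k ij ik (p₁ , p₂) (p₃ , p₄) (q₁ , q₂) (q₃ , q₄) x y z C C′
    with R a b j in u | R a b k in v
  ... | true  | false = <-asym (C (ij , p₁ , p₂ , u) (ik , p₃ , p₄ , v)) (C′ (ik , q₃ , q₄ , z) (ij , q₁ , q₂ , y))
  ... | false | true  = <-asym (C (ik , p₃ , p₄ , v) (ij , p₁ , p₂ , u)) (C′ (ij , q₁ , q₂ , y) (ik , q₃ , q₄ , z))

  -- Crossing of chords in terms of labels

  CrossL : ℕ → ℕ → ℕ → ℕ → Set
  CrossL a b e f = (e ≢ a) × (e ≢ b) × (f ≢ a) × (f ≢ b) × (R a b e ≢ R a b f)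

  ≢⇒≡not : ∀ {u v} → u ≢ v → u ≡ not v
  ≢⇒≡not {true}  {true}  n = ⊥-elim (n refl)
  ≢⇒≡not {true}  {false} n = refl
  ≢⇒≡not {false} {true}  n = refl
  ≢⇒≡not {false} {false} n = ⊥-elim (n refl)

  ≢-sym′ : ∀ {u v : Bool} → u ≢ v → v ≢ u
  ≢-sym′ n e = n (sym e)

  -- The witnesses for `Chk-opposite` are the ends of the overlap of `[a, b]` and `[e, f]`, the
  -- larger left end and the smaller right end: crossing chords separate these two in opposite ways.
  Chk-noncrossing : ∀ {c a b e f} → a < b → b ≤ suc m → e < f → f ≤ suc m →
                    Chk c a b → Chk c e f → ¬ CrossL a b e f
  Chk-noncrossing {c} {a} {b} {e} {f} a<b b≤ e<f f≤ C C′ (e≢a , e≢b , f≢a , f≢b , ne)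
    with zone a b e | zone a b f
  ... | left p | left q = ne (trans (R-left p) (sym (R-left q)))
  ... | left p | mid q r =
    Chk-opposite a f (≤-trans (s≤s z≤n) e<a , ≤-pred (≤-trans a<b b≤)) (between-inner b≤ q r)
      (≤-refl , <⇒≤ a<b) (<⇒≤ q , <⇒≤ r) (<⇒≤ e<a , <⇒≤ q) (<⇒≤ e<f , ≤-refl)
      (≢⇒≡not (λ x → ne (trans (R-left p) (trans (sym (R-left {b = b} ≤-refl)) x))))
      (trans (R-mid e<a q) (cong not (sym (R-left ≤-refl))))
      (trans (R-right e<f ≤-refl) (sym (trans (cong not (R-mid q r)) (not-involutive (up f))))) C C′
    where e<a = ≤∧≢⇒< p e≢a
  ... | left p | right q =
    Chk-opposite a b (between-inner f≤ e<a (<-trans a<b b<f)) (between-inner f≤ (<-trans e<a a<b) b<f)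
      (≤-refl , <⇒≤ a<b) (<⇒≤ a<b , ≤-refl) (<⇒≤ e<a , <⇒≤ (<-trans a<b b<f)) (<⇒≤ (<-trans e<a a<b) , q)
      (≢⇒≡not (λ x → ne (trans (R-left p) (trans (sym (R-left {b = b} ≤-refl))
        (trans x (trans (R-right a<b ≤-refl) (sym (R-right a<b q))))))))
      (trans (R-mid e<a (<-trans a<b b<f)) (cong not (sym (R-left ≤-refl))))
      (trans (R-mid (<-trans e<a a<b) b<f) (cong not (sym (R-right a<b ≤-refl)))) C C′
    where
    e<a = ≤∧≢⇒< p e≢a
    b<f = ≤∧≢⇒< q (f≢b ∘ sym)
  ... | mid p q | left r = <⇒≱ (<-trans p e<f) r
  ... | mid p q | mid r s =
    Chk-opposite e f (between-inner b≤ p q) (between-inner b≤ r s)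
      (<⇒≤ p , <⇒≤ q) (<⇒≤ r , <⇒≤ s) (≤-refl , <⇒≤ e<f) (<⇒≤ e<f , ≤-refl) (≢⇒≡not ne)
      (trans (R-left ≤-refl) (sym (trans (cong not (R-mid p q)) (not-involutive (up e)))))
      (trans (R-right e<f ≤-refl) (sym (trans (cong not (R-mid r s)) (not-involutive (up f))))) C C′
  ... | mid p q | right r =
    Chk-opposite e b (between-inner b≤ p q) (between-inner f≤ q b<f)
      (<⇒≤ p , <⇒≤ q) (<⇒≤ a<b , ≤-refl) (≤-refl , <⇒≤ e<f) (<⇒≤ q , r)
      (≢⇒≡not (λ x → ne (trans x (trans (R-right a<b ≤-refl) (sym (R-right a<b r))))))
      (trans (R-left ≤-refl) (sym (trans (cong not (R-mid p q)) (not-involutive (up e)))))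
      (trans (R-mid q b<f) (cong not (sym (R-right a<b ≤-refl)))) C C′
    where b<f = ≤∧≢⇒< r (f≢b ∘ sym)
  ... | right p | left r = <⇒≱ (<-≤-trans a<b (≤-trans p (<⇒≤ e<f))) r
  ... | right p | mid r s = <⇒≱ (<-trans e<f s) p
  ... | right p | right q = ne (trans (R-right a<b p) (sym (R-right a<b q)))

  -- Read contrapositively, a chord that lies below `j` also lies below `k`; this inclusion makes
  -- the counting weight monotone across `{a, b}`. In each pair of zones a failure is contradictory
  -- outright or puts the ends of `{e, f}` on opposite sides of `{a, b}`.
  noncrossing-mono : ∀ {a b e f j k} → a < b → e < f → ¬ CrossL a b e f →
                     InL a b j → InU a b k → R e f k ≡ true → R e f j ≡ true
  noncrossing-mono {a} {b} {e} {f} {j} {k} a<b e<f nc (ij , a≤j , j≤b , Rj) (ik , a≤k , k≤b , Rk) Ek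
    with bool (R e f j)
  ... | inj₁ Ej = Ej
  ... | inj₂ Ej = ⊥-elim (main (zone e f j) (zone e f k))
    where
    up-a : j ≡ a → up a ≡ true
    up-a refl = trans (sym (R-left {b = b} ≤-refl)) Rj
    up-b : j ≡ b → up b ≡ true
    up-b refl = trans (sym (R-right a<b ≤-refl)) Rj
    dn-a : k ≡ a → up a ≡ false
    dn-a refl = trans (sym (R-left {b = b} ≤-refl)) Rk
    dn-b : k ≡ b → up b ≡ false
    dn-b refl = trans (sym (R-right a<b ≤-refl)) Rk
    -- Strictly between `a` and `b` only down labels lie below the chord, so an up label on the
    -- lower side is an end. Dually for `end-k`.
    end-j : up j ≡ true → j ≡ a ⊎ j ≡ b
    end-j u with zone a b j
    ... | left p  = inj₁ (≤-antisym p a≤j)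
    ... | right p = inj₂ (≤-antisym j≤b p)
    ... | mid p q = ⊥-elim (true≢false Rj (trans (R-mid p q) (cong not u)))
    end-k : up k ≡ false → k ≡ a ⊎ k ≡ b
    end-k u with zone a b k
    ... | left p  = inj₁ (≤-antisym p a≤k)
    ... | right p = inj₂ (≤-antisym k≤b p)
    ... | mid p q = ⊥-elim (true≢false (trans (R-mid p q) (cong not u)) Rk)
    cross : ∀ {u} → e ≢ a → e ≢ b → f ≢ a → f ≢ b → R a b e ≡ u → R a b f ≡ not u → ⊥
    cross {u} p q r s x y = nc (p , q , r , s , λ z → lem u (trans (sym x) (trans z y)))
      where
      lem : ∀ u → u ≡ not u → ⊥
      lem true ()
      lem false ()
    upj : e < j → j < f → up j ≡ true
    upj p q = trans (sym (not-involutive (up j))) (cong not (trans (sym (R-mid p q)) Ej))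
    upk : e < k → k < f → up k ≡ false
    upk p q = trans (sym (not-involutive (up k))) (cong not (trans (sym (R-mid p q)) Ek))
    main : Zone e f j → Zone e f k → ⊥
    main (left p) (left q) = true≢false (trans (sym (R-left {b = f} q)) Ek) (trans (sym (R-left {b = f} p)) Ej)
    main (right p) (right q) = true≢false (trans (sym (R-right e<f q)) Ek) (trans (sym (R-right e<f p)) Ej)
    main (left p) (mid q r) with end-k (upk q r)
    ... | inj₁ x = <⇒≱ (≤-<-trans p q) (≤-trans (≤-reflexive x) a≤j)
    ... | inj₂ refl = cross e≢a (<⇒≢ q) (>⇒≢ (<-trans a<b r)) (>⇒≢ r)
          (trans (R-mid (≤∧≢⇒< (≤-trans a≤j p) (e≢a ∘ sym)) q) (cong not dn-e))
          (trans (R-right a<b (<⇒≤ r)) (dn-b refl))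
      where
      dn-e = trans (sym (R-left {b = f} p)) Ej
      e≢a : e ≢ a
      e≢a refl = true≢false (up-a (≤-antisym p a≤j)) dn-e
    main (left p) (right q) = cross e≢a (<⇒≢ e<b) (>⇒≢ (≤-<-trans a≤e e<f)) f≢b
        (trans (R-mid (≤∧≢⇒< a≤e (e≢a ∘ sym)) e<b) (cong not dn-e))
        (trans (R-mid (≤-<-trans a≤e e<f) (≤∧≢⇒< f≤b f≢b)) (cong not up-f))
      where
      a≤e = ≤-trans a≤j p
      f≤b = ≤-trans q k≤b
      e<b = <-≤-trans e<f f≤b
      dn-e = trans (sym (R-left {b = f} p)) Ej
      up-f = trans (sym (R-right e<f q)) Ek
      e≢a : e ≢ a
      e≢a refl = true≢false (up-a (≤-antisym p a≤j)) dn-e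
      f≢b : f ≢ b
      f≢b refl = true≢false up-f (dn-b (≤-antisym k≤b q))
    main (mid p q) (left r) with end-j (upj p q)
    ... | inj₁ x = <⇒≱ (≤-<-trans r p) (≤-trans (≤-reflexive x) a≤k)
    ... | inj₂ refl = cross e≢a (<⇒≢ p) (>⇒≢ (<-trans a<b q)) (>⇒≢ q)
          (trans (R-mid (≤∧≢⇒< (≤-trans a≤k r) (e≢a ∘ sym)) p) (cong not up-e))
          (trans (R-right a<b (<⇒≤ q)) (up-b refl))
      where
      up-e = trans (sym (R-left {b = f} r)) Ek
      e≢a : e ≢ a
      e≢a refl = true≢false up-e (dn-a (≤-antisym r a≤k))
    main (mid p q) (mid r s) with end-j (upj p q) | end-k (upk r s)
    ... | inj₁ refl | inj₁ refl = true≢false (up-a refl) (dn-a refl)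
    ... | inj₂ refl | inj₂ refl = true≢false (up-b refl) (dn-b refl)
    ... | inj₁ refl | inj₂ refl = cross (<⇒≢ p) (<⇒≢ r) (>⇒≢ q) (>⇒≢ s)
          (trans (R-left (<⇒≤ p)) (up-a refl)) (trans (R-right a<b (<⇒≤ s)) (dn-b refl))
    ... | inj₂ refl | inj₁ refl = cross (<⇒≢ r) (<⇒≢ p) (>⇒≢ s) (>⇒≢ q)
          (trans (R-left (<⇒≤ r)) (dn-a refl)) (trans (R-right a<b (<⇒≤ q)) (up-b refl))
    main (mid p q) (right r) with end-j (upj p q)
    ... | inj₂ x = <⇒≱ (<-≤-trans q r) (≤-trans k≤b (≤-reflexive (sym x)))
    ... | inj₁ refl = cross (<⇒≢ p) (<⇒≢ (<-trans p a<b)) (>⇒≢ q) f≢b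
          (trans (R-left (<⇒≤ p)) (up-a refl))
          (trans (R-mid q (≤∧≢⇒< (≤-trans r k≤b) f≢b)) (cong not up-f))
      where
      up-f = trans (sym (R-right e<f r)) Ek
      f≢b : f ≢ b
      f≢b refl = true≢false up-f (dn-b (≤-antisym k≤b r))
    main (right p) (left q) = cross e≢a (<⇒≢ e<b) (>⇒≢ (≤-<-trans a≤e e<f)) f≢b
        (trans (R-mid (≤∧≢⇒< a≤e (e≢a ∘ sym)) e<b) (cong not up-e))
        (trans (R-mid (≤-<-trans a≤e e<f) (≤∧≢⇒< f≤b f≢b)) (cong not dn-f))
      where
      a≤e = ≤-trans a≤k q
      f≤b = ≤-trans p j≤b
      e<b = <-≤-trans e<f f≤b
      up-e = trans (sym (R-left {b = f} q)) Ek
      dn-f = trans (sym (R-right e<f p)) Ej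
      e≢a : e ≢ a
      e≢a refl = true≢false up-e (dn-a (≤-antisym q a≤k))
      f≢b : f ≢ b
      f≢b refl = true≢false (up-b (≤-antisym j≤b p)) dn-f
    main (right p) (mid q r) with end-k (upk q r)
    ... | inj₂ x = <⇒≱ (<-≤-trans r p) (≤-trans j≤b (≤-reflexive (sym x)))
    ... | inj₁ refl = cross (<⇒≢ q) (<⇒≢ (<-trans q a<b)) (>⇒≢ r) f≢b
          (trans (R-left (<⇒≤ q)) (dn-a refl))
          (trans (R-mid r (≤∧≢⇒< (≤-trans p j≤b) f≢b)) (cong not dn-f))
      where
      dn-f = trans (sym (R-right e<f p)) Ej
      f≢b : f ≢ b
      f≢b refl = true≢false (up-b (≤-antisym j≤b p)) dn-f

  Edge-disjoint : ∀ {J a b e f} → Edge J a b → Edge J e f → ¬ (a ≡ e × b ≡ f) → b ≤ e ⊎ f ≤ a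
  Edge-disjoint {J} {a} {b} {e} {f} E E′ ne with <-cmp a e
  ... | tri< a<e _ _ = inj₁ (≮⇒≥ λ e<b → true≢false (Edge.alive-a E′) (Edge.dead E e a<e e<b))
  ... | tri> _ _ e<a = inj₂ (≮⇒≥ λ a<f → true≢false (Edge.alive-a E) (Edge.dead E′ a e<a a<f))
  ... | tri≈ _ refl _ with <-cmp b f
  ...   | tri< b<f _ _ = ⊥-elim (true≢false (Edge.alive-b E) (Edge.dead E′ b (Edge.a<b E) b<f))
  ...   | tri> _ _ f<b = ⊥-elim (true≢false (Edge.alive-b E′) (Edge.dead E f (Edge.a<b E′) f<b))
  ...   | tri≈ _ refl _ = ⊥-elim (ne (refl , refl))

  -- The thresholds at which a chord lies on the path

  inL? : ∀ a b j → Dec (InL a b j)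
  inL? a b j = inner? j ×-dec (a ≤? j) ×-dec (j ≤? b) ×-dec (R a b j Bool.≟ true)

  inU? : ∀ a b j → Dec (InU a b j)
  inU? a b j = inner? j ×-dec (a ≤? j) ×-dec (j ≤? b) ×-dec (R a b j Bool.≟ false)

  module _ (_≲_ : ℕ → ℕ → Set) (total : ∀ x y → x ≲ y ⊎ y ≲ x)
           (tr : ∀ {x y z} → x ≲ y → y ≲ z → x ≲ z) where

    reflexive : ∀ x → x ≲ x
    reflexive x with total x x
    ... | inj₁ p = p
    ... | inj₂ p = p

    below-suc-elim : ∀ {P Q : ℕ → Set} {k} → (∀ i → i < k → P i → Q i) → (P k → Q k) → ∀ i → i < suc k → P i → Q i
    below-suc-elim h hk i i<k with m<1+n⇒m<n∨m≡n i<k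
    ... | inj₁ p = h i p
    ... | inj₂ refl = hk

    -- An arbitrary total preorder lets one induction yield both the heaviest lower label and the
    -- lightest upper label.
    argbest-bounded : ∀ {P : ℕ → Set} (P? : ∀ j → Dec (P j)) (c : ℕ → ℕ) k →
                      (∃ λ j → P j × (∀ i → i < k → P i → c j ≲ c i)) ⊎ (∀ i → i < k → ¬ P i)
    argbest-bounded P? c zero = inj₂ λ i ()
    argbest-bounded P? c (suc k) with argbest-bounded P? c k | P? k
    ... | inj₂ none | no ¬p = inj₂ (below-suc-elim none ¬p)
    ... | inj₂ none | yes p = inj₁ (k , p , below-suc-elim (λ i i<k q → ⊥-elim (none i i<k q)) λ _ → reflexive (c k))
    ... | inj₁ (j , p , best) | no ¬q = inj₁ (j , p , below-suc-elim best (⊥-elim ∘ ¬q))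
    ... | inj₁ (j , p , best) | yes q with total (c j) (c k)
    ...   | inj₁ le = inj₁ (j , p , below-suc-elim best λ _ → le)
    ...   | inj₂ ge = inj₁ (k , q , below-suc-elim (λ i i<k r → tr ge (best i i<k r)) λ _ → reflexive (c k))

  argmax-L : ∀ c a b → (∃ λ j → InL a b j × (∀ i → InL a b i → c i ≤ c j)) ⊎ (∀ i → ¬ InL a b i)
  argmax-L c a b with argbest-bounded _≥_ (flip ≤-total) (flip ≤-trans) (inL? a b) c (suc m)
  ... | inj₁ (j , p , best) = inj₁ (j , p , λ i q → best i (s≤s (proj₂ (proj₁ q))) q)
  ... | inj₂ none = inj₂ λ i q → none i (s≤s (proj₂ (proj₁ q))) q

  argmin-U : ∀ c a b → (∃ λ j → InU a b j × (∀ i → InU a b i → c j ≤ c i)) ⊎ (∀ i → ¬ InU a b i)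
  argmin-U c a b with argbest-bounded _≤_ ≤-total ≤-trans (inU? a b) c (suc m)
  ... | inj₁ (j , p , best) = inj₁ (j , p , λ i q → best i (s≤s (proj₂ (proj₁ q))) q)
  ... | inj₂ none = inj₂ λ i q → none i (s≤s (proj₂ (proj₁ q))) q

  -- The threshold t of the first path {c < t} through the chord {a, b}.
  birth : ∀ c a b → ∃ λ t → (∀ j → InL a b j → c j < t) × (t ≡ 0 ⊎ ∃ λ j → InL a b j × t ≡ suc (c j))
  birth c a b with argmax-L c a b
  ... | inj₁ (j , p , best) = suc (c j) , (λ i q → s≤s (best i q)) , inj₂ (j , p , refl)
  ... | inj₂ none = 0 , (λ i q → ⊥-elim (none i q)) , inj₁ refl

  -- The threshold just above the heaviest lower label works, because `Chk` puts every upper label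
  -- at or beyond it. The record of how the threshold arises is kept so that it can be located among
  -- the weights.
  Chk⇒Edge : ∀ {c a b} → a < b → b ≤ suc m → Chk c a b →
             ∃ λ t → Edge (below c t) a b × (t ≡ 0 ⊎ ∃ λ j → InL a b j × t ≡ suc (c j))
  Chk⇒Edge {c} {a} {b} a<b b≤ C with birth c a b
  ... | t , lt , att = t , LU⇒Edge a<b b≤ (λ j q → below-true c (lt j q)) (λ j q → below-false c (ge j q att)) , att
    where
    ge : ∀ j → InU a b j → t ≡ 0 ⊎ (∃ λ j → InL a b j × t ≡ suc (c j)) → t ≤ c j
    ge j q (inj₁ refl) = z≤n
    ge j q (inj₂ (i , p , refl)) = C p q

  opaque
    -- It suffices to compare the heaviest lower label with the lightest upper one.
    chk? : ∀ c a b → Dec (Chk c a b)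
    chk? c a b with argmax-L c a b | argmin-U c a b
    ... | inj₂ none | _ = yes λ p q → ⊥-elim (none _ p)
    ... | inj₁ _ | inj₂ none = yes λ p q → ⊥-elim (none _ q)
    ... | inj₁ (j , p , bj) | inj₁ (k , q , bk) with c j <? c k
    ...   | yes lt = yes λ p′ q′ → ≤-<-trans (bj _ p′) (<-≤-trans lt (bk _ q′))
    ...   | no ¬lt = no λ C → ¬lt (C p q)

  -- A chord of T_K other than {a, b} does not separate the triangles on the two sides of {a, b}.
  Chk-unseparated : ∀ {K a b e f j k} → a < b → b ≤ suc m → e < f → f ≤ suc m →
    Chk K a b → Chk K e f → ¬ (a ≡ e × b ≡ f) →
    InL a b j → (∀ i → InL a b i → K i ≤ K j) → InU a b k → (∀ i → InU a b i → K k ≤ K i) →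
    R e f j ≡ true → R e f k ≡ true
  Chk-unseparated {K} {a} {b} {e} {f} {j} {k} a<b b≤ e<f f≤ C C′ ne p@(ij , a≤j , j≤b , Rj) jmax q@(ik , a≤k , k≤b , Rk) kmin Ej
    with bool (R e f k)
  ... | inj₁ Ek = Ek
  ... | inj₂ Ek = ⊥-elim absurd
    where
    j<k : K j < K k
    j<k = C p q
    up-e : ∀ {i} → i ≤ e → R e f i ≡ up e
    up-e = R-left
    -- Such an `i` would take `{e, f}` off the path no later than `j` enters. If `j` lies outside
    -- `[e, f]`, the end of `{e, f}` between `j` and `k` is lower for `{e, f}` and upper for
    -- `{a, b}`; it is then heavier than `j`, hence not lighter than `i`, against `Chk K e f`.
    dies : (∃ λ i → InU e f i × K i ≤ K j) → ⊥
    dies (i , u , i≤j) with zone e f j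
    ... | mid x y = <⇒≱ (C′ (ij , <⇒≤ x , <⇒≤ y , Ej) u) i≤j
    ... | left x with k ≤? e
    ...   | yes y = true≢false (trans (up-e y) (trans (sym (up-e x)) Ej)) Ek
    ...   | no y with j ≟ e
    ...     | yes refl = <⇒≱ (C′ (ij , ≤-refl , <⇒≤ e<f , Ej) u) i≤j
    ...     | no z = <⇒≱ (C′ eL u) (≤-trans i≤j (<⇒≤ (<-≤-trans j<k (kmin e eU))))
      where
      j<e = ≤∧≢⇒< x z
      e<k = ≰⇒> y
      ie : Inner e
      ie = ≤-trans (s≤s z≤n) j<e , ≤-pred (≤-trans e<f f≤)
      ue = trans (sym (up-e x)) Ej
      eL : InL e f e
      eL = ie , ≤-refl , <⇒≤ e<f , trans (up-e ≤-refl) ue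
      eU : InU a b e
      eU = ie , ≤-trans a≤j x , ≤-trans (<⇒≤ e<k) k≤b ,
           trans (R-mid (≤-<-trans a≤j j<e) (<-≤-trans e<k k≤b)) (cong not ue)
    dies (i , u , i≤j) | right x with f ≤? k
    ...   | yes y = true≢false (trans (R-right e<f y) (trans (sym (R-right e<f x)) Ej)) Ek
    ...   | no y with j ≟ f
    ...     | yes refl = <⇒≱ (C′ (ij , <⇒≤ e<f , ≤-refl , Ej) u) i≤j
    ...     | no z = <⇒≱ (C′ fL u) (≤-trans i≤j (<⇒≤ (<-≤-trans j<k (kmin f fU))))
      where
      f<j = ≤∧≢⇒< x (z ∘ sym)
      k<f = ≰⇒> y
      f-inner : Inner f
      f-inner = ≤-trans (s≤s z≤n) e<f , ≤-trans x (proj₂ ij)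
      uf = trans (sym (R-right e<f x)) Ej
      fL : InL e f f
      fL = f-inner , <⇒≤ e<f , ≤-refl , trans (R-right e<f ≤-refl) uf
      fU : InU a b f
      fU = f-inner , ≤-trans a≤k (<⇒≤ k<f) , ≤-trans x j≤b ,
           trans (R-mid (≤-<-trans a≤k k<f) (<-≤-trans f<j j≤b)) (cong not uf)
    -- The dual situation: `{e, f}` would join the path only after `k` has become due, and the end
    -- of `{e, f}` between `k` and `j` refutes this.
    born : (∃ λ i → InL e f i × K k ≤ K i) → ⊥
    born (i , l , k≤i) with zone e f k
    ... | mid x y = <⇒≱ (C′ l (ik , <⇒≤ x , <⇒≤ y , Ek)) k≤i
    ... | left x with j ≤? e
    ...   | yes y = true≢false (trans (up-e x) (trans (sym (up-e y)) Ej)) Ek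
    ...   | no y with k ≟ e
    ...     | yes refl = <⇒≱ (C′ l (ik , ≤-refl , <⇒≤ e<f , Ek)) k≤i
    ...     | no z = <⇒≱ (C′ l eU) (≤-trans (≤-trans (jmax e eL) (<⇒≤ j<k)) k≤i)
      where
      k<e = ≤∧≢⇒< x z
      e<j = ≰⇒> y
      ie : Inner e
      ie = ≤-trans (s≤s z≤n) k<e , ≤-pred (≤-trans e<f f≤)
      ue = trans (sym (up-e x)) Ek
      eU : InU e f e
      eU = ie , ≤-refl , <⇒≤ e<f , trans (up-e ≤-refl) ue
      eL : InL a b e
      eL = ie , ≤-trans a≤k x , ≤-trans (<⇒≤ e<j) j≤b ,
           trans (R-mid (≤-<-trans a≤k k<e) (<-≤-trans e<j j≤b)) (cong not ue)
    born (i , l , k≤i) | right x with f ≤? j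
    ...   | yes y = true≢false (trans (R-right e<f x) (trans (sym (R-right e<f y)) Ej)) Ek
    ...   | no y with k ≟ f
    ...     | yes refl = <⇒≱ (C′ l (ik , <⇒≤ e<f , ≤-refl , Ek)) k≤i
    ...     | no z = <⇒≱ (C′ l fU) (≤-trans (≤-trans (jmax f fL) (<⇒≤ j<k)) k≤i)
      where
      f<k = ≤∧≢⇒< x (z ∘ sym)
      j<f = ≰⇒> y
      f-inner : Inner f
      f-inner = ≤-trans (s≤s z≤n) e<f , ≤-trans x (proj₂ ik)
      uf = trans (sym (R-right e<f x)) Ek
      fU : InU e f f
      fU = f-inner , <⇒≤ e<f , ≤-refl , trans (R-right e<f ≤-refl) uf
      fL : InL a b f
      fL = f-inner , ≤-trans a≤j (<⇒≤ j<f) , ≤-trans x k≤b ,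
           trans (R-mid (≤-<-trans a≤j j<f) (<-≤-trans f<k k≤b)) (cong not uf)
    -- Distinct edges of one path do not overlap, so `j` and `k` lie beyond the same end of
    -- `{e, f}`, where `R e f` is constant.
    simultaneous : ∀ {J} → Edge J a b → Edge J e f → ⊥
    simultaneous E E′ with Edge-disjoint E E′ ne
    ... | inj₁ b≤e = true≢false (trans (up-e (≤-trans k≤b b≤e)) (trans (sym (up-e (≤-trans j≤b b≤e))) Ej)) Ek
    ... | inj₂ f≤a = true≢false (trans (R-right e<f (≤-trans f≤a a≤k)) (trans (sym (R-right e<f (≤-trans f≤a a≤j))) Ej)) Ek
    -- `{a, b}` is on the path for the thresholds in `(K j, K k]`. The first threshold `t` of
    -- `{e, f}` is beyond this interval (`born`), inside it (`simultaneous`), or before it; in the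
    -- last case `{e, f}` has either left the path by `K j + 1` (`dies`) or is still there
    -- (`simultaneous`).
    absurd : ⊥
    absurd with Chk⇒Edge e<f f≤ C′
    ... | t , E′ , att with t ≤? K k
    ...   | no t≰ = born (lem att)
      where
      lem : t ≡ 0 ⊎ (∃ λ j → InL e f j × t ≡ suc (K j)) → ∃ λ i → InL e f i × K k ≤ K i
      lem (inj₁ refl) = ⊥-elim (t≰ z≤n)
      lem (inj₂ (i , l , refl)) = i , l , ≤-pred (≰⇒> t≰)
    ...   | yes t≤ with K j <? t
    ...     | yes j<t = simultaneous {below K t}
              (LU⇒Edge a<b b≤ (λ i l → below-true K (≤-<-trans (jmax i l) j<t))
                              (λ i u → below-false K (≤-trans t≤ (kmin i u)))) E′
    ...     | no j≮t with search (λ i → inU? e f i ×-dec (K i ≤? K j))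
    ...       | inj₁ (i , _ , x) = dies (i , x)
    ...       | inj₂ none = simultaneous {below K (suc (K j))}
              (LU⇒Edge a<b b≤ (λ i l → below-true K (s≤s (jmax i l)))
                              (λ i u → below-false K (<-≤-trans j<k (kmin i u))))
              (LU⇒Edge e<f f≤
                 (λ i l → below-true K (<-≤-trans (below⇒< K (Edge-inL E′ l)) (≤-trans (≮⇒≥ j≮t) (n≤1+n (K j)))))
                 (λ i u → below-false K (≰⇒> λ le → none i (proj₁ u) (u , le))))

opaque
  bound : ∀ (K : ℕ → ℕ) k → ∃ λ B → ∀ i → i < k → K i < B
  bound K zero = 0 , λ _ ()
  bound K (suc k) with bound K k
  ... | B , lt = suc (K k) ⊔ B , λ i i<k → lem i (m<1+n⇒m<n∨m≡n i<k)
    where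
    lem : ∀ i → i < k ⊎ i ≡ k → K i < suc (K k) ⊔ B
    lem i (inj₁ p) = <-≤-trans (lt i p) (m≤n⊔m (suc (K k)) B)
    lem i (inj₂ refl) = m≤m⊔n (suc (K k)) B

≡-⇔ : ∀ {u v} → (u ≡ true → v ≡ true) → (v ≡ true → u ≡ true) → u ≡ v
≡-⇔ {true}  {v}     p q = sym (p refl)
≡-⇔ {false} {true}  p q = q refl
≡-⇔ {false} {false} p q = refl

-- Costs of paths

module PathCost (h : ℕ → ℕ → ℤ) where

  -- An exhausted search returns 0, where every path starts.
  prev : (ℕ → Bool) → ℕ → ℕ
  prev α zero    = 0
  prev α (suc i) = if α i then i else prev α i

  step : Bool → ℤ → ℤ
  step true  z = z
  step false z = 0ℤ

  cost : (ℕ → Bool) → ℕ → ℤ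
  cost α zero    = 0ℤ
  cost α (suc k) = cost α k ℤ.+ step (α (suc k)) (h (prev α (suc k)) (suc k))

  prev≡ : ∀ {α a k} → a < k → α a ≡ true → (∀ i → a < i → i < k → α i ≡ false) → prev α k ≡ a
  prev≡ {α} {a} {suc k} a<k αa dead with m<1+n⇒m<n∨m≡n a<k
  ... | inj₂ refl rewrite αa = refl
  ... | inj₁ a<k′ rewrite dead k a<k′ ≤-refl =
    prev≡ a<k′ αa λ i p q → dead i p (≤-trans q (n≤1+n k))

  prev-cong : ∀ {α β} k → (∀ i → i < k → α i ≡ β i) → prev α k ≡ prev β k
  prev-cong zero e = refl
  prev-cong {α} {β} (suc k) e rewrite e k ≤-refl | prev-cong {α} {β} k (λ i p → e i (≤-trans p (n≤1+n k))) = refl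

  cost-cong : ∀ {α β} k → (∀ i → i ≤ k → α i ≡ β i) → cost α k ≡ cost β k
  cost-cong zero e = refl
  cost-cong {α} {β} (suc k) e =
    cong₂ ℤ._+_ (cost-cong k λ i p → e i (≤-trans p (n≤1+n k)))
      (cong₂ step (e (suc k) ≤-refl) (cong (λ a → h a (suc k)) (prev-cong (suc k) λ i p → e i (<⇒≤ p))))

  module Insert {α β : ℕ → Bool} {a j b : ℕ} (a<j : a < j) (j<b : j < b)
      (off : ∀ i → i ≢ j → α i ≡ β i) (αj : α j ≡ true) (βj : β j ≡ false)
      (αa : α a ≡ true) (αb : α b ≡ true)
      (deadˡ : ∀ i → a < i → i < j → α i ≡ false) (deadʳ : ∀ i → j < i → i < b → α i ≡ false) where

    upto : ∀ k → k < j → cost α k ≡ cost β k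
    upto k k<j = cost-cong k λ i p → off i (<⇒≢ (≤-<-trans p k<j))

    β-dead : ∀ i → a < i → i < b → β i ≡ false
    β-dead i p q with <-cmp i j
    ... | tri< r s _ = trans (sym (off i s)) (deadˡ i p r)
    ... | tri≈ _ refl _ = βj
    ... | tri> _ s r = trans (sym (off i s)) (deadʳ i r q)

    βa : β a ≡ true
    βa = trans (sym (off a (<⇒≢ a<j))) αa

    between : ∀ k → j ≤ k → k < b → cost α k ≡ cost β k ℤ.+ h a j
    between k j≤k k<b with m≤n⇒m<n∨m≡n j≤k
    between (suc k) _ k<b | inj₁ (s≤s j≤k)
      rewrite deadʳ (suc k) (s≤s j≤k) k<b | β-dead (suc k) (<-trans a<j (s≤s j≤k)) k<b
      = trans (ℤ.+-identityʳ _) (trans (between k j≤k (<-trans (n<1+n k) k<b))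
          (cong (λ z → z ℤ.+ h a j) (sym (ℤ.+-identityʳ (cost β k)))))
    between zero _ k<b | inj₂ refl = ⊥-elim (n≮0 a<j)
    between (suc k) _ k<b | inj₂ refl
      rewrite αj | βj | prev≡ {α} {a} {suc k} a<j αa deadˡ
      = cong (λ z → z ℤ.+ h a (suc k)) (trans (upto k ≤-refl) (sym (ℤ.+-identityʳ (cost β k))))

    after-prev : ∀ k → b < k → prev α k ≡ prev β k
    after-prev (suc k) b<k with m<1+n⇒m<n∨m≡n b<k
    ... | inj₂ refl rewrite αb | sym (off b (>⇒≢ j<b)) | αb = refl
    ... | inj₁ b<k′ rewrite off k (>⇒≢ (<-trans j<b b<k′)) | after-prev k b<k′ = refl

    shift : ∀ c d e x y z → c ℤ.+ e ≡ d ℤ.+ (x ℤ.+ y) → (c ℤ.+ z) ℤ.+ e ≡ (d ℤ.+ z) ℤ.+ (x ℤ.+ y)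
    shift c d e x y z p = trans (lem c z e) (trans (cong (λ w → w ℤ.+ z) p) (lem d (x ℤ.+ y) z))
      where
      lem : ∀ u v w → (u ℤ.+ v) ℤ.+ w ≡ (u ℤ.+ w) ℤ.+ v
      lem = solve-∀

    -- From `b` on the two paths coincide again, so the exchange of `h a b` for `h a j` and `h j b`
    -- persists. Written without subtraction, it serves the insertion and the deletion of a vertex
    -- alike.
    after : ∀ k → b ≤ k → cost α k ℤ.+ h a b ≡ cost β k ℤ.+ (h a j ℤ.+ h j b)
    after k b≤k with m≤n⇒m<n∨m≡n b≤k
    after (suc k) _ | inj₁ (s≤s b≤k)
      rewrite off (suc k) (>⇒≢ (<-≤-trans j<b (≤-trans b≤k (n≤1+n k)))) | after-prev (suc k) (s≤s b≤k)
      = shift (cost α k) (cost β k) (h a b) (h a j) (h j b) _ (after k b≤k)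
    after zero _ | inj₂ refl = ⊥-elim (n≮0 j<b)
    after (suc k) _ | inj₂ refl
      rewrite sym (off (suc k) (>⇒≢ j<b)) | αb
        | prev≡ {α} {j} {suc k} j<b αj deadʳ
        | prev≡ {β} {a} {suc k} (<-trans a<j j<b) βa β-dead
        | between k (≤-pred j<b) ≤-refl
      = lem (cost β k) (h a j) (h j (suc k)) (h a (suc k))
      where
      lem : ∀ c x y z → ((c ℤ.+ x) ℤ.+ y) ℤ.+ z ≡ (c ℤ.+ z) ℤ.+ (x ℤ.+ y)
      lem = solve-∀

-- The cost of a set of labels and its increments

module Paths (m : ℕ) (up : ℕ → Bool) (ρ π : ℕ → ℤ)
  (ρ-down : ∀ {a b} → a < b → b ≤ suc m → up b ≡ false → ρ a ℤ.< ρ b)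
  (ρ-up : ∀ {a b} → a < b → b ≤ suc m → up b ≡ true → ρ b ℤ.< ρ a)
  (π-down : ∀ {a b} → a < b → b ≤ suc m → up a ≡ false → π a ℤ.< π b)
  (π-up : ∀ {a b} → a < b → b ≤ suc m → up a ≡ true → π b ℤ.< π a)
  (π-down≡ : ∀ {a} → a ≤ suc m → up a ≡ false → π a ≡ ρ a)
  (π-up≡ : ∀ {a} → a ≤ suc m → up a ≡ true → π a ≡ ρ a ℤ.+ (1ℤ ℤ.+ + suc m))
  where
  open Labels m up

  record LeftNbr (J : ℕ → Bool) (j a : ℕ) : Set where
    constructor leftNbr
    field
      a<j   : a < j
      alive-a : alive J a ≡ true
      dead  : ∀ i → a < i → i < j → alive J i ≡ false

  record RightNbr (J : ℕ → Bool) (j b : ℕ) : Set where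
    constructor rightNbr
    field
      j<b   : j < b
      b≤    : b ≤ suc m
      alive-b : alive J b ≡ true
      dead  : ∀ i → j < i → i < b → alive J i ≡ false

  left-search : ∀ J j → ∃ (LeftNbr J (suc j))
  left-search J zero = 0 , leftNbr (s≤s z≤n) (alive-zero J) λ i p q → ⊥-elim (<⇒≱ p (≤-pred q))
  left-search J (suc j) with bool (alive J (suc j)) | left-search J j
  ... | inj₁ al | _ = suc j , leftNbr ≤-refl al λ i p q → ⊥-elim (<⇒≱ p (≤-pred q))
  ... | inj₂ de | a , leftNbr a<j al dead = a , leftNbr (≤-trans a<j (n≤1+n _)) al λ i p q → lem i p (m<1+n⇒m<n∨m≡n q)
    where
    lem : ∀ i → a < i → i < suc j ⊎ i ≡ suc j → alive J i ≡ false
    lem i p (inj₁ q) = dead i p q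
    lem i p (inj₂ refl) = de

  left-exists : ∀ J j → 1 ≤ j → ∃ (LeftNbr J j)
  left-exists J (suc j) _ = left-search J j

  right-search : ∀ J j d → suc j ℕ.+ d ≡ suc m → ∃ (RightNbr J j)
  right-search J j zero e = suc m , rightNbr (≤-reflexive (trans (sym (+-identityʳ (suc j))) e)) ≤-refl (alive-top J)
    λ i p q → ⊥-elim (<⇒≱ p (≤-pred (subst (i <_) (sym (trans (sym (+-identityʳ (suc j))) e)) q)))
  right-search J j (suc d) e with bool (alive J (suc j))
  ... | inj₁ al = suc j , rightNbr ≤-refl (subst (suc j ≤_) e (m≤m+n (suc j) (suc d))) al
                  λ i p q → ⊥-elim (<⇒≱ p (≤-pred q))
  ... | inj₂ de with right-search J (suc j) d (trans (sym (+-suc (suc j) d)) e)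
  ...   | b , rightNbr j<b b≤ al dead = b , rightNbr (<-trans (n<1+n j) j<b) b≤ al λ i p q → lem i (m≤n⇒m<n∨m≡n p) q
    where
    lem : ∀ i → suc j < i ⊎ suc j ≡ i → i < b → alive J i ≡ false
    lem i (inj₁ p) q = dead i p q
    lem i (inj₂ refl) q = de

  right-exists : ∀ J j → j ≤ m → ∃ (RightNbr J j)
  right-exists J j j≤m = right-search J j (m ∸ j) (cong suc (m+[n∸m]≡n j≤m))

  left-right⇒Edge : ∀ {J j a b} → LeftNbr J j a → RightNbr J j b → alive J j ≡ false → Edge J a b
  left-right⇒Edge {J} {j} {a} {b} (leftNbr a<j ala dl) (rightNbr j<b b≤ alb dr) dj =
    edge (<-trans a<j j<b) b≤ ala alb lem
    where
    lem : ∀ i → a < i → i < b → alive J i ≡ false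
    lem i p q with <-cmp i j
    ... | tri< r _ _ = dl i p r
    ... | tri≈ _ refl _ = dj
    ... | tri> _ _ r = dr i r q

  left⇒Edge : ∀ {J j a} → j ≤ m → LeftNbr J j a → alive J j ≡ true → Edge J a j
  left⇒Edge j≤m (leftNbr a<j ala dl) aj = edge a<j (≤-trans j≤m (n≤1+n m)) ala aj dl

  right⇒Edge : ∀ {J j b} → RightNbr J j b → alive J j ≡ true → Edge J j b
  right⇒Edge (rightNbr j<b b≤ alb dr) aj = edge j<b b≤ aj alb dr

  Edge⇒left : ∀ {J a j} → Edge J a j → LeftNbr J j a
  Edge⇒left (edge a<j _ ala _ d) = leftNbr a<j ala d

  Edge⇒right : ∀ {J j b} → Edge J j b → RightNbr J j b
  Edge⇒right (edge j<b b≤ _ alb d) = rightNbr j<b b≤ alb d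

  through⇒left : ∀ {J a j b} → Edge J a b → a < j → j < b → LeftNbr J j a
  through⇒left (edge _ _ ala _ d) p q = leftNbr p ala λ i r s → d i r (<-trans s q)

  through⇒right : ∀ {J a j b} → Edge J a b → a < j → j < b → RightNbr J j b
  through⇒right (edge _ b≤ _ alb d) p q = rightNbr q b≤ alb λ i r s → d i (<-trans p r) s

  -- The left neighbour consults `J` only on `[a, j)`, so it survives any change elsewhere, in
  -- particular at `j` itself.
  left-cong : ∀ {J J′ j a} → (∀ i → Inner i → a ≤ i → i < j → J i ≡ J′ i) → LeftNbr J j a → LeftNbr J′ j a
  left-cong {J} {J′} {j} {a} e (leftNbr a<j al d) =
    leftNbr a<j (trans (sym (alive-cong J J′ λ ia → e a ia ≤-refl a<j)) al)
      λ i p q → trans (sym (alive-cong J J′ λ ii → e i ii (<⇒≤ p) q)) (d i p q)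

  right-cong : ∀ {J J′ j b} → (∀ i → Inner i → j < i → i ≤ b → J i ≡ J′ i) → RightNbr J j b → RightNbr J′ j b
  right-cong {J} {J′} {j} {b} e (rightNbr j<b b≤ al d) =
    rightNbr j<b b≤ (trans (sym (alive-cong J J′ λ ib → e b ib j<b ≤-refl)) al)
      λ i p q → trans (sym (alive-cong J J′ λ ii → e i ii p (<⇒≤ q))) (d i p q)

  Edge-cong : ∀ {J J′ a b} → (∀ i → Inner i → a ≤ i → i ≤ b → J i ≡ J′ i) → Edge J a b → Edge J′ a b
  Edge-cong {J} {J′} {a} {b} e (edge a<b b≤ ala alb d) =
    edge a<b b≤ (trans (sym (alive-cong J J′ λ ii → e a ii ≤-refl (<⇒≤ a<b))) ala)
      (trans (sym (alive-cong J J′ λ ii → e b ii (<⇒≤ a<b) ≤-refl)) alb)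
      λ i p q → trans (sym (alive-cong J J′ λ ii → e i ii (<⇒≤ p) (<⇒≤ q))) (d i p q)

  left-unique : ∀ {J j a a′} → LeftNbr J j a → LeftNbr J j a′ → a ≡ a′
  left-unique {J} {j} {a} {a′} (leftNbr p al d) (leftNbr p′ al′ d′) with <-cmp a a′
  ... | tri< lt _ _ = ⊥-elim (true≢false al′ (d a′ lt p′))
  ... | tri≈ _ e _  = e
  ... | tri> _ _ gt = ⊥-elim (true≢false al (d′ a gt p))

  right-unique : ∀ {J j b b′} → RightNbr J j b → RightNbr J j b′ → b ≡ b′
  right-unique {J} {j} {b} {b′} (rightNbr p _ al d) (rightNbr p′ _ al′ d′) with <-cmp b b′
  ... | tri< lt _ _ = ⊥-elim (true≢false al (d′ b p lt))
  ... | tri≈ _ e _  = e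
  ... | tri> _ _ gt = ⊥-elim (true≢false al′ (d b′ p′ gt))

  N-1 : ℤ
  N-1 = + suc m

  -- Both factors change sign when `j` is up, so one formula gives the product of the two boundary
  -- lengths for either kind of label.
  ω-area : ℕ → ℕ → ℕ → ℤ
  ω-area j a b = (ρ j ℤ.- ρ a) ℤ.* (π b ℤ.- π j)

  gain : ℕ → ℕ → ℕ → ℤ
  gain j a b = if up j then N-1 ℤ.- ω-area j a b else ω-area j a b

  -- Charged at the right end of an edge, hence once for each up label visited. At an up label the
  -- two new lengths add up to `N` more than the length they replace; this constant reduces the
  -- resulting increment `N (N - 1) - 2 ω` to `2 (N - 1 - ω)`.
  upCost : Bool → ℤ
  upCost true  = N-1 ℤ.* (N-1 ℤ.- 1ℤ)
  upCost false = 0ℤ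

  pairs : ℤ → ℤ
  pairs s = s ℤ.* (s ℤ.- 1ℤ)

  -- π b − ρ a is the number of sides of the polygon below {a, b}.
  h : ℕ → ℕ → ℤ
  h a b = pairs (π b ℤ.- ρ a) ℤ.- upCost (up b)

  open PathCost h public

  opaque
    f : (ℕ → Bool) → ℤ
    f J = cost (alive J) (suc m)

    f≡ : ∀ J → f J ≡ cost (alive J) (suc m)
    f≡ J = refl

  f-cong : ∀ J J′ → (∀ i → Inner i → J i ≡ J′ i) → f J ≡ f J′
  f-cong J J′ e = trans (f≡ J) (trans (cost-cong (suc m) λ i _ → alive-cong J J′ (e i)) (sym (f≡ J′)))

  isolate : ∀ (x y a b c : ℤ) → x ℤ.+ a ≡ y ℤ.+ (b ℤ.+ c) → x ≡ y ℤ.+ ((b ℤ.+ c) ℤ.- a)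
  isolate x y a b c e = begin
    x                        ≡⟨ lem₁ x a ⟩
    (x ℤ.+ a) ℤ.- a          ≡⟨ cong (λ z → z ℤ.- a) e ⟩
    (y ℤ.+ (b ℤ.+ c)) ℤ.- a  ≡⟨ lem₂ y (b ℤ.+ c) a ⟩
    y ℤ.+ ((b ℤ.+ c) ℤ.- a)  ∎
    where
    open ≡-Reasoning
    lem₁ : ∀ x a → x ≡ (x ℤ.+ a) ℤ.- a
    lem₁ = solve-∀
    lem₂ : ∀ y z a → (y ℤ.+ z) ℤ.- a ≡ y ℤ.+ (z ℤ.- a)
    lem₂ = solve-∀

  isolate′ : ∀ (x y a b c : ℤ) → x ℤ.+ a ≡ y ℤ.+ (b ℤ.+ c) → y ≡ x ℤ.+ (a ℤ.- (b ℤ.+ c))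
  isolate′ x y a b c e = begin
    y                                ≡⟨ lem₁ y (b ℤ.+ c) ⟩
    (y ℤ.+ (b ℤ.+ c)) ℤ.- (b ℤ.+ c)  ≡⟨ cong (λ z → z ℤ.- (b ℤ.+ c)) (sym e) ⟩
    (x ℤ.+ a) ℤ.- (b ℤ.+ c)          ≡⟨ lem₂ x a (b ℤ.+ c) ⟩
    x ℤ.+ (a ℤ.- (b ℤ.+ c))          ∎
    where
    open ≡-Reasoning
    lem₁ : ∀ x a → x ≡ (x ℤ.+ a) ℤ.- a
    lem₁ = solve-∀
    lem₂ : ∀ y z a → (y ℤ.+ z) ℤ.- a ≡ y ℤ.+ (z ℤ.- a)
    lem₂ = solve-∀

  -- Entering the set puts an up label on the path and takes a down label off it, so the two
  -- branches use `Insert` with `J` and `J′` exchanged.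
  f-insert : ∀ {J J′ j a b} → Inner j → (∀ i → Inner i → i ≢ j → J i ≡ J′ i) → J j ≡ false → J′ j ≡ true →
             LeftNbr J j a → RightNbr J j b → f J′ ≡ f J ℤ.+ + 2 ℤ.* gain j a b
  f-insert {J} {J′} {j} {a} {b} ij off Jj J′j (leftNbr a<j ala dl) (rightNbr j<b b≤ alb dr)
    with bool (up j)
  ... | inj₁ u = trans (isolate (f J′) (f J) (h a b) (h a j) (h j b)
                    (trans (cong (λ z → z ℤ.+ h a b) (f≡ J′)) (trans (I.after (suc m) b≤)
                      (cong (λ z → z ℤ.+ (h a j ℤ.+ h j b)) (sym (f≡ J)))))) (cong (ℤ._+_ (f J)) eq)
    where
    off′ : ∀ i → i ≢ j → alive J′ i ≡ alive J i
    off′ i ne = sym (alive-cong J J′ λ ii → off i ii ne)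
    module I = Insert {alive J′} {alive J} a<j j<b off′
      (⇒alive J′ ij (trans J′j (sym u))) (⇒dead J ij (trans Jj (cong not (sym u))))
      (trans (off′ a (<⇒≢ a<j)) ala) (trans (off′ b (>⇒≢ j<b)) alb)
      (λ i p q → trans (off′ i (<⇒≢ q)) (dl i p q)) (λ i p q → trans (off′ i (>⇒≢ p)) (dr i p q))
    lem : ∀ r p q M H →
      (((p ℤ.+ (1ℤ ℤ.+ M) ℤ.- r) ℤ.* (p ℤ.+ (1ℤ ℤ.+ M) ℤ.- r ℤ.- 1ℤ) ℤ.- M ℤ.* (M ℤ.- 1ℤ))
        ℤ.+ ((q ℤ.- p) ℤ.* (q ℤ.- p ℤ.- 1ℤ) ℤ.- H)) ℤ.- ((q ℤ.- r) ℤ.* (q ℤ.- r ℤ.- 1ℤ) ℤ.- H)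
      ≡ + 2 ℤ.* (M ℤ.- (p ℤ.- r) ℤ.* (q ℤ.- (p ℤ.+ (1ℤ ℤ.+ M))))
    lem = solve-∀
    eq : (h a j ℤ.+ h j b) ℤ.- h a b ≡ + 2 ℤ.* gain j a b
    eq rewrite u | π-up≡ (≤-trans (proj₂ ij) (n≤1+n m)) u = lem (ρ a) (ρ j) (π b) N-1 (upCost (up b))
  ... | inj₂ u = trans (isolate′ (f J) (f J′) (h a b) (h a j) (h j b)
                    (trans (cong (λ z → z ℤ.+ h a b) (f≡ J)) (trans (I.after (suc m) b≤)
                      (cong (λ z → z ℤ.+ (h a j ℤ.+ h j b)) (sym (f≡ J′)))))) (cong (ℤ._+_ (f J)) eq)
    where
    off′ : ∀ i → i ≢ j → alive J i ≡ alive J′ i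
    off′ i ne = alive-cong J J′ λ ii → off i ii ne
    module I = Insert {alive J} {alive J′} a<j j<b off′
      (⇒alive J ij (trans Jj (sym u))) (⇒dead J′ ij (trans J′j (cong not (sym u))))
      ala alb dl dr
    lem : ∀ r p q H →
      ((q ℤ.- r) ℤ.* (q ℤ.- r ℤ.- 1ℤ) ℤ.- H) ℤ.- (((p ℤ.- r) ℤ.* (p ℤ.- r ℤ.- 1ℤ) ℤ.- 0ℤ)
        ℤ.+ ((q ℤ.- p) ℤ.* (q ℤ.- p ℤ.- 1ℤ) ℤ.- H))
      ≡ + 2 ℤ.* ((p ℤ.- r) ℤ.* (q ℤ.- p))
    lem = solve-∀
    eq : h a b ℤ.- (h a j ℤ.+ h j b) ≡ + 2 ℤ.* gain j a b
    eq rewrite u | π-down≡ (≤-trans (proj₂ ij) (n≤1+n m)) u = lem (ρ a) (ρ j) (π b) (upCost (up b))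

  *-mono-tight : ∀ {x y x′ y′ : ℤ} → 0ℤ ℤ.< x → 0ℤ ℤ.< y → x ℤ.≤ x′ → y ℤ.≤ y′ →
                 x ℤ.* y ℤ.≤ x′ ℤ.* y′ × (x ℤ.* y ≡ x′ ℤ.* y′ → x ≡ x′ × y ≡ y′)
  *-mono-tight {x} {y} {x′} {y′} px py x≤ y≤ = ℤ.≤-trans s₁ s₂ , tight
    where
    instance
      _ = ℤ.positive px
      _ = ℤ.positive py
      _ = ℤ.positive (ℤ.<-≤-trans py y≤)
    s₁ : x ℤ.* y ℤ.≤ x ℤ.* y′
    s₁ = ℤ.*-monoˡ-≤-nonNeg x {{ℤ.nonNegative (ℤ.<⇒≤ px)}} y≤
    s₂ : x ℤ.* y′ ℤ.≤ x′ ℤ.* y′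
    s₂ = ℤ.*-monoʳ-≤-nonNeg y′ {{ℤ.nonNegative (ℤ.<⇒≤ (ℤ.<-≤-trans py y≤))}} x≤
    tight : x ℤ.* y ≡ x′ ℤ.* y′ → x ≡ x′ × y ≡ y′
    tight e with x ℤ.≟ x′ | y ℤ.≟ y′
    ... | yes p | yes q = p , q
    ... | no p | _ = ⊥-elim (ℤ.<-irrefl e (ℤ.≤-<-trans s₁ (ℤ.*-monoʳ-<-pos y′ (ℤ.≤∧≢⇒< x≤ p))))
    ... | yes p | no q = ⊥-elim (ℤ.<-irrefl e (ℤ.<-≤-trans (ℤ.*-monoˡ-<-pos x (ℤ.≤∧≢⇒< y≤ q)) s₂))

  -- A label visited for only one of the sets `A ⊆ B` betrays its kind: it is up if visited for `B`,
  -- down if visited for `A`. Where the neighbours differ, the one nearer to `j` is such a label,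
  -- and the monotonicity of `ρ` for its kind gives the inequality.
  left-mono : ∀ {A B j a a′} → j ≤ m → (∀ i → Inner i → A i ≡ true → B i ≡ true) →
              LeftNbr A j a → LeftNbr B j a′ → ρ a′ ℤ.≤ ρ a × (ρ a′ ≡ ρ a → a ≡ a′)
  left-mono {A} {B} {j} {a} {a′} j≤m sub (leftNbr a<j al d) (leftNbr a′<j al′ d′) with <-cmp a a′
  ... | tri≈ _ refl _ = ℤ.≤-refl , λ _ → refl
  ... | tri< a<a′ _ _ = ℤ.<⇒≤ lt , λ e → ⊥-elim (ℤ.<-irrefl e lt)
    where
    ia : Inner a′
    ia = ≤-trans (s≤s z≤n) a<a′ , ≤-trans (<⇒≤ a′<j) j≤m
    u : up a′ ≡ true
    u with bool (up a′)
    ... | inj₁ e = e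
    ... | inj₂ e = ⊥-elim (true≢false
      (sub a′ ia (trans (dead⇒ A ia (d a′ a<a′ a′<j)) (cong not e))) (trans (alive⇒ B ia al′) e))
    lt = ρ-up a<a′ (≤-trans (proj₂ ia) (n≤1+n m)) u
  ... | tri> _ _ a′<a = ℤ.<⇒≤ lt , λ e → ⊥-elim (ℤ.<-irrefl e lt)
    where
    ia : Inner a
    ia = ≤-trans (s≤s z≤n) a′<a , ≤-trans (<⇒≤ a<j) j≤m
    u : up a ≡ false
    u with bool (up a)
    ... | inj₂ e = e
    ... | inj₁ e = ⊥-elim (true≢false
      (sub a ia (trans (alive⇒ A ia al) e)) (trans (dead⇒ B ia (d′ a a′<a a<j)) (cong not e)))
    lt = ρ-down a′<a (≤-trans (proj₂ ia) (n≤1+n m)) u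

  right-mono : ∀ {A B j b b′} → 1 ≤ j → (∀ i → Inner i → A i ≡ true → B i ≡ true) →
               RightNbr A j b → RightNbr B j b′ → π b ℤ.≤ π b′ × (π b ≡ π b′ → b ≡ b′)
  right-mono {A} {B} {j} {b} {b′} 1≤j sub (rightNbr j<b b≤ al d) (rightNbr j<b′ b′≤ al′ d′) with <-cmp b b′
  ... | tri≈ _ refl _ = ℤ.≤-refl , λ _ → refl
  ... | tri< b<b′ _ _ = ℤ.<⇒≤ lt , λ e → ⊥-elim (ℤ.<-irrefl e lt)
    where
    ib : Inner b
    ib = ≤-trans 1≤j (<⇒≤ j<b) , ≤-pred (≤-trans b<b′ b′≤)
    u : up b ≡ false
    u with bool (up b)
    ... | inj₂ e = e
    ... | inj₁ e = ⊥-elim (true≢false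
      (sub b ib (trans (alive⇒ A ib al) e)) (trans (dead⇒ B ib (d′ b j<b b<b′)) (cong not e)))
    lt = π-down b<b′ b′≤ u
  ... | tri> _ _ b′<b = ℤ.<⇒≤ lt , λ e → ⊥-elim (ℤ.<-irrefl e lt)
    where
    ib : Inner b′
    ib = ≤-trans 1≤j (<⇒≤ j<b′) , ≤-pred (≤-trans b′<b b≤)
    u : up b′ ≡ true
    u with bool (up b′)
    ... | inj₁ e = e
    ... | inj₂ e = ⊥-elim (true≢false
      (sub b′ ib (trans (dead⇒ A ib (d b′ j<b′ b′<b)) (cong not e))) (trans (alive⇒ B ib al′) e))
    lt = π-up b′<b b≤ u

  <⇒0<- : ∀ {x y : ℤ} → x ℤ.< y → 0ℤ ℤ.< y ℤ.- x
  <⇒0<- {x} {y} p = subst (ℤ._< y ℤ.- x) (ℤ.+-inverseʳ x) (ℤ.+-monoˡ-< (ℤ.- x) p)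

  flip-product : ∀ r p q s → (p ℤ.- r) ℤ.* (q ℤ.- s) ≡ (r ℤ.- p) ℤ.* (s ℤ.- q)
  flip-product = solve-∀

  -‿injectiveʳ : ∀ z {x y : ℤ} → z ℤ.- x ≡ z ℤ.- y → x ≡ y
  -‿injectiveʳ z e = ℤ.neg-injective (∙-cancelˡ z _ _ e)

  -‿injectiveˡ : ∀ z {x y : ℤ} → x ℤ.- z ≡ y ℤ.- z → x ≡ y
  -‿injectiveˡ z e = ∙-cancelʳ (ℤ.- z) _ _ e

  -‿monoʳ : ∀ z {x y : ℤ} → x ℤ.≤ y → z ℤ.- y ℤ.≤ z ℤ.- x
  -‿monoʳ z p = ℤ.+-monoʳ-≤ z (ℤ.neg-mono-≤ p)

  -- Supermodularity of `f`, together with its equality case. For a down label both factors of the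
  -- area grow with the set; for an up label both shrink in absolute value, and the area is
  -- subtracted.
  gain-mono : ∀ {A B j a b a′ b′} → Inner j → (∀ i → Inner i → A i ≡ true → B i ≡ true) →
              LeftNbr A j a → RightNbr A j b → LeftNbr B j a′ → RightNbr B j b′ →
              gain j a b ℤ.≤ gain j a′ b′ × (gain j a b ≡ gain j a′ b′ → a ≡ a′ × b ≡ b′)
  gain-mono {A} {B} {j} {a} {b} {a′} {b′} ij sub La Rb La′ Rb′
    with left-mono (proj₂ ij) sub La La′ | right-mono (proj₁ ij) sub Rb Rb′
  ... | ρ≤ , ρ≡ | π≤ , π≡ with bool (up j)
  ...   | inj₂ u rewrite u = proj₁ mt , λ e →
            let p , q = proj₂ mt e in ρ≡ (sym (-‿injectiveʳ (ρ j) p)) , π≡ (-‿injectiveˡ (π j) q)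
    where
    mt = *-mono-tight (<⇒0<- (ρ-down (LeftNbr.a<j La) (≤-trans (proj₂ ij) (n≤1+n m)) u))
                      (<⇒0<- (π-down (RightNbr.j<b Rb) (RightNbr.b≤ Rb) u))
                      (-‿monoʳ (ρ j) ρ≤) (ℤ.+-monoˡ-≤ (ℤ.- π j) {π b} {π b′} π≤)
  ...   | inj₁ u rewrite u | flip-product (ρ a) (ρ j) (π b) (π j) | flip-product (ρ a′) (ρ j) (π b′) (π j) =
            -‿monoʳ N-1 (proj₁ mt) , λ e →
            let p , q = proj₂ mt (sym (-‿injectiveʳ N-1 e)) in ρ≡ (-‿injectiveˡ (ρ j) p) , π≡ (sym (-‿injectiveʳ (π j) q))
    where
    mt = *-mono-tight (<⇒0<- (ρ-up (LeftNbr.a<j La′) (≤-trans (proj₂ ij) (n≤1+n m)) u))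
                      (<⇒0<- (π-up (RightNbr.j<b Rb′) (RightNbr.b≤ Rb′) u))
                      (ℤ.+-monoˡ-≤ (ℤ.- ρ j) {ρ a′} {ρ a} ρ≤) (-‿monoʳ (π j) π≤)

  -- The inequality for every set of labels and its equality case

  restrict : (ℕ → Bool) → (ℕ → ℤ) → ℕ → ℤ
  restrict J x i = if J i then x i else 0ℤ

  total : (ℕ → ℤ) → (ℕ → Bool) → ℤ
  total x J = ∑ m (restrict J x ∘ suc)

  -- Sides of the polygon pass `Chk` vacuously, so this constrains only the diagonals on the path.
  EdgesIn : (ℕ → ℕ) → (ℕ → Bool) → Set
  EdgesIn K J = ∀ a b → Edge J a b → Chk K a b

  excess : (ℕ → ℤ) → (ℕ → Bool) → ℤ
  excess x J = + 2 ℤ.* total x J ℤ.- (f J ℤ.- f (λ _ → false))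

  record Tight (K : ℕ → ℕ) (x : ℕ → ℤ) (J : ℕ → Bool) : Set where
    constructor tight
    field
      excess≥0   : 0ℤ ℤ.≤ excess x J
      excess≡0⇒  : excess x J ≡ 0ℤ → EdgesIn K J
      ⇒excess≡0  : EdgesIn K J → excess x J ≡ 0ℤ

  total-cong : ∀ x J J′ → (∀ i → Inner i → J i ≡ J′ i) → total x J ≡ total x J′
  total-cong x J J′ e = ∑-cong m λ i i<m → cong (λ v → if v then x (suc i) else 0ℤ) (e (suc i) (s≤s z≤n , i<m))

  excess-cong : ∀ x J J′ → (∀ i → Inner i → J i ≡ J′ i) → excess x J ≡ excess x J′
  excess-cong x J J′ e = cong₂ (λ u v → + 2 ℤ.* u ℤ.- (v ℤ.- f (λ _ → false))) (total-cong x J J′ e) (f-cong J J′ e)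

  Tight-cong : ∀ {K x J J′} → (∀ i → Inner i → J i ≡ J′ i) → Tight K x J → Tight K x J′
  Tight-cong {K} {x} {J} {J′} e (tight p q r) = tight
    (subst (0ℤ ℤ.≤_) ee p)
    (λ z a b E → q (trans ee z) a b (Edge-cong (λ i ii _ _ → sym (e i ii)) E))
    (λ h → trans (sym ee) (r λ a b E → h a b (Edge-cong (λ i ii _ _ → e i ii) E)))
    where ee = excess-cong x J J′ e

  module _ (K : ℕ → ℕ) (K-inj : ∀ {i j} → Inner i → Inner j → K i ≡ K j → i ≡ j) where

    below-suc : ∀ {i j} → Inner i → Inner j → i ≢ j → below K (K j) i ≡ below K (suc (K j)) i
    below-suc {i} {j} ii ij ne = ≡-⇔
      (λ p → below-true K (<-trans (below⇒< K p) (n<1+n _)))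
      (λ p → below-true K (≤∧≢⇒< (≤-pred (below⇒< K p)) (ne ∘ K-inj ii ij)))

    -- The three sides of the triangle with middle label `j` lie on the paths of the thresholds
    -- `K j` and `K j + 1`, between which only `j` enters.
    nbrs-Chk : ∀ {j a b} → Inner j → LeftNbr (below K (K j)) j a → RightNbr (below K (K j)) j b →
               Chk K a b × Chk K a j × Chk K j b
    nbrs-Chk {j} {a} {b} ij L R′ with bool (up j)
    ... | inj₁ u = Edge-below⇒Chk (left-right⇒Edge L R′ (⇒dead _ ij (trans (below-false K ≤-refl) (sym (cong not u)))))
                 , Edge-below⇒Chk (left⇒Edge (proj₂ ij) L⁺ al) , Edge-below⇒Chk (right⇒Edge R⁺ al)
      where
      L⁺ = left-cong {J′ = below K (suc (K j))} (λ i ii _ p → below-suc ii ij (<⇒≢ p)) L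
      R⁺ = right-cong {J′ = below K (suc (K j))} (λ i ii p _ → below-suc ii ij (>⇒≢ p)) R′
      al = ⇒alive (below K (suc (K j))) ij (trans (below-true K ≤-refl) (sym u))
    ... | inj₂ u = Edge-below⇒Chk (left-right⇒Edge L⁺ R⁺ (⇒dead _ ij (trans (below-true K ≤-refl) (sym (cong not u)))))
                 , Edge-below⇒Chk (left⇒Edge (proj₂ ij) L al) , Edge-below⇒Chk (right⇒Edge R′ al)
      where
      L⁺ = left-cong {J′ = below K (suc (K j))} (λ i ii _ p → below-suc ii ij (<⇒≢ p)) L
      R⁺ = right-cong {J′ = below K (suc (K j))} (λ i ii p _ → below-suc ii ij (>⇒≢ p)) R′
      al = ⇒alive (below K (K j)) ij (trans (below-false K ≤-refl) (sym u))

    module _ (x : ℕ → ℤ)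
             (x-gain : ∀ {j a b} → Inner j → LeftNbr (below K (K j)) j a → RightNbr (below K (K j)) j b →
                       x j ≡ gain j a b) where

      total-insert : ∀ {J J′ j} → Inner j → (∀ i → Inner i → i ≢ j → J i ≡ J′ i) →
                     J j ≡ false → J′ j ≡ true → total x J′ ≡ total x J ℤ.+ x j
      total-insert {J} {J′} {suc j} ij off Jj J′j = ∑-update m j (proj₂ ij)
        (λ i i<m ne → cong (λ v → if v then x (suc i) else 0ℤ) (sym (off (suc i) (s≤s z≤n , i<m) (ne ∘ suc-injective))))
        lem
        where
        lem : restrict J′ x (suc j) ≡ restrict J x (suc j) ℤ.+ x (suc j)
        lem rewrite Jj | J′j = sym (ℤ.+-identityˡ (x (suc j)))

      -- As `J` lies inside `{K < K j}`, `gain-mono` bounds the increment of `f` by `2 x j`. The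
      -- excess therefore grows by `2 δ ≥ 0`, and it is 0 afterwards only if it was 0 before and `j`
      -- has the same neighbours for `J` as for the threshold set.
      insert-step : ∀ {J J′ j} → Inner j → (∀ i → Inner i → i ≢ j → J i ≡ J′ i) →
                    J j ≡ false → J′ j ≡ true → (∀ i → Inner i → J i ≡ true → below K (K j) i ≡ true) →
                    Tight K x J → Tight K x J′
      insert-step {J} {J′} {j} ij off Jj J′j sub (tight ge t⇒ ⇒t)
        with left-exists J j (proj₁ ij) | right-exists J j (proj₂ ij)
           | left-exists (below K (K j)) j (proj₁ ij) | right-exists (below K (K j)) j (proj₂ ij)
      ... | a , La | b , Rb | a′ , La′ | b′ , Rb′ = tight
          (subst (0ℤ ℤ.≤_) (sym exc) (ℤ.+-mono-≤ ge 2δ≥0))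
          (λ z → let p , q = +-tight ge 2δ≥0 (sym (trans (sym exc) z)) in
             fwd (t⇒ (sym p)) (proj₂ gm (δ≡0⇒ (sym q))))
          (λ h → let same , e = bwd h in
             trans exc (cong₂ ℤ._+_ (⇒t e) (cong (ℤ._*_ (+ 2)) (δ≡0 same))))
        where
        gm = gain-mono ij sub La Rb La′ Rb′
        xj : x j ≡ gain j a′ b′
        xj = x-gain ij La′ Rb′
        δ = gain j a′ b′ ℤ.- gain j a b
        2δ≥0 : 0ℤ ℤ.≤ + 2 ℤ.* δ
        2δ≥0 = ℤ.*-monoˡ-≤-nonNeg (+ 2) (ℤ.i≤j⇒0≤j-i (proj₁ gm))
        δ≡0⇒ : + 2 ℤ.* δ ≡ 0ℤ → gain j a b ≡ gain j a′ b′
        δ≡0⇒ e = sym (ℤ.i-j≡0⇒i≡j _ _ (ℤ.*-cancelˡ-≡ (+ 2) δ 0ℤ e))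
        δ≡0 : a ≡ a′ × b ≡ b′ → δ ≡ 0ℤ
        δ≡0 (refl , refl) = ℤ.+-inverseʳ (gain j a b)
        exc : excess x J′ ≡ excess x J ℤ.+ + 2 ℤ.* δ
        exc = trans (cong₂ (λ u v → + 2 ℤ.* u ℤ.- (v ℤ.- f (λ _ → false)))
                       (trans (total-insert ij off Jj J′j) (cong (ℤ._+_ (total x J)) xj))
                       (f-insert ij off Jj J′j La Rb))
                    (lem (total x J) (gain j a′ b′) (f J) (gain j a b) (f (λ _ → false)))
          where
          lem : ∀ t g F g′ c → + 2 ℤ.* (t ℤ.+ g) ℤ.- ((F ℤ.+ + 2 ℤ.* g′) ℤ.- c)
                             ≡ (+ 2 ℤ.* t ℤ.- (F ℤ.- c)) ℤ.+ + 2 ℤ.* (g ℤ.- g′)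
          lem = solve-∀
        -- An edge over or at `j` is determined by the neighbours of `j`, hence is a side of the
        -- triangle in `nbrs-Chk`.
        via-nbrs : ∀ {e f} {J₁ : ℕ → Bool} → (∀ i → Inner i → i ≢ j → J₁ i ≡ J i) → a ≡ a′ × b ≡ b′ →
                   Edge J₁ e f → e ≤ j → j ≤ f → Chk K e f
        via-nbrs {e} {f} off₁ (refl , refl) E e≤j j≤f with m≤n⇒m<n∨m≡n e≤j | m≤n⇒m<n∨m≡n j≤f
        ... | inj₂ refl | inj₂ refl = ⊥-elim (<-irrefl refl (Edge.a<b E))
        ... | inj₁ p | inj₁ q
          with left-unique La (left-cong (λ i ii _ r → off₁ i ii (<⇒≢ r)) (through⇒left E p q))
             | right-unique Rb (right-cong (λ i ii r _ → off₁ i ii (>⇒≢ r)) (through⇒right E p q))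
        ...   | refl | refl = proj₁ (nbrs-Chk ij La′ Rb′)
        via-nbrs {e} {f} off₁ (refl , refl) E e≤j j≤f | inj₁ p | inj₂ refl
          with left-unique La (left-cong (λ i ii _ r → off₁ i ii (<⇒≢ r)) (Edge⇒left E))
        ...   | refl = proj₁ (proj₂ (nbrs-Chk ij La′ Rb′))
        via-nbrs {e} {f} off₁ (refl , refl) E e≤j j≤f | inj₂ refl | inj₁ q
          with right-unique Rb (right-cong (λ i ii r _ → off₁ i ii (>⇒≢ r)) (Edge⇒right E))
        ...   | refl = proj₂ (proj₂ (nbrs-Chk ij La′ Rb′))
        fwd : EdgesIn K J → a ≡ a′ × b ≡ b′ → EdgesIn K J′
        fwd h same e f E with e ≤? j | j ≤? f
        ... | yes p | yes q = via-nbrs (λ i ii ne → sym (off i ii ne)) same E p q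
        ... | no p | _ = h e f (Edge-cong (λ i ii r _ → sym (off i ii λ { refl → p r })) E)
        ... | yes _ | no q = h e f (Edge-cong (λ i ii _ r → sym (off i ii λ { refl → q r })) E)
        -- On a chord of the path of `J′` that spans `j`, the label `j` is lower, and the labels
        -- outside `J′` are upper and so heavier than `j`. Along this chord `J` and `{K < K j}` thus
        -- differ at most at `j`.
        agrees : ∀ {e f} → Edge J′ e f → Chk K e f → e ≤ j → j ≤ f → ∀ i → Inner i → e ≤ i → i ≤ f →
                 i ≢ j → J i ≡ below K (K j) i
        agrees E C e≤j j≤f i ii e≤i i≤f ne with bool (J i)
        ... | inj₁ t = trans t (sym (sub i ii t))
        ... | inj₂ t = trans t (sym (below-false K (<⇒≤ (C
                (ij , e≤j , j≤f , trans (sym (Edge⇒R E ij e≤j j≤f)) J′j)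
                (ii , e≤i , i≤f , trans (sym (Edge⇒R E ii e≤i i≤f)) (trans (sym (off i ii ne)) t))))))
        a<j = LeftNbr.a<j La
        j<b = RightNbr.j<b Rb
        La⁺ : LeftNbr J′ j a
        La⁺ = left-cong (λ i ii _ r → off i ii (<⇒≢ r)) La
        Rb⁺ : RightNbr J′ j b
        Rb⁺ = right-cong (λ i ii r _ → off i ii (>⇒≢ r)) Rb
        -- An up `j` is visited by the path of `J′`, and its two edges reach the two neighbours;
        -- over a down `j` a single edge spans both.
        same-nbrs : EdgesIn K J′ → a ≡ a′ × b ≡ b′
        same-nbrs h with bool (up j)
        ... | inj₁ u = left-unique (left-cong (λ i ii p q → agrees E₁ (h _ _ E₁) (<⇒≤ a<j) ≤-refl i ii p (<⇒≤ q) (<⇒≢ q)) La) La′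
                     , right-unique (right-cong (λ i ii p q → agrees E₂ (h _ _ E₂) ≤-refl (<⇒≤ j<b) i ii (<⇒≤ p) q (>⇒≢ p)) Rb) Rb′
          where
          al = ⇒alive J′ ij (trans J′j (sym u))
          E₁ = left⇒Edge (proj₂ ij) La⁺ al
          E₂ = right⇒Edge Rb⁺ al
        ... | inj₂ u = left-unique (left-cong (λ i ii p q → ag i ii p (<⇒≤ (<-trans q j<b)) (<⇒≢ q)) La) La′
                     , right-unique (right-cong (λ i ii p q → ag i ii (<⇒≤ (<-trans a<j p)) q (>⇒≢ p)) Rb) Rb′
          where
          E = left-right⇒Edge La⁺ Rb⁺ (⇒dead J′ ij (trans J′j (cong not (sym u))))
          ag = agrees E (h _ _ E) (<⇒≤ a<j) (<⇒≤ j<b)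
        bwd : EdgesIn K J′ → (a ≡ a′ × b ≡ b′) × EdgesIn K J
        bwd h = same , all
          where
          same = same-nbrs h
          all : EdgesIn K J
          all e f E with e ≤? j | j ≤? f
          ... | yes p | yes q = via-nbrs (λ i ii ne → refl) same E p q
          ... | no p | _ = h e f (Edge-cong (λ i ii r _ → off i ii λ { refl → p r }) E)
          ... | yes _ | no q = h e f (Edge-cong (λ i ii _ r → off i ii λ { refl → q r }) E)

      cut : (ℕ → Bool) → ℕ → ℕ → Bool
      cut J t i = J i ∧ below K t i

      cut⇒ : ∀ {J t i} → cut J t i ≡ true → J i ≡ true × K i < t
      cut⇒ {J} {t} {i} e with J i | below K t i in r
      ... | true | true = refl , below⇒< K r

      ⇒cut : ∀ {J t i} → J i ≡ true → K i < t → cut J t i ≡ true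
      ⇒cut e p rewrite e = below-true K p

      ¬cut : ∀ {J t i} → ¬ (J i ≡ true × K i < t) → cut J t i ≡ false
      ¬cut {J} {t} {i} n with bool (cut J t i)
      ... | inj₁ e = ⊥-elim (n (cut⇒ {J} e))
      ... | inj₂ e = e

      -- The elements of `J` are inserted by increasing weight, so each one meets only lighter ones,
      -- as `insert-step` requires. Injectivity of `K` lets at most one label enter per threshold.
      tight-cut : ∀ J t → Tight K x (cut J t)
      tight-cut J zero = tight (ℤ.≤-reflexive (sym e0)) (λ _ → ed) (λ _ → e0)
        where
        none : ∀ i → cut J 0 i ≡ false
        none i = ¬cut {J} λ { (_ , ()) }
        e0 : excess x (cut J 0) ≡ 0ℤ
        e0 = trans (excess-cong x (cut J 0) (λ _ → false) λ i _ → none i)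
               (trans (cong₂ (λ u v → + 2 ℤ.* u ℤ.- v) (∑-0 m) (ℤ.+-inverseʳ (f (λ _ → false)))) refl)
        ed : EdgesIn K (cut J 0)
        -- `{K < 0}` is empty as well, so the path of the empty set is a threshold path.
        ed a b E = Edge-below⇒Chk {t = 0} (Edge-cong (λ i _ _ _ → trans (none i) (sym (below-false K z≤n))) E)
      tight-cut J (suc t) with tight-cut J t | search (λ j → (K j ≟ t) ×-dec (J j Bool.≟ true))
      ... | ih | inj₁ (j , ij , refl , Jj) = insert-step ij off (¬cut {J} λ { (_ , p) → <-irrefl refl p })
              (⇒cut {J} Jj ≤-refl) (λ i _ e → below-true K (proj₂ (cut⇒ {J} e))) ih
        where
        off : ∀ i → Inner i → i ≢ j → cut J t i ≡ cut J (suc t) i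
        off i ii ne = cong (J i ∧_) (below-suc ii ij ne)
      ... | ih | inj₂ none = Tight-cong same ih
        where
        same : ∀ i → Inner i → cut J t i ≡ cut J (suc t) i
        same i ii = ≡-⇔
          (λ e → let p , q = cut⇒ {J} e in ⇒cut {J} p (<-trans q (n<1+n t)))
          (λ e → let p , q = cut⇒ {J} e in ⇒cut {J} p (≤∧≢⇒< (≤-pred q) λ k → none i ii (k , p)))

      greedy-tight : ∀ J → Tight K x J
      greedy-tight J with bound K (suc m)
      ... | B , lt = Tight-cong (λ i ii → ≡-⇔ (λ e → proj₁ (cut⇒ {J} e)) (λ e → ⇒cut {J} e (lt i (s≤s (proj₂ ii)))))
                                (tight-cut J B)

-- Counting

cnt : (ℕ → Bool) → ℕ → ℕ
cnt p zero    = 0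
cnt p (suc k) = if p (suc k) then suc (cnt p k) else cnt p k

cnt-true : ∀ p {k} → p (suc k) ≡ true → cnt p (suc k) ≡ suc (cnt p k)
cnt-true p e rewrite e = refl

cnt-false : ∀ p {k} → p (suc k) ≡ false → cnt p (suc k) ≡ cnt p k
cnt-false p e rewrite e = refl

count : (ℕ → Bool) → List ℕ → ℕ
count p xs = length (filter (λ j → p j Bool.≟ true) xs)

count-∷ʳ : ∀ p xs x → count p (xs ∷ʳ x) ≡ (if p x then suc (count p xs) else count p xs)
count-∷ʳ p xs x = trans (cong length (filter-++ P? xs (x ∷ [])))
    (trans (length-++ (filter P? xs)) lem)
  where
  P? : ∀ j → Dec (p j ≡ true)
  P? j = p j Bool.≟ true
  lem : count p xs ℕ.+ count p (x ∷ []) ≡ (if p x then suc (count p xs) else count p xs)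
  lem with p x
  ... | true  = +-comm (count p xs) 1
  ... | false = +-identityʳ (count p xs)

-- Bridges `cnt`, which recurses from the top, and the lists of the definitions, which are built
-- from the bottom.
cnt-+ : ∀ p a k → cnt p a ℕ.+ count p (applyUpTo (λ i → suc a ℕ.+ i) k) ≡ cnt p (a ℕ.+ k)
cnt-+ p a zero = trans (+-identityʳ (cnt p a)) (cong (cnt p) (sym (+-identityʳ a)))
cnt-+ p a (suc k) = begin
  cnt p a ℕ.+ count p (applyUpTo g (suc k))   ≡⟨ cong (λ xs → cnt p a ℕ.+ count p xs) (sym (applyUpTo-∷ʳ g k)) ⟩
  cnt p a ℕ.+ count p (applyUpTo g k ∷ʳ g k)  ≡⟨ cong (cnt p a ℕ.+_) (count-∷ʳ p (applyUpTo g k) (g k)) ⟩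
  cnt p a ℕ.+ (if p (g k) then suc c else c)  ≡⟨ lem (p (g k)) ⟩
  cnt p (suc (a ℕ.+ k))                       ≡⟨ cong (cnt p) (sym (+-suc a k)) ⟩
  cnt p (a ℕ.+ suc k)                         ∎
  where
  open ≡-Reasoning
  g : ℕ → ℕ
  g i = suc a ℕ.+ i
  c = count p (applyUpTo g k)
  lem : ∀ b → cnt p a ℕ.+ (if b then suc c else c) ≡ (if b then suc (cnt p (a ℕ.+ k)) else cnt p (a ℕ.+ k))
  lem true  = trans (+-suc (cnt p a) c) (cong suc (cnt-+ p a k))
  lem false = cnt-+ p a k

cnt-mono : ∀ p {a b} → a ≤ b → cnt p a ≤ cnt p b
cnt-mono p {a} {zero} z≤n = z≤n
cnt-mono p {a} {suc b} a≤b with m≤n⇒m<n∨m≡n a≤b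
... | inj₂ refl = ≤-refl
... | inj₁ a<b with p (suc b)
...   | true  = ≤-trans (cnt-mono p (≤-pred a<b)) (n≤1+n _)
...   | false = cnt-mono p (≤-pred a<b)

cnt-mono-< : ∀ p {a b} → a < b → p b ≡ true → cnt p a < cnt p b
cnt-mono-< p {a} {suc b} a<b pb rewrite pb = s≤s (cnt-mono p (≤-pred a<b))

cnt-surj : ∀ p k v → 1 ≤ v → v ≤ cnt p k → ∃ λ i → i ≤ k × p i ≡ true × cnt p i ≡ v
cnt-surj p zero v 1≤v v≤ = ⊥-elim (<⇒≱ 1≤v v≤)
cnt-surj p (suc k) v 1≤v v≤ with bool (p (suc k))
... | inj₂ e = let i , x , y = cnt-surj p k v 1≤v (subst (v ≤_) (cnt-false p e) v≤) in i , ≤-trans x (n≤1+n k) , y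
... | inj₁ e with v ≤? cnt p k
...   | yes w = let i , x , y = cnt-surj p k v 1≤v w in i , ≤-trans x (n≤1+n k) , y
...   | no ¬w = suc k , ≤-refl , e , trans (cnt-true p e) (≤-antisym (≰⇒> ¬w) (subst (v ≤_) (cnt-true p e) v≤))

cnt-not : ∀ p k → cnt (not ∘ p) k ℕ.+ cnt p k ≡ k
cnt-not p zero = refl
cnt-not p (suc k) with p (suc k)
... | true  = trans (+-suc _ _) (cong suc (cnt-not p k))
... | false = cong suc (cnt-not p k)

-- Evaluating the Boolean and list code of the definitions

if-true : ∀ {A : Set} {b} {x y : A} → b ≡ true → (if b then x else y) ≡ x
if-true refl = refl

if-false : ∀ {A : Set} {b} {x y : A} → b ≡ false → (if b then x else y) ≡ y
if-false refl = refl

∧-true : ∀ {u v} → u ∧ v ≡ true → u ≡ true × v ≡ true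
∧-true {true} {true} e = refl , refl

≡true⇒T : ∀ {b} → b ≡ true → T b
≡true⇒T refl = _

≡ᵇ-true : ∀ {a b} → a ≡ b → (a ≡ᵇ b) ≡ true
≡ᵇ-true {a} {b} e = dec-true (a ≟ b) e

≡ᵇ-false : ∀ {a b} → a ≢ b → (a ≡ᵇ b) ≡ false
≡ᵇ-false {a} {b} e = dec-false (a ≟ b) e

find-first : (ℕ → ℕ) → ℕ → List ℕ → ℕ
find-first q p = foldr (λ a r → if q a ≡ᵇ p then a else r) 0

-- A known preimage in the range rules out the default value 0 of the search.
find-first-spec : ∀ (q : ℕ → ℕ) p g k {a} → a < k → q (g a) ≡ p →
                  ∃ λ i → i < k × find-first q p (applyUpTo g k) ≡ g i × q (g i) ≡ p
find-first-spec q p g (suc k) {a} a<k e with q (g 0) ≟ p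
... | yes e₀ = 0 , s≤s z≤n , if-true (≡ᵇ-true e₀) , e₀
find-first-spec q p g (suc k) {zero} a<k e | no n = ⊥-elim (n e)
find-first-spec q p g (suc k) {suc a} (s≤s a<k) e | no n
  with find-first-spec q p (g ∘ suc) k a<k e
... | i , i<k , x , y = suc i , s≤s i<k , trans (if-false (≡ᵇ-false n)) x , y

allB-true : ∀ f g k → (∀ i → i < k → f (g i) ≡ true) → allB f (applyUpTo g k) ≡ true
allB-true f g zero h = refl
allB-true f g (suc k) h rewrite h 0 (s≤s z≤n) = allB-true f (g ∘ suc) k λ i i<k → h (suc i) (s≤s i<k)

allB-false : ∀ f g k i → i < k → f (g i) ≡ false → allB f (applyUpTo g k) ≡ false
allB-false f g (suc k) zero _ h rewrite h = refl
allB-false f g (suc k) (suc i) (s≤s i<k) h rewrite allB-false f (g ∘ suc) k i i<k h = Bool.∧-zeroʳ (f (g 0))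

-- Adding `y` back keeps truncated subtraction out of later computations; `mod-sub->` is the case
-- with wrap-around.
mod-sub-≤ : ∀ k {x y} → x < suc k → y ≤ x → (x ℕ.+ suc k ∸ y) % suc k ℕ.+ y ≡ x
mod-sub-≤ k {x} {y} x< y≤x = begin
  (x ℕ.+ suc k ∸ y) % suc k ℕ.+ y   ≡⟨ cong (λ z → z % suc k ℕ.+ y) (+-∸-comm (suc k) y≤x) ⟩
  (x ∸ y ℕ.+ suc k) % suc k ℕ.+ y   ≡⟨ cong (ℕ._+ y) ([m+n]%n≡m%n (x ∸ y) (suc k)) ⟩
  (x ∸ y) % suc k ℕ.+ y           ≡⟨ cong (ℕ._+ y) (m<n⇒m%n≡m (≤-<-trans (m∸n≤m x y) x<)) ⟩
  x ∸ y ℕ.+ y                     ≡⟨ m∸n+n≡m y≤x ⟩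
  x ∎
  where open ≡-Reasoning

mod-sub-> : ∀ k {x y} → x < y → y < suc k → (x ℕ.+ suc k ∸ y) % suc k ℕ.+ y ≡ x ℕ.+ suc k
mod-sub-> k {x} {y} x<y y< = trans (cong (ℕ._+ y) (m<n⇒m%n≡m lt)) (m∸n+n≡m y≤)
  where
  y≤ : y ≤ x ℕ.+ suc k
  y≤ = ≤-trans (<⇒≤ y<) (m≤n+m (suc k) x)
  lt : x ℕ.+ suc k ∸ y < suc k
  lt = +-cancelʳ-< y _ _ (subst (_< suc k ℕ.+ y) (sym (m∸n+n≡m y≤))
         (subst (_< suc k ℕ.+ y) (+-comm (suc k) x) (+-monoʳ-< (suc k) x<y)))

does⇒ : ∀ {A : Set} (d : Dec A) → does d ≡ true → A
does⇒ (yes a) _ = a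

+-move : ∀ {x y z} → x ℕ.+ y ≡ z → + x ≡ + z ℤ.- + y
+-move {x} {y} refl = lem (+ x) (+ y)
  where
  lem : ∀ u v → u ≡ (u ℤ.+ v) ℤ.- v
  lem = solve-∀

-- Indicators and cardinalities of diagonal sets

ι : Bool → ℤ
ι true  = 1ℤ
ι false = 0ℤ

χ : ∀ {A : Set} → Dec A → ℤ
χ d = ι (does d)

χ-yes : ∀ {A : Set} (d : Dec A) → A → χ d ≡ 1ℤ
χ-yes d a = cong ι (dec-true d a)

χ-no : ∀ {A : Set} (d : Dec A) → ¬ A → χ d ≡ 0ℤ
χ-no d a = cong ι (dec-false d a)

χ-cong : ∀ {A B : Set} (d : Dec A) (e : Dec B) → (A → B) → (B → A) → χ d ≡ χ e
χ-cong (yes a) e f g = sym (χ-yes e (f a))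
χ-cong (no ¬a) e f g = sym (χ-no e (¬a ∘ g))

χ-⊎ : ∀ {A B C : Set} (d : Dec A) (e : Dec B) (f : Dec C) → (A → B ⊎ C) → (B → A) → (C → A) → ¬ (B × C) →
      χ d ≡ χ e ℤ.+ χ f
χ-⊎ d (yes b) (yes c) x y z n = ⊥-elim (n (b , c))
χ-⊎ d (yes b) (no _)  x y z n = χ-yes d (y b)
χ-⊎ d (no _)  (yes c) x y z n = χ-yes d (z c)
χ-⊎ d (no ¬b) (no ¬c) x y z n = χ-no d λ a → lem (x a)
  where
  lem : _ ⊎ _ → ⊥
  lem (inj₁ b) = ¬b b
  lem (inj₂ c) = ¬c c

∑-χ< : ∀ k d → d ≤ k → ∑ k (λ i → χ (i <? d)) ≡ + d
∑-χ< k zero _ = trans (∑-cong k λ i _ → χ-no (i <? 0) λ ()) (∑-0 k)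
∑-χ< (suc k) (suc d) (s≤s d≤k) = cong (ℤ._+_ 1ℤ)
  (trans (∑-cong k λ i _ → χ-cong (suc i <? suc d) (i <? d) ≤-pred s≤s) (∑-χ< k d d≤k))

∑-sides : ∀ k d → d < k → ∑ k (λ p → ∑ k (λ q → χ ((q ≟ suc p) ×-dec (p <? d)))) ≡ + d
∑-sides k d d<k = trans (∑-cong k row) (∑-χ< k d (<⇒≤ d<k))
  where
  row : ∀ p → p < k → ∑ k (λ q → χ ((q ≟ suc p) ×-dec (p <? d))) ≡ χ (p <? d)
  row p p<k with p <? d
  ... | no ¬p = trans (∑-cong k λ q _ → χ-no ((q ≟ suc p) ×-dec (p <? d)) (¬p ∘ proj₂))
                      (trans (∑-0 k) (sym (χ-no (p <? d) ¬p)))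
  ... | yes p<d = trans (∑-update k {g = λ _ → 0ℤ} {1ℤ} (suc p) (≤-<-trans p<d d<k)
            (λ q _ ne → χ-no ((q ≟ suc p) ×-dec (p <? d)) (ne ∘ proj₁))
            (χ-yes ((suc p ≟ suc p) ×-dec (p <? d)) (refl , p<d)))
          (trans (cong (λ z → z ℤ.+ 1ℤ) (∑-0 k)) (sym (χ-yes (p <? d) p<d)))

length-filter-map : ∀ (S : DiagSet) p g k →
  + length (filter (λ pq → S (proj₁ pq) (proj₂ pq) Bool.≟ true) (List.map (p ,_) (applyUpTo g k)))
  ≡ ∑ k (λ i → ι (S p (g i)))
length-filter-map S p g zero = refl
length-filter-map S p g (suc k) with S p (g 0)
... | true  = cong (ℤ._+_ 1ℤ) (length-filter-map S p (g ∘ suc) k)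
... | false = trans (length-filter-map S p (g ∘ suc) k) (sym (ℤ.+-identityˡ _))

length-filter-product : ∀ (S : DiagSet) g k h l →
  + length (filter (λ pq → S (proj₁ pq) (proj₂ pq) Bool.≟ true) (cartesianProduct (applyUpTo g k) (applyUpTo h l)))
  ≡ ∑ k (λ i → ∑ l (λ j → ι (S (g i) (h j))))
length-filter-product S g zero h l = refl
length-filter-product S g (suc k) h l = trans
  (cong +_ (trans (cong length (filter-++ P? (List.map (g 0 ,_) (applyUpTo h l)) rest)) (length-++ (filter P? (List.map (g 0 ,_) (applyUpTo h l))))))
  (cong₂ ℤ._+_ (length-filter-map S (g 0) h l) (length-filter-product S (g ∘ suc) k h l))
  where
  P? : ∀ pq → Dec (S (proj₁ pq) (proj₂ pq) ≡ true)
  P? pq = S (proj₁ pq) (proj₂ pq) Bool.≟ true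
  rest = cartesianProduct (applyUpTo (g ∘ suc) k) (applyUpTo h l)

-- `range 0 n` includes `n`; well-formedness makes the extra row and column empty.
countD≡∑ : ∀ n S → WellFormed n S → + countD n S ≡ ∑ n (λ p → ∑ n (λ q → ι (S p q)))
countD≡∑ n S wf = trans (length-filter-product S (λ k → k) (suc n) (λ k → k) (suc n))
  (trans (∑-last n (λ p → ∑ (suc n) (λ q → ι (S p q))))
    (trans (cong₂ ℤ._+_ (∑-cong n λ p _ → trans (∑-last n (λ q → ι (S p q)))
                                    (trans (cong (ℤ._+_ (∑ n (λ q → ι (S p q)))) (off p n (λ d → <-irrefl refl (proj₁ (proj₂ d)))))
                                           (ℤ.+-identityʳ _)))
             (trans (∑-cong (suc n) λ q _ → off n q (λ d → <⇒≱ (<-trans (n<1+n n) (proj₁ d)) (<⇒≤ (proj₁ (proj₂ d)))))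
                    (∑-0 (suc n))))
           (ℤ.+-identityʳ _)))
  where
  off : ∀ p q → ¬ IsDiagonal n p q → ι (S p q) ≡ 0ℤ
  off p q nd with bool (S p q)
  ... | inj₁ t = ⊥-elim (nd (wf p q t))
  ... | inj₂ t = cong ι t

ι-mono : ∀ {u v} → (u ≡ true → v ≡ true) → ι u ℤ.≤ ι v
ι-mono {false} {false} h = ℤ.≤-refl
ι-mono {false} {true}  h = ℤ.+≤+ z≤n
ι-mono {true}  {v}     h rewrite h refl = ℤ.≤-refl

ι-injective : ∀ {u v} → ι u ≡ ι v → u ≡ v
ι-injective {false} {false} e = refl
ι-injective {true}  {true}  e = refl

⊆D-countD : ∀ n {S S′} → WellFormed n S → WellFormed n S′ → S ⊆D S′ → countD n S ≡ countD n S′ → S′ ⊆D S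
⊆D-countD n {S} {S′} wf wf′ sub e p q t = trans (ι-injective (pointwise)) t
  where
  D = wf′ p q t
  q< = proj₁ (proj₂ D)
  p< = <-trans (<-trans (n<1+n p) (proj₁ D)) q<
  sums : ∑ n (λ p → ∑ n (λ q → ι (S p q))) ≡ ∑ n (λ p → ∑ n (λ q → ι (S′ p q)))
  sums = trans (sym (countD≡∑ n S wf)) (trans (cong +_ e) (countD≡∑ n S′ wf′))
  rows = ∑-tight n (λ p _ → ∑-mono n λ q _ → ι-mono (sub p q)) sums p p<
  pointwise : ι (S p q) ≡ ι (S′ p q)
  pointwise = ∑-tight n (λ q _ → ι-mono (sub p q)) rows q q<

maxL-filter-≤ : ∀ (p : ℕ → Bool) f v g k → (∀ i → i < k → p (g i) ≡ true → f (g i) ≤ v) →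
                maxL (List.map f (filter (λ a → p a Bool.≟ true) (applyUpTo g k))) ≤ v
maxL-filter-≤ p f v g zero h = z≤n
maxL-filter-≤ p f v g (suc k) h with p (g 0) in e
... | true  = ⊔-lub (h 0 (s≤s z≤n) e) (maxL-filter-≤ p f v (g ∘ suc) k λ i i<k → h (suc i) (s≤s i<k))
... | false = maxL-filter-≤ p f v (g ∘ suc) k λ i i<k → h (suc i) (s≤s i<k)

≤-maxL-filter : ∀ (p : ℕ → Bool) f g k i → i < k → p (g i) ≡ true →
                f (g i) ≤ maxL (List.map f (filter (λ a → p a Bool.≟ true) (applyUpTo g k)))
≤-maxL-filter p f g (suc k) zero _ e with p (g 0)
... | true = m≤m⊔n (f (g 0)) _
≤-maxL-filter p f g (suc k) (suc i) (s≤s i<k) e with p (g 0)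
... | true  = ≤-trans (≤-maxL-filter p f (g ∘ suc) k i i<k e) (m≤n⊔m (f (g 0)) _)
... | false = ≤-maxL-filter p f (g ∘ suc) k i i<k e

∨-true : ∀ {u v} → u ∨ v ≡ true → u ≡ true ⊎ v ≡ true
∨-true {true}  e = inj₁ refl
∨-true {false} e = inj₂ e

∨-introˡ : ∀ {u v} → u ≡ true → u ∨ v ≡ true
∨-introˡ refl = refl

∨-introʳ : ∀ {u v} → v ≡ true → u ∨ v ≡ true
∨-introʳ {true}  e = refl
∨-introʳ {false} e = e

≡ᵇ⇒ : ∀ {a b} → (a ≡ᵇ b) ≡ true → a ≡ b
≡ᵇ⇒ {a} {b} e = ≡ᵇ⇒≡ a b (≡true⇒T e)

ι-≥0 : ∀ u → 0ℤ ℤ.≤ ι u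
ι-≥0 true  = ℤ.+≤+ z≤n
ι-≥0 false = ℤ.≤-refl

∑-≥0 : ∀ k {f} → (∀ i → i < k → 0ℤ ℤ.≤ f i) → 0ℤ ℤ.≤ ∑ k f
∑-≥0 k h = ℤ.≤-trans (ℤ.≤-reflexive (sym (∑-0 k))) (∑-mono k h)

-- The double index covers two uses: the diagonals of a set, indexed by pairs of positions, and the
-- thresholds of a weight, with `M = 1`.
missing : ℕ → ℕ → (ℕ → ℕ → ℕ → Bool) → ℕ → ℤ
missing B M J j = ∑ B (λ p → ∑ M (λ q → ι (not (J p q j))))

missing-≥0 : ∀ B M J j → 0ℤ ℤ.≤ missing B M J j
missing-≥0 B M J j = ∑-≥0 B λ p _ → ∑-≥0 M λ q _ → ι-≥0 (not (J p q j))

not-anti : ∀ {u v} → (v ≡ true → u ≡ true) → not u ≡ true → not v ≡ true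
not-anti {false} {false} h _ = refl
not-anti {false} {true}  h _ = h refl

missing-mono : ∀ B M J {i j} → (∀ p q → J p q j ≡ true → J p q i ≡ true) → missing B M J i ℤ.≤ missing B M J j
missing-mono B M J h = ∑-mono B λ p _ → ∑-mono M λ q _ → ι-mono (not-anti (h p q))

missing-tight : ∀ B M J {i j} → (∀ p q → J p q j ≡ true → J p q i ≡ true) → missing B M J i ≡ missing B M J j →
                ∀ {p q} → p < B → q < M → J p q i ≡ J p q j
missing-tight B M J {i} {j} h e {p} {q} p< q< = not-inj (ι-injective
    (∑-tight M (λ q _ → ι-mono (not-anti (h p q))) (∑-tight B (λ p _ → ∑-mono M λ q _ → ι-mono (not-anti (h p q))) e p p<) q q<))
  where
  not-inj : ∀ {u v} → not u ≡ not v → u ≡ v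
  not-inj {u} {v} e = trans (sym (not-involutive u)) (trans (cong not e) (not-involutive v))

+-cancelʳ-≤-ℤ : ∀ k {a b} → a ℤ.+ k ℤ.≤ b ℤ.+ k → a ℤ.≤ b
+-cancelʳ-≤-ℤ k {a} {b} le = subst₂ ℤ._≤_ (lem a k) (lem b k) (ℤ.+-monoˡ-≤ (ℤ.- k) le)
  where
  lem : ∀ a k → (a ℤ.+ k) ℤ.- k ≡ a
  lem = solve-∀

-- Integers in ℚ

coprime-1 : ∀ z → Coprime ℤ.∣ z ∣ 1
coprime-1 z = Coprimality.sym (Coprimality.1-coprimeTo ℤ.∣ z ∣)

toℚ≡ : ∀ z → toℚ z ≡ mkℚ z 0 (coprime-1 z)
toℚ≡ z = ℚ.↥p/↧p≡p (mkℚ z 0 (coprime-1 z))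

toℚᵘ-toℚ : ∀ z → toℚᵘ (toℚ z) ≡ mkℚᵘ z 0
toℚᵘ-toℚ z = cong toℚᵘ (toℚ≡ z)

toℚ-+ : ∀ a b → toℚ (a ℤ.+ b) ≡ toℚ a ℚ.+ toℚ b
toℚ-+ a b = ℚ.toℚᵘ-injective (ℚᵘ.≃-trans (ℚᵘ.≃-reflexive (toℚᵘ-toℚ (a ℤ.+ b)))
  (ℚᵘ.≃-trans (*≡* (lem a b)) (ℚᵘ.≃-sym (ℚᵘ.≃-trans (ℚ.toℚᵘ-homo-+ (toℚ a) (toℚ b))
    (ℚᵘ.≃-reflexive (cong₂ ℚᵘ._+_ (toℚᵘ-toℚ a) (toℚᵘ-toℚ b)))))))
  where
  lem : ∀ a b → (a ℤ.+ b) ℤ.* 1ℤ ≡ (a ℤ.* 1ℤ ℤ.+ b ℤ.* 1ℤ) ℤ.* 1ℤ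
  lem = solve-∀

toℚ-* : ∀ a b → toℚ (a ℤ.* b) ≡ toℚ a ℚ.* toℚ b
toℚ-* a b = ℚ.toℚᵘ-injective (ℚᵘ.≃-trans (ℚᵘ.≃-reflexive (toℚᵘ-toℚ (a ℤ.* b)))
  (ℚᵘ.≃-sym (ℚᵘ.≃-trans (ℚ.toℚᵘ-homo-* (toℚ a) (toℚ b))
    (ℚᵘ.≃-reflexive (cong₂ ℚᵘ._*_ (toℚᵘ-toℚ a) (toℚᵘ-toℚ b))))))

toℚ-mono : ∀ {a b} → a ℤ.≤ b → toℚ a ℚ.≤ toℚ b
toℚ-mono {a} {b} le = ℚ.toℚᵘ-cancel-≤ (subst₂ ℚᵘ._≤_ (sym (toℚᵘ-toℚ a)) (sym (toℚᵘ-toℚ b))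
  (*≤* (ℤ.*-monoʳ-≤-nonNeg 1ℤ le)))

toℚ-cancel : ∀ {a b} → toℚ a ℚ.≤ toℚ b → a ℤ.≤ b
toℚ-cancel {a} {b} le with subst₂ ℚᵘ._≤_ (toℚᵘ-toℚ a) (toℚᵘ-toℚ b) (ℚ.toℚᵘ-mono-≤ le)
... | *≤* p = subst₂ ℤ._≤_ (ℤ.*-identityʳ a) (ℤ.*-identityʳ b) p

*-↧ : ∀ q → q ℚ.* toℚ (↧ q) ≡ toℚ (↥ q)
*-↧ q@(mkℚ z d _) = ℚ.toℚᵘ-injective (ℚᵘ.≃-trans (ℚ.toℚᵘ-homo-* q (toℚ (↧ q)))
  (ℚᵘ.≃-trans (ℚᵘ.≃-reflexive (cong (mkℚᵘ z d ℚᵘ.*_) (toℚᵘ-toℚ (+ suc d))))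
    (ℚᵘ.≃-trans (*≡* (lem z (+ suc (d ℕ.* 1)) (+ suc d) (cong (λ w → + suc w) (*-identityʳ d))))
      (ℚᵘ.≃-reflexive (sym (toℚᵘ-toℚ z))))))
  where
  lem : ∀ z a b → a ≡ b → (z ℤ.* b) ℤ.* 1ℤ ≡ z ℤ.* a
  lem z a _ refl = ℤ.*-identityʳ (z ℤ.* a)

pos-toℚ : ∀ d → ℚ.Positive (toℚ (+ suc d))
pos-toℚ d = subst ℚ.Positive (sym (toℚ≡ (+ suc d))) _

dot-toℚ : ∀ k (z x : ℕ → ℤ) →
          dot (tabulate {n = k} (λ i → toℚ (z (toℕ i)))) (Vec.map toℚ (tabulate (λ i → x (toℕ i)))) ≡ toℚ (∑ k (λ i → z i ℤ.* x i))
dot-toℚ zero z x = refl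
dot-toℚ (suc k) z x = trans (cong₂ ℚ._+_ (sym (toℚ-* (z 0) (x 0))) (dot-toℚ k (z ∘ suc) (x ∘ suc)))
  (sym (toℚ-+ (z 0 ℤ.* x 0) (∑ k (λ i → z (suc i) ℤ.* x (suc i)))))

-- Maximisers are invariant under positive scaling, so an integral functional can stand in for a
-- rational one. The factor `suc d` is the product of the denominators.
clear-denominators : ∀ k (c : Vec ℚ k) → ∃ λ d → ∃ λ (z : ℕ → ℤ) → ∀ (x : ℕ → ℤ) →
  dot c (Vec.map toℚ (tabulate (λ i → x (toℕ i)))) ℚ.* toℚ (+ suc d) ≡ toℚ (∑ k (λ i → z i ℤ.* x i))
clear-denominators zero [] = 0 , (λ _ → 0ℤ) , λ x → ℚ.*-zeroˡ (toℚ 1ℤ)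
clear-denominators (suc k) (q ∷ c) with clear-denominators k c
-- The successor of this number is `suc d * ↧ₙ q`.
... | d , z , eq = ℚ.denominator-1 q ℕ.+ d ℕ.* ↧ₙ q , z′ , eq′
  where
  z′ : ℕ → ℤ
  z′ zero = ↥ q ℤ.* + suc d
  z′ (suc i) = ↧ q ℤ.* z i
  eq′ : ∀ x → dot (q ∷ c) (Vec.map toℚ (tabulate (λ i → x (toℕ i)))) ℚ.* toℚ (+ (suc d ℕ.* ↧ₙ q)) ≡ toℚ (∑ (suc k) (λ i → z′ i ℤ.* x i))
  eq′ x = begin
    (q ℚ.* toℚ (x 0) ℚ.+ r) ℚ.* toℚ (+ (suc d ℕ.* ↧ₙ q))          ≡⟨ cong (λ w → (q ℚ.* toℚ (x 0) ℚ.+ r) ℚ.* w) (trans (cong toℚ (ℤ.pos-* (suc d) (↧ₙ q))) (toℚ-* (+ suc d) (↧ q))) ⟩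
    (q ℚ.* X ℚ.+ r) ℚ.* (D ℚ.* E)                                 ≡⟨ ℚ.*-distribʳ-+ (D ℚ.* E) (q ℚ.* X) r ⟩
    (q ℚ.* X) ℚ.* (D ℚ.* E) ℚ.+ r ℚ.* (D ℚ.* E)                   ≡⟨ cong₂ ℚ._+_ first second ⟩
    toℚ (z′ 0 ℤ.* x 0) ℚ.+ toℚ (∑ k (λ i → z′ (suc i) ℤ.* x (suc i))) ≡⟨ sym (toℚ-+ (z′ 0 ℤ.* x 0) (∑ k (λ i → z′ (suc i) ℤ.* x (suc i)))) ⟩
    toℚ (∑ (suc k) (λ i → z′ i ℤ.* x i))                          ∎
    where
    open ≡-Reasoning
    r = dot c (Vec.map toℚ (tabulate (λ i → x (suc (toℕ i)))))
    X = toℚ (x 0)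
    D = toℚ (+ suc d)
    E = toℚ (↧ q)
    first : (q ℚ.* X) ℚ.* (D ℚ.* E) ≡ toℚ (z′ 0 ℤ.* x 0)
    first = begin
      (q ℚ.* X) ℚ.* (D ℚ.* E)        ≡⟨ cong₂ ℚ._*_ (ℚ.*-comm q X) (ℚ.*-comm D E) ⟩
      (X ℚ.* q) ℚ.* (E ℚ.* D)        ≡⟨ ℚ.*-assoc X q (E ℚ.* D) ⟩
      X ℚ.* (q ℚ.* (E ℚ.* D))  ≡⟨ cong (X ℚ.*_) (sym (ℚ.*-assoc q E D)) ⟩
      X ℚ.* ((q ℚ.* E) ℚ.* D)  ≡⟨ cong (λ w → X ℚ.* (w ℚ.* D)) (*-↧ q) ⟩
      X ℚ.* (toℚ (↥ q) ℚ.* D)  ≡⟨ cong (X ℚ.*_) (sym (toℚ-* (↥ q) (+ suc d))) ⟩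
      X ℚ.* toℚ (z′ 0)         ≡⟨ ℚ.*-comm X (toℚ (z′ 0)) ⟩
      toℚ (z′ 0) ℚ.* X         ≡⟨ sym (toℚ-* (z′ 0) (x 0)) ⟩
      toℚ (z′ 0 ℤ.* x 0)       ∎
    second : r ℚ.* (D ℚ.* E) ≡ toℚ (∑ k (λ i → z′ (suc i) ℤ.* x (suc i)))
    second = begin
      r ℚ.* (D ℚ.* E)                                ≡⟨ sym (ℚ.*-assoc r D E) ⟩
      (r ℚ.* D) ℚ.* E                                ≡⟨ cong (ℚ._* E) (eq (x ∘ suc)) ⟩
      toℚ (∑ k (λ i → z i ℤ.* x (suc i))) ℚ.* E      ≡⟨ sym (toℚ-* (∑ k (λ i → z i ℤ.* x (suc i))) (↧ q)) ⟩
      toℚ (∑ k (λ i → z i ℤ.* x (suc i)) ℤ.* ↧ q)    ≡⟨ cong toℚ (ℤ.*-comm (∑ k (λ i → z i ℤ.* x (suc i))) (↧ q)) ⟩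
      toℚ (↧ q ℤ.* ∑ k (λ i → z i ℤ.* x (suc i)))    ≡⟨ cong toℚ (sym (∑-*ˡ k (↧ q) (λ i → z i ℤ.* x (suc i)))) ⟩
      toℚ (∑ k (λ i → ↧ q ℤ.* (z i ℤ.* x (suc i))))  ≡⟨ cong toℚ (∑-cong k λ i _ → sym (ℤ.*-assoc (↧ q) (z i) (x (suc i)))) ⟩
      toℚ (∑ k (λ i → z′ (suc i) ℤ.* x (suc i)))     ∎

-- The labelled polygon

module Polygon (m : ℕ) (dir : Orientation) (1≤m : 1 ≤ m) where

  opaque
    up : ℕ → Bool
    up = isUp m dir

    up≡ : ∀ i → isUp m dir i ≡ up i
    up≡ i = refl

    posn : ℕ → ℕ
    posn = pos m dir

    posn≡ : ∀ a → pos m dir a ≡ posn a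
    posn≡ a = refl

    labl : ℕ → ℕ
    labl = lab m dir

    up⇒inner : ∀ {i} → up i ≡ true → 1 < i × i < m
    up⇒inner {i} e with ∧-true {1 <ᵇ i} e
    ... | p , q with ∧-true {i <ᵇ m} q
    ...   | r , _ = <ᵇ⇒< 1 i (≡true⇒T p) , <ᵇ⇒< i m (≡true⇒T r)

    up-mid : ∀ {i} → 1 < i → i < m → up i ≡ not (dir (i ∸ 1))
    up-mid {i} p q = trans (cong (_∧ ((i <ᵇ m) ∧ not (dir (i ∸ 1)))) (dec-true (1 <? i) p))
                           (cong (_∧ not (dir (i ∸ 1))) (dec-true (i <? m) q))

    down-0 : up 0 ≡ false
    down-0 = refl

    down-1 : up 1 ≡ false
    down-1 = refl

    pos-zero : posn 0 ≡ 0
    pos-zero = refl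

    posn-top : posn (suc m) ≡ suc (count (not ∘ up) (range 1 m))
    posn-top = if-true (≡ᵇ-true {suc m} refl)

    posn-down : ∀ a → suc a ≢ suc m → up (suc a) ≡ false → posn (suc a) ≡ count (not ∘ up) (range 1 (suc a))
    posn-down a ne dn = trans (if-false (≡ᵇ-false ne)) (if-true (cong not dn))

    posn-up : ∀ a → suc a ≢ suc m → up (suc a) ≡ true →
              posn (suc a) ≡ suc (count (not ∘ up) (range 1 m)) ℕ.+ count up (range (suc a) m)
    posn-up a ne u = trans (if-false (≡ᵇ-false ne)) (if-false (cong not u))

    labl≡ : ∀ p → labl p ≡ find-first posn p (applyUpTo (λ k → 0 ℕ.+ k) (suc (suc m)))
    labl≡ p = refl

  open Labels m up public

  down-≥m : ∀ {i} → m ≤ i → up i ≡ false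
  down-≥m {i} p with bool (up i)
  ... | inj₁ e = ⊥-elim (<⇒≱ (proj₂ (up⇒inner e)) p)
  ... | inj₂ e = e

  cd cu : ℕ → ℕ
  cd = cnt (not ∘ up)
  cu = cnt up

  cd+cu : ∀ k → cd k ℕ.+ cu k ≡ k
  cd+cu = cnt-not up

  cd-top : cd (suc m) ≡ suc (cd m)
  cd-top = cnt-true (not ∘ up) {m} (cong not (down-≥m (n≤1+n m)))

  countDown≡ : ∀ a → count (not ∘ up) (range 1 a) ≡ cd a
  countDown≡ a = cnt-+ (not ∘ up) 0 a

  pos-down : ∀ {a} → a ≤ suc m → up a ≡ false → posn a ≡ cd a
  pos-down {zero} _ _ = pos-zero
  pos-down {suc a} a≤ dn with suc a ≟ suc m
  ... | yes refl = trans posn-top (trans (cong suc (countDown≡ m)) (sym cd-top))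
  ... | no ne = trans (posn-down a ne dn) (countDown≡ (suc a))

  -- Up labels follow one another clockwise from 0, the `k`-th of them at position `N - k`.
  pos-up : ∀ {a} → up a ≡ true → posn a ℕ.+ cu a ≡ suc (suc m)
  pos-up {zero} u = ⊥-elim (true≢false u down-0)
  pos-up {suc a} u = begin
    posn (suc a) ℕ.+ cu (suc a)                                ≡⟨ cong₂ ℕ._+_ e (cnt-true up u) ⟩
    (suc (count (not ∘ up) (range 1 m)) ℕ.+ c) ℕ.+ suc (cu a)  ≡⟨ cong (λ z → (suc z ℕ.+ c) ℕ.+ suc (cu a)) (countDown≡ m) ⟩
    (suc (cd m) ℕ.+ c) ℕ.+ suc (cu a)                          ≡⟨ +-assoc (suc (cd m)) c (suc (cu a)) ⟩
    suc (cd m) ℕ.+ (c ℕ.+ suc (cu a))                          ≡⟨ cong (suc (cd m) ℕ.+_) (trans (+-suc c (cu a)) (cong suc (+-comm c (cu a)))) ⟩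
    suc (cd m) ℕ.+ suc (cu a ℕ.+ c)                            ≡⟨ cong (λ z → suc (cd m) ℕ.+ suc z) split ⟩
    suc (cd m) ℕ.+ suc (cu m)                                  ≡⟨ +-suc (suc (cd m)) (cu m) ⟩
    suc (suc (cd m ℕ.+ cu m))                                  ≡⟨ cong (λ z → suc (suc z)) (cd+cu m) ⟩
    suc (suc m)                                                ∎
    where
    open ≡-Reasoning
    a<m : suc a < m
    a<m = proj₂ (up⇒inner u)
    c = count up (range (suc a) m)
    e : posn (suc a) ≡ suc (count (not ∘ up) (range 1 m)) ℕ.+ c
    e = posn-up a (<⇒≢ (<-trans a<m (n<1+n m))) u
    split : cu a ℕ.+ c ≡ cu m
    split = trans (cnt-+ up a (m ∸ a)) (cong cu (m+[n∸m]≡n (≤-trans (n≤1+n a) (<⇒≤ a<m))))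

  up≤ : ∀ {a} → up a ≡ true → a ≤ suc m
  up≤ u = <⇒≤ (<-trans (proj₂ (up⇒inner u)) (n<1+n m))

  cu-pos : ∀ {a} → up a ≡ true → 1 ≤ cu a
  cu-pos {zero} u = ⊥-elim (true≢false u down-0)
  cu-pos {suc a} u = subst (1 ≤_) (sym (cnt-true up u)) (s≤s z≤n)

  +-flip-< : ∀ {x y u v w} → x ℕ.+ y ≡ w → u ℕ.+ v ≡ w → y < v → u < x
  +-flip-< {x} {y} {u} {v} p q y<v = +-cancelʳ-< y u x
    (<-≤-trans (+-monoʳ-< u y<v) (≤-reflexive (trans q (sym p))))

  pos-<-down : ∀ {a b} → a < b → b ≤ suc m → up a ≡ false → posn a < posn b
  pos-<-down {a} {b} a<b b≤ dn rewrite pos-down (≤-trans (<⇒≤ a<b) b≤) dn with bool (up b)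
  ... | inj₂ db rewrite pos-down b≤ db = cnt-mono-< (not ∘ up) a<b (cong not db)
  ... | inj₁ ub = +-cancelʳ-< (cu b) _ _ (subst (cd a ℕ.+ cu b <_) (sym (pos-up ub))
      (s≤s (≤-trans (+-monoˡ-≤ (cu b) (cnt-mono (not ∘ up) (<⇒≤ a<b))) (≤-trans (≤-reflexive (cd+cu b)) b≤))))

  pos-<-up : ∀ {a b} → a < b → b ≤ suc m → up a ≡ true → posn b < posn a
  pos-<-up {a} {b} a<b b≤ ua with bool (up b)
  ... | inj₁ ub = +-flip-< (pos-up ua) (pos-up ub) (cnt-mono-< up a<b ub)
  ... | inj₂ db rewrite pos-down b≤ db = +-cancelʳ-< (cu a) _ _ (subst (cd b ℕ.+ cu a <_) (sym (pos-up ua))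
      (s≤s (≤-trans (+-monoʳ-≤ (cd b) (cnt-mono up (<⇒≤ a<b))) (≤-trans (≤-reflexive (cd+cu b)) b≤))))

  pos< : ∀ {a} → a ≤ suc m → posn a < suc (suc m)
  pos< {a} a≤ with bool (up a)
  ... | inj₂ dn rewrite pos-down a≤ dn = s≤s (≤-trans (m≤m+n (cd a) (cu a)) (≤-trans (≤-reflexive (cd+cu a)) a≤))
  ... | inj₁ ua = <-≤-trans (m<m+n (posn a) (cu-pos ua)) (≤-reflexive (pos-up ua))

  pos-injective : ∀ {a b} → a ≤ suc m → b ≤ suc m → posn a ≡ posn b → a ≡ b
  pos-injective {a} {b} a≤ b≤ e with <-cmp a b
  ... | tri≈ _ p _ = p
  ... | tri< p _ _ with bool (up a)
  ...   | inj₁ u = ⊥-elim (<-irrefl (sym e) (pos-<-up p b≤ u))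
  ...   | inj₂ u = ⊥-elim (<-irrefl e (pos-<-down p b≤ u))
  pos-injective {a} {b} a≤ b≤ e | tri> _ _ p with bool (up b)
  ...   | inj₁ u = ⊥-elim (<-irrefl e (pos-<-up p a≤ u))
  ...   | inj₂ u = ⊥-elim (<-irrefl (sym e) (pos-<-down p a≤ u))

  pos-surjective : ∀ {p} → p < suc (suc m) → ∃ λ a → a ≤ suc m × posn a ≡ p
  pos-surjective {zero} _ = 0 , z≤n , pos-zero
  pos-surjective {suc p} p< with suc p ≤? cd (suc m)
  ... | yes le with cnt-surj (not ∘ up) (suc m) (suc p) (s≤s z≤n) le
  ...   | a , a≤ , d , e = a , a≤ , trans (pos-down a≤ (trans (sym (not-involutive (up a))) (cong not d))) e
  pos-surjective {suc p} p< | no ¬le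
    with cnt-surj up (suc m) (suc (suc m) ∸ suc p) (m<n⇒0<n∸m p<) small
    where
    small : suc (suc m) ∸ suc p ≤ cu (suc m)
    small = +-cancelʳ-≤ (suc p) _ _ (≤-trans (≤-reflexive (m∸n+n≡m (<⇒≤ p<)))
      (≤-trans (≤-reflexive (cong suc (sym (trans (+-comm (cu (suc m)) _) (cd+cu (suc m))))))
        (≤-trans (≤-reflexive (sym (+-suc (cu (suc m)) (cd (suc m))))) (+-monoʳ-≤ (cu (suc m)) (≰⇒> ¬le)))))
  ... | a , a≤ , u , e = a , a≤ , +-cancelʳ-≡ (cu a) _ _
          (trans (pos-up u) (sym (trans (cong (suc p ℕ.+_) e) (m+[n∸m]≡n (<⇒≤ p<)))))

  lab-spec : ∀ {p} → p < suc (suc m) → labl p ≤ suc m × posn (labl p) ≡ p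
  lab-spec {p} p< with pos-surjective p<
  ... | a , a≤ , e with find-first-spec posn p (λ k → 0 ℕ.+ k) (suc (suc m)) {a} (s≤s a≤) e
  ...   | i , i< , x , y rewrite labl≡ p | x = ≤-pred i< , y

  lab-pos : ∀ {a} → a ≤ suc m → labl (posn a) ≡ a
  lab-pos {a} a≤ with lab-spec (pos< a≤)
  ... | l≤ , e = pos-injective l≤ a≤ e

  N : ℕ
  N = suc (suc m)

  -- Lengths of the boundary paths

  module _ (i j : ℕ) where
    private
      pi = posn i
      pj = posn j

    ok : ℕ → Bool
    ok v = let l = labl v in if j <ᵇ i then l ≤ᵇ i else i ≤ᵇ l

    ccwLen cwLen : ℕ
    ccwLen = (pj ℕ.+ N ∸ pi) % N
    cwLen  = (pi ℕ.+ N ∸ pj) % N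

    verts : List ℕ
    verts = List.map (λ k → (pi ℕ.+ k) % N) (range 0 ccwLen)

    verts≡ : verts ≡ applyUpTo (λ k → (pi ℕ.+ k) % N) (suc ccwLen)
    verts≡ = map-applyUpTo (λ k → 0 ℕ.+ k) (λ k → (pi ℕ.+ k) % N) (suc ccwLen)

    opaque
      unfolding posn labl
      μ≡ : μ m dir i j ≡ (if allB ok verts then ccwLen else cwLen)
      μ≡ = refl

    μ-ccw : (∀ k → k ≤ ccwLen → ok ((pi ℕ.+ k) % N) ≡ true) → μ m dir i j ≡ ccwLen
    μ-ccw h = trans μ≡ (if-true {b = allB ok verts} (trans (cong (allB ok) verts≡)
      (allB-true ok (λ k → (pi ℕ.+ k) % N) (suc ccwLen) λ k k< → h k (≤-pred k<))))

    μ-cw : ∀ k → k ≤ ccwLen → ok ((pi ℕ.+ k) % N) ≡ false → μ m dir i j ≡ cwLen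
    μ-cw k k≤ h = trans μ≡ (if-false {b = allB ok verts} (trans (cong (allB ok) verts≡)
      (allB-false ok (λ k → (pi ℕ.+ k) % N) (suc ccwLen) k (s≤s k≤) h)))

    ok-left : j < i → ∀ {v} → ok v ≡ (labl v ≤ᵇ i)
    ok-left j<i = if-true (dec-true (j <? i) j<i)

    ok-right : i < j → ∀ {v} → ok v ≡ (i ≤ᵇ labl v)
    ok-right i<j = if-false (dec-false (j <? i) (<⇒≯ i<j))

    -- No position between those of `i` and `j` carries a label below `i`, so the counterclockwise
    -- path qualifies.
    μ-right-down : i < j → j ≤ suc m → up i ≡ false → μ m dir i j ℕ.+ pi ≡ pj
    μ-right-down i<j j≤ dn = trans (cong (ℕ._+ pi) (μ-ccw all-ok)) len
      where
      p<q = pos-<-down i<j j≤ dn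
      len : ccwLen ℕ.+ pi ≡ pj
      len = mod-sub-≤ (suc m) (pos< j≤) (<⇒≤ p<q)
      all-ok : ∀ k → k ≤ ccwLen → ok ((pi ℕ.+ k) % N) ≡ true
      all-ok k k≤ = trans (ok-right i<j) (dec-true (i ≤? labl v) (≮⇒≥ absurd))
        where
        v = (pi ℕ.+ k) % N
        pk≤ : pi ℕ.+ k ≤ pj
        pk≤ = ≤-trans (≤-reflexive (+-comm pi k)) (≤-trans (+-monoˡ-≤ pi k≤) (≤-reflexive len))
        v≡ : v ≡ pi ℕ.+ k
        v≡ = m<n⇒m%n≡m (≤-<-trans pk≤ (pos< j≤))
        l = labl v
        pl : posn l ≡ pi ℕ.+ k
        pl = trans (proj₂ (lab-spec (≤-<-trans (≤-reflexive v≡) (≤-<-trans pk≤ (pos< j≤))))) v≡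
        absurd : l < i → ⊥
        absurd l<i with bool (up l)
        ... | inj₁ u = <⇒≱ (pos-<-up (<-trans l<i i<j) j≤ u) (≤-trans (≤-reflexive pl) pk≤)
        ... | inj₂ d = <⇒≱ (pos-<-down l<i (≤-trans (<⇒≤ i<j) j≤) d) (≤-trans (m≤m+n pi k) (≤-reflexive (sym pl)))

    -- Counterclockwise from an up label the path meets position 0 after `N ∸ pi` steps, and the
    -- label 0 there is too small.
    μ-right-up : i < j → j ≤ suc m → up i ≡ true → μ m dir i j ℕ.+ pj ≡ pi
    μ-right-up i<j j≤ u = trans (cong (ℕ._+ pj) (μ-cw (N ∸ pi) k≤ bad)) (mod-sub-≤ (suc m) pi< (<⇒≤ q<p))
      where
      pi< = pos< (≤-trans (<⇒≤ i<j) j≤)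
      q<p = pos-<-up i<j j≤ u
      len : ccwLen ℕ.+ pi ≡ pj ℕ.+ N
      len = mod-sub-> (suc m) q<p pi<
      k≤ : N ∸ pi ≤ ccwLen
      k≤ = +-cancelʳ-≤ pi _ _ (≤-trans (≤-reflexive (m∸n+n≡m (<⇒≤ pi<))) (≤-trans (m≤n+m N pj) (≤-reflexive (sym len))))
      v≡ : (pi ℕ.+ (N ∸ pi)) % N ≡ 0
      v≡ = trans (cong (_% N) (m+[n∸m]≡n (<⇒≤ pi<))) ([m+n]%n≡m%n 0 N)
      bad : ok ((pi ℕ.+ (N ∸ pi)) % N) ≡ false
      bad = trans (cong ok v≡) (trans (ok-right i<j) (trans (cong (i ≤ᵇ_) (trans (cong labl (sym pos-zero)) (lab-pos {0} z≤n)))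
              (dec-false (i ≤? 0) (<⇒≱ (<-trans (s≤s z≤n) (proj₁ (up⇒inner u)))))))

    -- The counterclockwise path runs through smaller up labels and, if `j` is down, on through
    -- position 0 along the down labels up to `j`.
    μ-left-up : j < i → up i ≡ true →
                (up j ≡ true → μ m dir i j ℕ.+ pi ≡ pj) × (up j ≡ false → μ m dir i j ℕ.+ pi ≡ pj ℕ.+ N)
    μ-left-up j<i u = (λ uj → trans (cong (ℕ._+ pi) (μ-ccw all-ok)) (len-up uj))
                    , (λ dj → trans (cong (ℕ._+ pi) (μ-ccw all-ok)) (len-down dj))
      where
      i≤ = up≤ u
      pi< = pos< i≤
      pj< = pos< (≤-trans (<⇒≤ j<i) i≤)
      len-up : up j ≡ true → ccwLen ℕ.+ pi ≡ pj
      len-up uj = mod-sub-≤ (suc m) pj< (<⇒≤ (pos-<-up j<i i≤ uj))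
      len-down : up j ≡ false → ccwLen ℕ.+ pi ≡ pj ℕ.+ N
      len-down dj = mod-sub-> (suc m) (pos-<-down j<i i≤ dj) pi<
      all-ok : ∀ k → k ≤ ccwLen → ok ((pi ℕ.+ k) % N) ≡ true
      all-ok k k≤ = trans (ok-left j<i) (dec-true (labl v ≤? i) (≮⇒≥ absurd))
        where
        v = (pi ℕ.+ k) % N
        pk≤ : pi ℕ.+ k ≤ ccwLen ℕ.+ pi
        pk≤ = ≤-trans (≤-reflexive (+-comm pi k)) (+-monoˡ-≤ pi k≤)
        l = labl v
        absurd : i < l → ⊥
        absurd i<l with pi ℕ.+ k <? N
        ... | yes lt = <⇒≱ (pos-<-up i<l (proj₁ sp) u)
                (≤-trans (m≤m+n pi k) (≤-reflexive (sym (trans (proj₂ sp) (m<n⇒m%n≡m lt)))))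
          where sp = lab-spec (subst (_< N) (sym (m<n⇒m%n≡m lt)) lt)
        ... | no ge with bool (up j)
        ...   | inj₁ uj = ge (≤-<-trans (≤-trans pk≤ (≤-reflexive (len-up uj))) pj<)
        ...   | inj₂ dj = <⇒≱ (pos-<-down (<-trans j<i i<l) (proj₁ sp) dj)
                            (≤-trans (≤-reflexive (trans (proj₂ sp) v≡)) w≤)
          where
          w = pi ℕ.+ k ∸ N
          w+N : w ℕ.+ N ≡ pi ℕ.+ k
          w+N = m∸n+n≡m (≮⇒≥ ge)
          w≤ : w ≤ pj
          w≤ = +-cancelʳ-≤ N _ _ (≤-trans (≤-reflexive w+N) (≤-trans pk≤ (≤-reflexive (len-down dj))))
          w< = ≤-<-trans w≤ pj<
          v≡ : v ≡ w
          v≡ = trans (cong (_% N) (sym w+N)) (trans ([m+n]%n≡m%n w N) (m<n⇒m%n≡m w<))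
          sp = lab-spec (subst (_< N) (sym v≡) w<)

    -- The counterclockwise path meets `m + 1`, a label too large, after `pt ∸ pi` steps.
    μ-left-down : j < i → i ≤ m → up i ≡ false →
                  (up j ≡ false → μ m dir i j ℕ.+ pj ≡ pi) × (up j ≡ true → μ m dir i j ℕ.+ pj ≡ pi ℕ.+ N)
    μ-left-down j<i i≤m dn = (λ dj → trans (cong (ℕ._+ pj) (cw (k≤-down dj))) (mod-sub-≤ (suc m) pi< (<⇒≤ (pos-<-down j<i i≤ dj))))
                           , (λ uj → trans (cong (ℕ._+ pj) (cw (k≤-up uj))) (mod-sub-> (suc m) (pos-<-up j<i i≤ uj) pj<))
      where
      i≤ = ≤-trans i≤m (n≤1+n m)
      pi< = pos< i≤
      pj< = pos< (≤-trans (<⇒≤ j<i) i≤)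
      pt = posn (suc m)
      pi<pt : pi < pt
      pi<pt = pos-<-down (s≤s i≤m) ≤-refl dn
      k≤-down : up j ≡ false → pt ∸ pi ≤ ccwLen
      k≤-down dj = +-cancelʳ-≤ pi _ _ (≤-trans (≤-reflexive (m∸n+n≡m (<⇒≤ pi<pt)))
        (≤-trans (≤-trans (<⇒≤ (pos< {suc m} ≤-refl)) (m≤n+m N pj)) (≤-reflexive (sym (mod-sub-> (suc m) (pos-<-down j<i i≤ dj) pi<)))))
      k≤-up : up j ≡ true → pt ∸ pi ≤ ccwLen
      k≤-up uj = +-cancelʳ-≤ pi _ _ (≤-trans (≤-reflexive (m∸n+n≡m (<⇒≤ pi<pt)))
        (≤-trans (<⇒≤ (pos-<-up (<-trans j<i (s≤s i≤m)) ≤-refl uj))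
          (≤-reflexive (sym (mod-sub-≤ (suc m) pj< (<⇒≤ (pos-<-up j<i i≤ uj)))))))
      v≡ : (pi ℕ.+ (pt ∸ pi)) % N ≡ pt
      v≡ = trans (cong (_% N) (m+[n∸m]≡n (<⇒≤ pi<pt))) (m<n⇒m%n≡m (pos< {suc m} ≤-refl))
      cw : pt ∸ pi ≤ ccwLen → μ m dir i j ≡ cwLen
      cw k≤ = μ-cw (pt ∸ pi) k≤ (trans (cong ok v≡) (trans (ok-left j<i)
                (trans (cong (_≤ᵇ i) (lab-pos {suc m} ≤-refl)) (dec-false (suc m ≤? i) (<⇒≱ (s≤s i≤m))))))

  -- Unrolled positions

  opaque
    -- Up labels receive the positions `-1, -2, ...` reached clockwise from 0, so that lengths of
    -- boundary paths to smaller labels are differences of `ρ`, with no reduction modulo `N`.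
    ρ : ℕ → ℤ
    ρ a = if up a then ℤ.- (+ cu a) else + cd a

    π : ℕ → ℤ
    π a = + posn a

    π≡ : ∀ a → π a ≡ + posn a
    π≡ a = refl

    ρ≡up : ∀ {a} → up a ≡ true → ρ a ≡ ℤ.- (+ cu a)
    ρ≡up = if-true

    ρ≡down : ∀ {a} → up a ≡ false → ρ a ≡ + cd a
    ρ≡down = if-false

  π-down≡ : ∀ {a} → a ≤ suc m → up a ≡ false → π a ≡ ρ a
  π-down≡ {a} a≤ d = trans (π≡ a) (trans (cong +_ (pos-down a≤ d)) (sym (ρ≡down d)))

  π-up≡ : ∀ {a} → a ≤ suc m → up a ≡ true → π a ≡ ρ a ℤ.+ (1ℤ ℤ.+ + suc m)
  π-up≡ {a} a≤ u = trans (π≡ a) (trans (+-move (pos-up u))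
    (trans (ℤ.+-comm (+ N) (ℤ.- (+ cu a))) (cong (λ z → z ℤ.+ + N) (sym (ρ≡up u)))))

  π-down : ∀ {a b} → a < b → b ≤ suc m → up a ≡ false → π a ℤ.< π b
  π-down {a} {b} p q r = subst₂ ℤ._<_ (sym (π≡ a)) (sym (π≡ b)) (ℤ.+<+ (pos-<-down p q r))

  π-up : ∀ {a b} → a < b → b ≤ suc m → up a ≡ true → π b ℤ.< π a
  π-up {a} {b} p q r = subst₂ ℤ._<_ (sym (π≡ b)) (sym (π≡ a)) (ℤ.+<+ (pos-<-up p q r))

  neg≤pos : ∀ x y → ℤ.- (+ x) ℤ.≤ + y
  neg≤pos x y = ℤ.neg-≤-pos {x} {y}

  ρ-down : ∀ {a b} → a < b → b ≤ suc m → up b ≡ false → ρ a ℤ.< ρ b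
  ρ-down {a} {b} p q d with bool (up a)
  ... | inj₂ da = subst₂ ℤ._<_ (sym (ρ≡down da)) (sym (ρ≡down d)) (ℤ.+<+ (cnt-mono-< (not ∘ up) p (cong not d)))
  ... | inj₁ ua = subst₂ ℤ._<_ (sym (ρ≡up ua)) (sym (ρ≡down d))
          (ℤ.≤-<-trans (neg≤pos (cu a) 0) (ℤ.+<+ (≤-<-trans z≤n (cnt-mono-< (not ∘ up) p (cong not d)))))

  ρ-up : ∀ {a b} → a < b → b ≤ suc m → up b ≡ true → ρ b ℤ.< ρ a
  ρ-up {a} {b} p q u with bool (up a)
  ... | inj₁ ua = subst₂ ℤ._<_ (sym (ρ≡up u)) (sym (ρ≡up ua)) (ℤ.neg-mono-< (ℤ.+<+ (cnt-mono-< up p u)))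
  ... | inj₂ da = subst₂ ℤ._<_ (sym (ρ≡up u)) (sym (ρ≡down da))
          (ℤ.<-≤-trans (ℤ.neg-mono-< (ℤ.+<+ (cu-pos u))) (ℤ.+≤+ (z≤n {cd a})))

  μ-right : ∀ {i j} → i < j → j ≤ suc m → + μ m dir i j ≡ (if up i then π i ℤ.- π j else π j ℤ.- π i)
  μ-right {i} {j} i<j j≤ with bool (up i)
  ... | inj₁ u = trans (+-move (μ-right-up i j i<j j≤ u)) (trans (sym (cong₂ ℤ._-_ (π≡ i) (π≡ j))) (sym (if-true u)))
  ... | inj₂ d = trans (+-move (μ-right-down i j i<j j≤ d)) (trans (sym (cong₂ ℤ._-_ (π≡ j) (π≡ i))) (sym (if-false d)))

  μ-left : ∀ {i j} → j < i → i ≤ m → + μ m dir i j ≡ (if up i then ρ j ℤ.- ρ i else ρ i ℤ.- ρ j)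
  μ-left {i} {j} j<i i≤m with bool (up i) | bool (up j)
  ... | inj₁ u | inj₁ uj = trans (+-move (proj₁ (μ-left-up i j j<i u) uj))
        (trans (cong₂ ℤ._-_ (trans (sym (π≡ j)) (π-up≡ (up≤ uj) uj)) (trans (sym (π≡ i)) (π-up≡ (up≤ u) u)))
          (trans (lem (ρ j) (ρ i) (1ℤ ℤ.+ + suc m)) (sym (if-true u))))
    where
    lem : ∀ x y z → (x ℤ.+ z) ℤ.- (y ℤ.+ z) ≡ x ℤ.- y
    lem = solve-∀
  ... | inj₁ u | inj₂ dj = trans (+-move (proj₂ (μ-left-up i j j<i u) dj))
        (trans (cong₂ ℤ._-_ (cong (λ z → z ℤ.+ + N) (trans (sym (π≡ j)) (π-down≡ (≤-trans (<⇒≤ j<i) (up≤ u)) dj)))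
                            (trans (sym (π≡ i)) (π-up≡ (up≤ u) u)))
          (trans (lem (ρ j) (ρ i) (1ℤ ℤ.+ + suc m)) (sym (if-true u))))
    where
    lem : ∀ x y z → (x ℤ.+ z) ℤ.- (y ℤ.+ z) ≡ x ℤ.- y
    lem = solve-∀
  ... | inj₂ d | inj₂ dj = trans (+-move (proj₁ (μ-left-down i j j<i i≤m d) dj))
        (trans (cong₂ ℤ._-_ (trans (sym (π≡ i)) (π-down≡ (≤-trans i≤m (n≤1+n m)) d))
                            (trans (sym (π≡ j)) (π-down≡ (≤-trans (<⇒≤ j<i) (≤-trans i≤m (n≤1+n m))) dj)))
          (sym (if-false d)))
  ... | inj₂ d | inj₁ uj = trans (+-move (proj₂ (μ-left-down i j j<i i≤m d) uj))
        (trans (cong₂ ℤ._-_ (cong (λ z → z ℤ.+ + N) (trans (sym (π≡ i)) (π-down≡ (≤-trans i≤m (n≤1+n m)) d)))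
                            (trans (sym (π≡ j)) (π-up≡ (up≤ uj) uj)))
          (trans (lem (ρ i) (ρ j) (1ℤ ℤ.+ + suc m)) (sym (if-false d))))
    where
    lem : ∀ x y z → (x ℤ.+ z) ℤ.- (y ℤ.+ z) ≡ x ℤ.- y
    lem = solve-∀

  -- Chords by positions and by labels

  -- Of two labels the smaller one decides their cyclic order, so the end a of a chord {a < b}
  -- comes first exactly when a is down.
  data Chord (p q a b : ℕ) : Set where
    from-down : a < b → b ≤ suc m → up a ≡ false → posn a ≡ p → posn b ≡ q → Chord p q a b
    from-up   : a < b → b ≤ suc m → up a ≡ true  → posn a ≡ q → posn b ≡ p → Chord p q a b

  chord-< : ∀ {p q a b} → Chord p q a b → a < b
  chord-< (from-down x _ _ _ _) = x
  chord-< (from-up x _ _ _ _) = x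

  chord-≤ : ∀ {p q a b} → Chord p q a b → b ≤ suc m
  chord-≤ (from-down _ x _ _ _) = x
  chord-≤ (from-up _ x _ _ _) = x

  chord-pos< : ∀ {p q a b} → Chord p q a b → p < q × q < N
  chord-pos< (from-down x y d refl refl) = pos-<-down x y d , pos< y
  chord-pos< (from-up x y d refl refl) = pos-<-up x y d , pos< (≤-trans (<⇒≤ x) y)

  lo hi : ℕ → ℕ → ℕ
  lo p q = labl p ⊓ labl q
  hi p q = labl p ⊔ labl q

  chord : ∀ {p q} → p < q → q < N → Chord p q (lo p q) (hi p q)
  chord {p} {q} p<q q< with lab-spec (<-trans p<q q<) | lab-spec q<
  ... | a≤ , ea | b≤ , eb with <-cmp (labl p) (labl q)
  ...   | tri< lt _ _ = subst₂ (Chord p q) (sym (m≤n⇒m⊓n≡m (<⇒≤ lt))) (sym (m≤n⇒m⊔n≡n (<⇒≤ lt))) res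
    where
    res : Chord p q (labl p) (labl q)
    res with bool (up (labl p))
    ... | inj₂ d = from-down lt b≤ d ea eb
    ... | inj₁ u = ⊥-elim (<-asym p<q (subst₂ _<_ eb ea (pos-<-up lt b≤ u)))
  ...   | tri≈ _ e _ = ⊥-elim (<-irrefl (trans (sym ea) (trans (cong posn e) eb)) p<q)
  ...   | tri> _ _ gt = subst₂ (Chord p q) (sym (m≥n⇒m⊓n≡n (<⇒≤ gt))) (sym (m≥n⇒m⊔n≡m (<⇒≤ gt))) res
    where
    res : Chord p q (labl q) (labl p)
    res with bool (up (labl q))
    ... | inj₁ u = from-up gt a≤ u eb ea
    ... | inj₂ d = ⊥-elim (<-asym p<q (subst₂ _<_ eb ea (pos-<-down gt a≤ d)))

  chord-of : ∀ {a b} → a < b → b ≤ suc m → Chord (posn a ⊓ posn b) (posn a ⊔ posn b) a b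
  chord-of {a} {b} a<b b≤ with bool (up a)
  ... | inj₂ d = from-down a<b b≤ d (sym (m≤n⇒m⊓n≡m (<⇒≤ lt))) (sym (m≤n⇒m⊔n≡n (<⇒≤ lt)))
    where lt = pos-<-down a<b b≤ d
  ... | inj₁ u = from-up a<b b≤ u (sym (m≥n⇒m⊔n≡m (<⇒≤ gt))) (sym (m≥n⇒m⊓n≡n (<⇒≤ gt)))
    where gt = pos-<-up a<b b≤ u

  chord-ends : ∀ {p q a b} → Chord p q a b → posn a ⊓ posn b ≡ p × posn a ⊔ posn b ≡ q
  chord-ends (from-down x y d refl refl) = m≤n⇒m⊓n≡m (<⇒≤ lt) , m≤n⇒m⊔n≡n (<⇒≤ lt)
    where lt = pos-<-down x y d
  chord-ends (from-up x y d refl refl) = m≥n⇒m⊓n≡n (<⇒≤ gt) , m≥n⇒m⊔n≡m (<⇒≤ gt)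
    where gt = pos-<-up x y d

  chord-labels : ∀ {p q a b} → Chord p q a b → lo p q ≡ a × hi p q ≡ b
  chord-labels {p} {q} {a} {b} (from-down x y d refl refl)
    rewrite lab-pos (≤-trans (<⇒≤ x) y) | lab-pos y = m≤n⇒m⊓n≡m (<⇒≤ x) , m≤n⇒m⊔n≡n (<⇒≤ x)
  chord-labels {p} {q} {a} {b} (from-up x y d refl refl)
    rewrite lab-pos (≤-trans (<⇒≤ x) y) | lab-pos y = m≥n⇒m⊓n≡n (<⇒≤ x) , m≥n⇒m⊔n≡m (<⇒≤ x)

  chord-unique : ∀ {p q p′ q′ a b} → Chord p q a b → Chord p′ q′ a b → p ≡ p′ × q ≡ q′
  chord-unique c c′ = trans (sym (proj₁ (chord-ends c))) (proj₁ (chord-ends c′))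
                    , trans (sym (proj₂ (chord-ends c))) (proj₂ (chord-ends c′))

  Inside Outside : ℕ → ℕ → ℕ → Set
  Inside p q x = p < x × x < q
  Outside p q x = x < p ⊎ q < x

  -- Counterclockwise from a down end `a` the vertices below the chord come first; an up end `a` is
  -- reached last, after the vertices above the chord. In both cases the positions between `p` and
  -- `q` carry the side `not (up a)`.
  inside : ∀ {p q a b v} → Chord p q a b → v ≤ suc m → v ≢ a → v ≢ b → R a b v ≡ not (up a) →
           Inside p q (posn v)
  inside {a = a} {b} {v} (from-down x y d refl refl) v≤ va vb r with zone a b v
  ... | left p = ⊥-elim (true≢false (trans r (cong not d)) (trans (R-left p) d))
  ... | mid p q = pos-<-down p v≤ d , pos-<-down q y
          (trans (sym (not-involutive (up v))) (trans (cong not (trans (sym (R-mid p q)) r)) (trans (not-involutive (up a)) d)))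
  ... | right p = pos-<-down (<-≤-trans x p) v≤ d ,
          pos-<-up (≤∧≢⇒< p (vb ∘ sym)) v≤ (trans (sym (R-right x p)) (trans r (cong not d)))
  inside {a = a} {b} {v} (from-up x y u refl refl) v≤ va vb r with zone a b v
  ... | left p = ⊥-elim (true≢false (trans (R-left p) u) (trans r (cong not u)))
  ... | mid p q = pos-<-up q y
          (trans (sym (not-involutive (up v))) (trans (cong not (trans (sym (R-mid p q)) r)) (trans (not-involutive (up a)) u)))
          , pos-<-up p v≤ u
  ... | right p = pos-<-down (≤∧≢⇒< p (vb ∘ sym)) v≤ (trans (sym (R-right x p)) (trans r (cong not u)))
                , pos-<-up (<-≤-trans x p) v≤ u

  outside : ∀ {p q a b v} → Chord p q a b → v ≤ suc m → v ≢ a → v ≢ b → R a b v ≡ up a →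
            Outside p q (posn v)
  outside {a = a} {b} {v} (from-down x y d refl refl) v≤ va vb r with zone a b v
  ... | mid p q = inj₂ (pos-<-up q y (trans (sym (not-involutive (up v))) (trans (cong not (trans (sym (R-mid p q)) r)) (cong not d))))
  ... | right p = inj₂ (pos-<-down (≤∧≢⇒< p (vb ∘ sym)) v≤ (trans (sym (R-right x p)) (trans r d)))
  ... | left p with bool (up v)
  ...   | inj₁ w = inj₂ (pos-<-up (≤-<-trans p x) y w)
  ...   | inj₂ w = inj₁ (pos-<-down (≤∧≢⇒< p va) (≤-trans (<⇒≤ x) y) w)
  outside {a = a} {b} {v} (from-up x y u refl refl) v≤ va vb r with zone a b v
  ... | mid p q = inj₁ (pos-<-down q y (trans (sym (not-involutive (up v))) (trans (cong not (trans (sym (R-mid p q)) r)) (cong not u))))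
  ... | right p = inj₁ (pos-<-up (≤∧≢⇒< p (vb ∘ sym)) v≤ (trans (sym (R-right x p)) (trans r u)))
  ... | left p with bool (up v)
  ...   | inj₁ w = inj₂ (pos-<-up (≤∧≢⇒< p va) (≤-trans (<⇒≤ x) y) w)
  ...   | inj₂ w = inj₁ (pos-<-down (≤-<-trans p x) y w)

  cross-at : ∀ {p q x y r s} → Inside p q x → Outside p q y → (x ≡ r × y ≡ s) ⊎ (x ≡ s × y ≡ r) → r < s → Cross p q r s
  cross-at (i₁ , i₂) (inj₁ o) (inj₁ (refl , refl)) r<s = ⊥-elim (<-asym r<s (<-trans o i₁))
  cross-at (i₁ , i₂) (inj₂ o) (inj₁ (refl , refl)) r<s = inj₁ (i₁ , i₂ , o)
  cross-at (i₁ , i₂) (inj₁ o) (inj₂ (refl , refl)) r<s = inj₂ (o , i₁ , i₂)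
  cross-at (i₁ , i₂) (inj₂ o) (inj₂ (refl , refl)) r<s = ⊥-elim (<-asym r<s (<-trans i₂ o))

  chord-posns : ∀ {p q a b} → Chord p q a b → (posn a ≡ p × posn b ≡ q) ⊎ (posn b ≡ p × posn a ≡ q)
  chord-posns (from-down _ _ _ x y) = inj₁ (x , y)
  chord-posns (from-up _ _ _ x y) = inj₂ (y , x)

  ⊎-flip : ∀ {x y r s : ℕ} → (x ≡ r × y ≡ s) ⊎ (y ≡ r × x ≡ s) → (x ≡ r × y ≡ s) ⊎ (x ≡ s × y ≡ r)
  ⊎-flip (inj₁ p) = inj₁ p
  ⊎-flip (inj₂ (p , q)) = inj₂ (q , p)

  ⊎-flip′ : ∀ {x y r s : ℕ} → (x ≡ r × y ≡ s) ⊎ (y ≡ r × x ≡ s) → (y ≡ r × x ≡ s) ⊎ (y ≡ s × x ≡ r)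
  ⊎-flip′ (inj₁ (p , q)) = inj₂ (q , p)
  ⊎-flip′ (inj₂ p) = inj₁ p

  CrossL⇒Cross : ∀ {p q r s a b e f} → Chord p q a b → Chord r s e f → CrossL a b e f → Cross p q r s
  CrossL⇒Cross {a = a} {b} {e} {f} c c′ (ea , eb , fa , fb , ne) with Bool._≟_ (R a b e) (up a)
  ... | yes x = cross-at (inside c (chord-≤ c′) fa fb (trans (≢⇒≡not (≢-sym′ ne)) (cong not x)))
                         (outside c (≤-trans (<⇒≤ (chord-< c′)) (chord-≤ c′)) ea eb x)
                         (⊎-flip′ (chord-posns c′)) (proj₁ (chord-pos< c′))
  ... | no x = cross-at (inside c (≤-trans (<⇒≤ (chord-< c′)) (chord-≤ c′)) ea eb (≢⇒≡not x))
                        (outside c (chord-≤ c′) fa fb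
                          (trans (≢⇒≡not (≢-sym′ ne)) (trans (cong not (≢⇒≡not x)) (not-involutive (up a)))))
                        (⊎-flip (chord-posns c′)) (proj₁ (chord-pos< c′))

  in-out : ∀ {p q x} → Inside p q x → Outside p q x → ⊥
  in-out (i , _) (inj₁ o) = <-asym i o
  in-out (_ , i) (inj₂ o) = <-asym i o

  cross-sides : ∀ {p q r s} → Cross p q r s → (Inside p q r × Outside p q s) ⊎ (Outside p q r × Inside p q s)
  cross-sides (inj₁ (x , y , z)) = inj₁ ((x , y) , inj₂ z)
  cross-sides (inj₂ (x , y , z)) = inj₂ (inj₁ x , (y , z))

  cross-ends : ∀ {p q a b v w} → Chord p q a b → v ≤ suc m → w ≤ suc m →
               Inside p q (posn v) → Outside p q (posn w) →
               p < q → v ≢ a × v ≢ b × w ≢ a × w ≢ b × R a b v ≢ R a b w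
  cross-ends {p} {q} {a} {b} {v} {w} c v≤ w≤ i o p<q = na , nb , na′ , nb′ , differ
    where
    end : ∀ {x} → (x ≡ a ⊎ x ≡ b) → posn x ≡ p ⊎ posn x ≡ q
    end (inj₁ refl) with chord-posns c
    ... | inj₁ (u , _) = inj₁ u
    ... | inj₂ (_ , u) = inj₂ u
    end (inj₂ refl) with chord-posns c
    ... | inj₁ (_ , u) = inj₂ u
    ... | inj₂ (u , _) = inj₁ u
    not-in : posn v ≡ p ⊎ posn v ≡ q → ⊥
    not-in (inj₁ e) = <-irrefl (sym e) (proj₁ i)
    not-in (inj₂ e) = <-irrefl e (proj₂ i)
    not-out : posn w ≡ p ⊎ posn w ≡ q → Outside p q (posn w) → ⊥
    not-out (inj₁ e) (inj₁ x) = <-irrefl e x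
    not-out (inj₂ e) (inj₁ x) = <-asym p<q (subst (_< p) e x)
    not-out (inj₁ e) (inj₂ x) = <-asym p<q (subst (q <_) e x)
    not-out (inj₂ e) (inj₂ x) = <-irrefl (sym e) x
    na : v ≢ a
    na x = not-in (end (inj₁ x))
    nb : v ≢ b
    nb x = not-in (end (inj₂ x))
    na′ : w ≢ a
    na′ x = not-out (end (inj₁ x)) o
    nb′ : w ≢ b
    nb′ x = not-out (end (inj₂ x)) o
    differ : R a b v ≢ R a b w
    differ x with Bool._≟_ (R a b v) (up a)
    ... | yes y = in-out i (outside c v≤ na nb y)
    ... | no y = in-out (inside c w≤ na′ nb′ (trans (sym x) (≢⇒≡not y))) o

  Cross⇒CrossL : ∀ {p q r s a b e f} → Chord p q a b → Chord r s e f → Cross p q r s → CrossL a b e f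
  Cross⇒CrossL {p} {q} {r} {s} {a} {b} {e} {f} c c′ X with cross-sides X | chord-posns c′
  ... | inj₁ (i , o) | inj₁ (refl , refl) = cross-ends c e≤ (chord-≤ c′) i o (proj₁ (chord-pos< c))
    where e≤ = ≤-trans (<⇒≤ (chord-< c′)) (chord-≤ c′)
  ... | inj₂ (o , i) | inj₂ (refl , refl) = cross-ends c e≤ (chord-≤ c′) i o (proj₁ (chord-pos< c))
    where e≤ = ≤-trans (<⇒≤ (chord-< c′)) (chord-≤ c′)
  ... | inj₁ (i , o) | inj₂ (refl , refl) = let x , y , z , w , ne = cross-ends c (chord-≤ c′) e≤ i o (proj₁ (chord-pos< c)) in
        z , w , x , y , ≢-sym′ ne
    where e≤ = ≤-trans (<⇒≤ (chord-< c′)) (chord-≤ c′)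
  ... | inj₂ (o , i) | inj₁ (refl , refl) = let x , y , z , w , ne = cross-ends c (chord-≤ c′) e≤ i o (proj₁ (chord-pos< c)) in
        z , w , x , y , ≢-sym′ ne
    where e≤ = ≤-trans (<⇒≤ (chord-< c′)) (chord-≤ c′)

  Side : Bool → ℕ → ℕ → ℕ → Set
  Side u a b j = Inner j × a ≤ j × j ≤ b × R a b j ≡ u

  -- If the label is an end of the chord, it stands for the vertices beyond this end, and 0 or
  -- `m + 1` is one of them.
  side⇒vertex : ∀ {u a b j} → a < b → b ≤ suc m → Side u a b j →
                ∃ λ v → v ≤ suc m × v ≢ a × v ≢ b × R a b v ≡ u
  side⇒vertex {u} {a} {b} {j} a<b b≤ (ij , a≤j , j≤b , e) with zone a b j
  ... | mid p q = j , ≤-trans (proj₂ ij) (n≤1+n m) , >⇒≢ p , <⇒≢ q , e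
  ... | left p = 0 , z≤n , <⇒≢ (≤-trans (proj₁ ij) p) , <⇒≢ (≤-trans (s≤s z≤n) a<b)
               , trans (R-left z≤n) (trans (sym (R-left p)) e)
  ... | right p = suc m , ≤-refl , >⇒≢ (<-≤-trans a<b b≤) , >⇒≢ (s≤s (≤-trans p (proj₂ ij)))
               , trans (R-right a<b b≤) (trans (sym (R-right a<b p)) e)

  vertex⇒side : ∀ {u a b v} → a < b → b ≤ suc m → v ≤ suc m → v ≢ a → v ≢ b → R a b v ≡ u → ∃ (Side u a b)
  vertex⇒side {u} {a} {b} {v} a<b b≤ v≤ va vb e with zone a b v
  ... | mid p q = v , between-inner b≤ p q , <⇒≤ p , <⇒≤ q , e
  ... | left p = a , (≤-trans (s≤s z≤n) (≤∧≢⇒< p va) , ≤-pred (≤-trans a<b b≤)) , ≤-refl , <⇒≤ a<b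
               , trans (R-left ≤-refl) (trans (sym (R-left p)) e)
  ... | right p = b , (≤-trans (s≤s z≤n) a<b , ≤-pred (≤-trans (≤∧≢⇒< p (vb ∘ sym)) v≤)) , <⇒≤ a<b , ≤-refl
               , trans (R-right a<b ≤-refl) (trans (sym (R-right a<b p)) e)

  N≡ : m ℕ.+ 2 ≡ N
  N≡ = +-comm m 2

  separated : ∀ {p q a b x y} → Chord p q a b → Inside p q x → Outside p q y → y < N → IsDiagonal (m ℕ.+ 2) p q
  separated {p} {q} c (i₁ , i₂) o y< = ≤-trans (s≤s i₁) i₂ , subst (q <_) (sym N≡) (proj₂ (chord-pos< c)) , λ { (refl , e) → not-outer e o }
    where
    not-outer : suc q ≡ m ℕ.+ 2 → ¬ Outside 0 q _
    not-outer e (inj₂ o) = <⇒≱ y< (≤-trans (≤-reflexive (sym (trans e N≡))) o)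

  sides⇒diagonal : ∀ {p q a b j k} → Chord p q a b → InL a b j → InU a b k → IsDiagonal (m ℕ.+ 2) p q
  sides⇒diagonal {p} {q} {a} {b} c l u
    with side⇒vertex (chord-< c) (chord-≤ c) l | side⇒vertex (chord-< c) (chord-≤ c) u
  ... | v , v≤ , va , vb , ve | w , w≤ , wa , wb , we with bool (up a)
  ...   | inj₂ d = separated c (inside c v≤ va vb (trans ve (sym (cong not d)))) (outside c w≤ wa wb (trans we (sym d))) (pos< w≤)
  ...   | inj₁ d = separated c (inside c w≤ wa wb (trans we (sym (cong not d)))) (outside c v≤ va vb (trans ve (sym d))) (pos< v≤)

  diagonal-< : ∀ {p q} → IsDiagonal (m ℕ.+ 2) p q → p < q × q < N
  diagonal-< {p} {q} (x , y , _) = <-trans (n<1+n p) x , subst (q <_) N≡ y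

  diagonal⇒sides : ∀ {p q a b} → Chord p q a b → IsDiagonal (m ℕ.+ 2) p q → ∃ (InL a b) × ∃ (InU a b)
  diagonal⇒sides {p} {q} {a} {b} c D@(2+p≤q , q< , nb) = res
    where
    q<N = proj₂ (diagonal-< D)
    sp = lab-spec (<-trans 2+p≤q q<N)
    iv : Inside p q (posn (labl (suc p)))
    iv = subst (Inside p q) (sym (proj₂ sp)) (≤-refl , 2+p≤q)
    -- Position 0 lies outside unless `p = 0`; then `suc q` does, because `{0, N - 1}` is a side.
    outer : ∃ λ x → x < N × Outside p q x
    outer with p ≟ 0
    ... | no ne = 0 , s≤s z≤n , inj₁ (n≢0⇒n>0 ne)
    ... | yes refl = suc q , ≤∧≢⇒< q<N (λ e → nb (refl , trans e (sym N≡))) , inj₂ ≤-refl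
    so = lab-spec (proj₁ (proj₂ outer))
    ov : Outside p q (posn (labl (proj₁ outer)))
    ov = subst (Outside p q) (sym (proj₂ so)) (proj₂ (proj₂ outer))
    ends = cross-ends c (proj₁ sp) (proj₁ so) iv ov (proj₁ (diagonal-< D))
    s₁ : ∀ {u} → R a b (labl (suc p)) ≡ u → ∃ (Side u a b)
    s₁ = vertex⇒side (chord-< c) (chord-≤ c) (proj₁ sp) (proj₁ ends) (proj₁ (proj₂ ends))
    s₂ : ∀ {u} → R a b (labl (proj₁ outer)) ≡ u → ∃ (Side u a b)
    s₂ = vertex⇒side (chord-< c) (chord-≤ c) (proj₁ so) (proj₁ (proj₂ (proj₂ ends))) (proj₁ (proj₂ (proj₂ (proj₂ ends))))
    ne = proj₂ (proj₂ (proj₂ (proj₂ ends)))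
    res : ∃ (InL a b) × ∃ (InU a b)
    res with bool (R a b (labl (suc p)))
    ... | inj₁ t = s₁ t , s₂ (trans (≢⇒≡not (≢-sym′ ne)) (cong not t))
    ... | inj₂ t = s₂ (trans (≢⇒≡not (≢-sym′ ne)) (cong not t)) , s₁ t

  -- The diagonals of T_c

  diagonal? : ∀ p q → Dec (IsDiagonal (m ℕ.+ 2) p q)
  diagonal? p q = (2 ℕ.+ p ≤? q) ×-dec (q <? m ℕ.+ 2) ×-dec ¬? ((p ≟ 0) ×-dec (suc q ≟ m ℕ.+ 2))

  opaque
    Tri : (ℕ → ℕ) → DiagSet
    Tri c p q = does (diagonal? p q ×-dec chk? c (lo p q) (hi p q))

    Tri⇒ : ∀ {c p q} → (p , q) ∈D Tri c → IsDiagonal (m ℕ.+ 2) p q × Chk c (lo p q) (hi p q)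
    Tri⇒ {c} {p} {q} = does⇒ (diagonal? p q ×-dec chk? c (lo p q) (hi p q))

    ⇒Tri : ∀ {c p q} → IsDiagonal (m ℕ.+ 2) p q → Chk c (lo p q) (hi p q) → (p , q) ∈D Tri c
    ⇒Tri {c} {p} {q} x y = dec-true (diagonal? p q ×-dec chk? c (lo p q) (hi p q)) (x , y)

  Tri-chord : ∀ {c p q a b} → Chord p q a b → (p , q) ∈D Tri c → Chk c a b
  Tri-chord {c} ch t with chord-labels ch
  ... | refl , refl = proj₂ (Tri⇒ {c} t)

  chord-Tri : ∀ {c p q a b} → Chord p q a b → IsDiagonal (m ℕ.+ 2) p q → Chk c a b → (p , q) ∈D Tri c
  chord-Tri {c} ch d k with chord-labels ch
  ... | refl , refl = ⇒Tri {c} d k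

  diagonal-chord : ∀ {p q} → IsDiagonal (m ℕ.+ 2) p q → Chord p q (lo p q) (hi p q)
  diagonal-chord D = let x , y = diagonal-< D in chord x y

  Tri-wellFormed : ∀ c → WellFormed (m ℕ.+ 2) (Tri c)
  Tri-wellFormed c p q t = proj₁ (Tri⇒ {c} t)

  Tri-nonCrossing : ∀ c → NonCrossing (Tri c)
  Tri-nonCrossing c p q r s t t′ X =
    Chk-noncrossing (chord-< ch) (chord-≤ ch) (chord-< ch′) (chord-≤ ch′)
      (Tri-chord {c} ch t) (Tri-chord {c} ch′ t′) (Cross⇒CrossL ch ch′ X)
    where
    ch = diagonal-chord (Tri-wellFormed c p q t)
    ch′ = diagonal-chord (Tri-wellFormed c r s t′)

  open Paths m up ρ π ρ-down ρ-up π-down π-up π-down≡ π-up≡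

  -- The number of diagonals of T_K

  LPred : Set₁
  LPred = ℕ → ℕ → Set

  chordPred? : ∀ {Q : LPred} → (∀ a b → Dec (Q a b)) → ∀ p q → Dec (p < q × Q (lo p q) (hi p q))
  chordPred? Q? p q = (p <? q) ×-dec Q? (lo p q) (hi p q)

  opaque
    size : ∀ {Q : LPred} → (∀ a b → Dec (Q a b)) → ℤ
    size Q? = ∑ N (λ p → ∑ N (λ q → χ (chordPred? Q? p q)))

    size≡ : ∀ {Q : LPred} (Q? : ∀ a b → Dec (Q a b)) → size Q? ≡ ∑ N (λ p → ∑ N (λ q → χ (chordPred? Q? p q)))
    size≡ Q? = refl

  size-cong : ∀ {Q Q′ : LPred} (Q? : ∀ a b → Dec (Q a b)) (Q′? : ∀ a b → Dec (Q′ a b)) →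
              (∀ {a b} → a < b → b ≤ suc m → Q a b → Q′ a b) →
              (∀ {a b} → a < b → b ≤ suc m → Q′ a b → Q a b) → size Q? ≡ size Q′?
  size-cong Q? Q′? f g = trans (size≡ Q?) (trans (∑₂-cong N λ p q _ q< → χ-cong (chordPred? Q? p q) (chordPred? Q′? p q)
    (λ { (p<q , x) → p<q , f (chord-< (chord p<q q<)) (chord-≤ (chord p<q q<)) x })
    (λ { (p<q , x) → p<q , g (chord-< (chord p<q q<)) (chord-≤ (chord p<q q<)) x })) (sym (size≡ Q′?)))

  size-add : ∀ {Q Q′ : LPred} (Q? : ∀ a b → Dec (Q a b)) (Q′? : ∀ a b → Dec (Q′ a b)) a₀ b₀ →
             a₀ < b₀ → b₀ ≤ suc m → Q′ a₀ b₀ → ¬ Q a₀ b₀ →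
             (∀ {a b} → a < b → b ≤ suc m → Q a b → Q′ a b) →
             (∀ {a b} → a < b → b ≤ suc m → ¬ (a ≡ a₀ × b ≡ b₀) → Q′ a b → Q a b) →
             size Q′? ≡ size Q? ℤ.+ 1ℤ
  size-add {Q} {Q′} Q? Q′? a₀ b₀ a<b b≤ y n f g = trans (size≡ Q′?)
    (trans (∑₂-update N p₀ q₀ (<-trans p<q q<) q< off on) (cong (λ z → z ℤ.+ 1ℤ) (sym (size≡ Q?))))
    where
    p₀ = posn a₀ ⊓ posn b₀
    q₀ = posn a₀ ⊔ posn b₀
    c = chord-of a<b b≤
    p<q = proj₁ (chord-pos< c)
    q< = proj₂ (chord-pos< c)
    off : ∀ p q → p < N → q < N → ¬ (p ≡ p₀ × q ≡ q₀) → χ (chordPred? Q′? p q) ≡ χ (chordPred? Q? p q)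
    off p q _ q<N ne = χ-cong (chordPred? Q′? p q) (chordPred? Q? p q)
      (λ { (p<q , x) → p<q , g (chord-< (chord p<q q<N)) (chord-≤ (chord p<q q<N))
            (λ { (e , e′) → ne (chord-unique (subst₂ (Chord p q) e e′ (chord p<q q<N)) c) }) x })
      (λ { (p<q , x) → p<q , f (chord-< (chord p<q q<N)) (chord-≤ (chord p<q q<N)) x })
    on : χ (chordPred? Q′? p₀ q₀) ≡ χ (chordPred? Q? p₀ q₀) ℤ.+ 1ℤ
    on = trans (χ-yes (chordPred? Q′? p₀ q₀) (p<q , subst₂ Q′ (sym (proj₁ ls)) (sym (proj₂ ls)) y))
               (sym (cong (λ z → z ℤ.+ 1ℤ) (χ-no (chordPred? Q? p₀ q₀) λ { (_ , x) → n (subst₂ Q (proj₁ ls) (proj₂ ls) x) })))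
      where ls = chord-labels c

  module _ (K : ℕ → ℕ) (K-inj : ∀ {i j} → Inner i → Inner j → K i ≡ K j → i ≡ j) where

    -- The chords lying on one of the paths of {K < s} with s ≤ t.
    Born : ℕ → LPred
    Born t a b = Chk K a b × (∀ j → InL a b j → K j < t)

    opaque
      born? : ∀ t a b → Dec (Born t a b)
      born? t a b = chk? K a b ×-dec lows
        where
        lows : Dec (∀ j → InL a b j → K j < t)
        lows with argmax-L K a b
        ... | inj₂ none = yes λ j l → ⊥-elim (none j l)
        ... | inj₁ (j , l , best) with K j <? t
        ...   | yes lt = yes λ i l′ → ≤-<-trans (best i l′) lt
        ...   | no ¬lt = no λ h → ¬lt (h j l)

    Born-mono : ∀ {t a b} → Born t a b → Born (suc t) a b
    Born-mono (c , h) = c , λ j l → <-trans (h j l) (n<1+n _)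

    Edge⇒Born : ∀ {t a b} → Edge (below K t) a b → Born t a b
    Edge⇒Born E = Edge-below⇒Chk E , λ j l → below⇒< K (Edge-inL E l)

    births : ℕ → ℕ → ℤ
    births t i = if below K t i then 1ℤ ℤ.+ ι (up i) else 0ℤ

    module Step (j : ℕ) (ij : Inner j) where
      t = K j
      J : ℕ → Bool
      J = below K (suc t)
      Jj : J j ≡ true
      Jj = below-true K ≤-refl

      old : ∀ {e f} → e < f → f ≤ suc m → Born (suc t) e f → ¬ InL e f j → Born t e f
      old e<f f≤ (c , h) n = c , λ i l → ≤∧≢⇒< (≤-pred (h i l))
        (λ e → n (subst (InL _ _) (K-inj (proj₁ l) ij e) l))

      new-edge : ∀ {e f} → e < f → f ≤ suc m → Born (suc t) e f → InL e f j → Edge J e f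
      new-edge e<f f≤ (c , h) l = LU⇒Edge e<f f≤ (λ i l′ → below-true K (h i l′)) (λ i u → below-false K (c l u))

      not-old : ∀ {e f} → Edge J e f → e ≤ j → j ≤ f → ¬ Born t e f
      not-old E p q (_ , h) = <-irrefl refl (h j (ij , p , q , trans (sym (Edge⇒R E ij p q)) Jj))

      La = left-exists J j (proj₁ ij)
      Rb = right-exists J j (proj₂ ij)
      a = proj₁ La
      b = proj₁ Rb
      a<j = LeftNbr.a<j (proj₂ La)
      j<b = RightNbr.j<b (proj₂ Rb)

      -- The new chords have `j` as a lower label and are edges of the new path. A down label is
      -- bridged by one new edge, an up label is joined to its neighbours by two.
      size-step : size (born? (suc t)) ≡ size (born? t) ℤ.+ (1ℤ ℤ.+ ι (up j))
      size-step with bool (up j)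
      ... | inj₂ d = trans (size-add (born? t) (born? (suc t)) a b (<-trans a<j j<b) (RightNbr.b≤ (proj₂ Rb))
                       (Edge⇒Born E) (not-old E (<⇒≤ a<j) (<⇒≤ j<b)) (λ _ _ → Born-mono) other)
                     (cong (λ u → size (born? t) ℤ.+ (1ℤ ℤ.+ ι u)) (sym d))
        where
        dj : alive J j ≡ false
        dj = ⇒dead J ij (trans Jj (cong not (sym d)))
        E : Edge J a b
        E = left-right⇒Edge (proj₂ La) (proj₂ Rb) dj
        other : ∀ {e f} → e < f → f ≤ suc m → ¬ (e ≡ a × f ≡ b) → Born (suc t) e f → Born t e f
        other {e} {f} e<f f≤ ne B = old e<f f≤ B λ l → absurd l (new-edge e<f f≤ B l)
          where
          absurd : InL e f j → Edge J e f → ⊥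
          absurd (_ , e≤j , j≤f , _) E′ with m≤n⇒m<n∨m≡n e≤j | m≤n⇒m<n∨m≡n j≤f
          ... | inj₁ p | inj₁ q = ne (left-unique (through⇒left E′ p q) (proj₂ La) , right-unique (through⇒right E′ p q) (proj₂ Rb))
          ... | inj₂ refl | _ = true≢false (Edge.alive-a E′) dj
          ... | inj₁ _ | inj₂ refl = true≢false (Edge.alive-b E′) dj
      -- The two edges are added one at a time; `mid?` describes the stage lacking only `{a, j}`.
      ... | inj₁ u = trans (trans (size-add mid? (born? (suc t)) a j a<j (≤-trans (proj₂ ij) (n≤1+n m))
                              (Edge⇒Born E₁) (λ { (_ , n) → n (refl , refl) }) (λ _ _ → proj₁) (λ _ _ ne B → B , ne))
                            (cong (λ z → z ℤ.+ 1ℤ) (size-add (born? t) mid? j b j<b (RightNbr.b≤ (proj₂ Rb))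
                              (Edge⇒Born E₂ , λ { (e , _) → <⇒≢ a<j (sym e) }) (not-old E₂ ≤-refl (<⇒≤ j<b))
                              (λ _ _ B → Born-mono B , λ { (refl , refl) → not-old E₁ (<⇒≤ a<j) ≤-refl B }) other)))
                     (trans (ℤ.+-assoc (size (born? t)) 1ℤ 1ℤ)
                            (cong (λ u → size (born? t) ℤ.+ (1ℤ ℤ.+ ι u)) (sym u)))
        where
        aj : alive J j ≡ true
        aj = ⇒alive J ij (trans Jj (sym u))
        E₁ : Edge J a j
        E₁ = left⇒Edge (proj₂ ij) (proj₂ La) aj
        E₂ : Edge J j b
        E₂ = right⇒Edge (proj₂ Rb) aj
        mid? : ∀ e f → Dec (Born (suc t) e f × ¬ (e ≡ a × f ≡ j))
        mid? e f = born? (suc t) e f ×-dec ¬? ((e ≟ a) ×-dec (f ≟ j))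
        other : ∀ {e f} → e < f → f ≤ suc m → ¬ (e ≡ j × f ≡ b) → Born (suc t) e f × ¬ (e ≡ a × f ≡ j) → Born t e f
        other {e} {f} e<f f≤ ne (B , ne′) = old e<f f≤ B λ l → absurd l (new-edge e<f f≤ B l)
          where
          absurd : InL e f j → Edge J e f → ⊥
          absurd (_ , e≤j , j≤f , _) E′ with m≤n⇒m<n∨m≡n e≤j | m≤n⇒m<n∨m≡n j≤f
          ... | inj₁ p | inj₁ q = true≢false aj (Edge.dead E′ j p q)
          ... | inj₂ refl | _ = ne (refl , right-unique (Edge⇒right E′) (proj₂ Rb))
          ... | inj₁ _ | inj₂ refl = ne′ (left-unique (Edge⇒left E′) (proj₂ La) , refl)

    size-born : ∀ t → size (born? t) ≡ size (born? 0) ℤ.+ ∑ m (births t ∘ suc)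
    size-born zero = sym (trans (cong (ℤ._+_ (size (born? 0)))
      (trans (∑-cong m λ i _ → if-false (below-false K z≤n)) (∑-0 m))) (ℤ.+-identityʳ _))
    size-born (suc t) with size-born t | search (λ j → K j ≟ t)
    ... | ih | inj₂ none = trans (size-cong (born? (suc t)) (born? t)
            (λ _ _ B → proj₁ B , λ j l → ≤∧≢⇒< (≤-pred (proj₂ B j l)) (none j (proj₁ l))) (λ _ _ → Born-mono))
          (trans ih (cong (ℤ._+_ (size (born? 0))) (∑-cong m λ i i<m →
            cong (λ v → if v then 1ℤ ℤ.+ ι (up (suc i)) else 0ℤ) (same (suc i) (s≤s z≤n , i<m)))))
      where
      same : ∀ i → Inner i → below K t i ≡ below K (suc t) i
      same i ii with K i <? t
      ... | yes lt = trans (below-true K lt) (sym (below-true K (<-trans lt (n<1+n t))))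
      ... | no ge = trans (below-false K (≮⇒≥ ge)) (sym (below-false K (≤∧≢⇒< (≮⇒≥ ge) (none i ii ∘ sym))))
    ... | ih | inj₁ (suc j , ij , refl) = trans (Step.size-step (suc j) ij)
          (trans (cong (λ z → z ℤ.+ (1ℤ ℤ.+ ι (up (suc j)))) ih)
            (trans (ℤ.+-assoc (size (born? 0)) _ _) (cong (ℤ._+_ (size (born? 0))) (sym upd))))
      where
      t′ = K (suc j)
      upd : ∑ m (births (suc t′) ∘ suc) ≡ ∑ m (births t′ ∘ suc) ℤ.+ (1ℤ ℤ.+ ι (up (suc j)))
      upd = ∑-update m j (proj₂ ij)
        (λ i i<m ne → cong (λ v → if v then 1ℤ ℤ.+ ι (up (suc i)) else 0ℤ) (same (suc i) (s≤s z≤n , i<m) (ne ∘ suc-injective)))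
        (trans (if-true (below-true K ≤-refl))
          (sym (trans (cong (λ z → z ℤ.+ (1ℤ ℤ.+ ι (up (suc j)))) (if-false (below-false K ≤-refl))) (ℤ.+-identityˡ _))))
        where
        same : ∀ i → Inner i → i ≢ suc j → below K (suc t′) i ≡ below K t′ i
        same i ii ne with K i <? t′
        ... | yes lt = trans (below-true K (<-trans lt (n<1+n t′))) (sym (below-true K lt))
        ... | no ge = trans (below-false K (≤∧≢⇒< (≮⇒≥ ge) (ne ∘ sym ∘ K-inj ij ii))) (sym (below-false K (≮⇒≥ ge)))

    -- The number of sides on the lower boundary from 0 to `m + 1`.
    D : ℕ
    D = cd (suc m)

    posn-top≡ : posn (suc m) ≡ D
    posn-top≡ = pos-down ≤-refl (down-≥m (n≤1+n m))

    D<N : D < N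
    D<N = subst (_< N) posn-top≡ (pos< ≤-refl)

    down⇒≤D : ∀ {a} → a ≤ suc m → up a ≡ false → posn a ≤ D
    down⇒≤D a≤ d = ≤-trans (≤-reflexive (pos-down a≤ d)) (cnt-mono (not ∘ up) a≤)

    up⇒>D : ∀ {a} → up a ≡ true → D < posn a
    up⇒>D u = subst (_< posn _) posn-top≡ (pos-<-up (<-trans (proj₂ (up⇒inner u)) (n<1+n m)) ≤-refl u)

    chord-down : ∀ {p q a b} → Chord p q a b → up a ≡ false → posn a ≡ p × posn b ≡ q
    chord-down (from-down _ _ _ x y) _ = x , y
    chord-down (from-up _ _ u _ _) d = ⊥-elim (true≢false u d)

    -- An up end would itself be a lower label, so both ends are down; a position between theirs
    -- would carry a down label strictly between `a` and `b`, again a lower label.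
    born-0 : ∀ {p q a b} → Chord p q a b → Born 0 a b → q ≡ suc p × p < D
    born-0 {p} {q} {a} {b} c (_ , h) = adjacent , p<D
      where
      a<b = chord-< c
      b≤ = chord-≤ c
      no-L : ∀ j → ¬ InL a b j
      no-L j l = n≮0 (h j l)
      da : up a ≡ false
      da with bool (up a)
      ... | inj₂ d = d
      ... | inj₁ u = ⊥-elim (no-L a ((<⇒≤ (proj₁ (up⇒inner u)) , <⇒≤ (proj₂ (up⇒inner u))) , ≤-refl , <⇒≤ a<b , trans (R-left ≤-refl) u))
      db : up b ≡ false
      db with bool (up b)
      ... | inj₂ d = d
      ... | inj₁ u = ⊥-elim (no-L b ((<⇒≤ (proj₁ (up⇒inner u)) , <⇒≤ (proj₂ (up⇒inner u))) , <⇒≤ a<b , ≤-refl , trans (R-right a<b ≤-refl) u))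
      ends : posn a ≡ p × posn b ≡ q
      ends = chord-down c da
      p<q = proj₁ (chord-pos< c)
      q≤D : q ≤ D
      q≤D = subst (_≤ D) (proj₂ ends) (down⇒≤D b≤ db)
      p<D = <-≤-trans p<q q≤D
      adjacent : q ≡ suc p
      adjacent with m≤n⇒m<n∨m≡n p<q
      ... | inj₂ e = sym e
      ... | inj₁ sp<q = ⊥-elim (no-L v (between-inner b≤ a<v v<b , <⇒≤ a<v , <⇒≤ v<b , trans (R-mid a<v v<b) (cong not dv)))
        where
        sp = lab-spec (<-trans sp<q (proj₂ (chord-pos< c)))
        v = labl (suc p)
        dv : up v ≡ false
        dv with bool (up v)
        ... | inj₂ d = d
        ... | inj₁ u = ⊥-elim (<⇒≱ (up⇒>D u) (≤-trans (≤-reflexive (proj₂ sp)) (≤-trans (<⇒≤ sp<q) q≤D)))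
        a<v : a < v
        a<v with <-cmp a v
        ... | tri< x _ _ = x
        ... | tri≈ _ e _ = ⊥-elim (<⇒≢ (n<1+n p) (trans (sym (proj₁ ends)) (trans (cong posn e) (proj₂ sp))))
        ... | tri> _ _ x = ⊥-elim (<-asym (n<1+n p) (subst₂ _<_ (proj₂ sp) (proj₁ ends) (pos-<-down x (≤-trans (<⇒≤ a<b) b≤) dv)))
        v<b : v < b
        v<b with <-cmp v b
        ... | tri< x _ _ = x
        ... | tri≈ _ e _ = ⊥-elim (<⇒≢ sp<q (trans (sym (proj₂ sp)) (trans (cong posn e) (proj₂ ends))))
        ... | tri> _ _ x = ⊥-elim (<-asym sp<q (subst₂ _<_ (proj₂ ends) (proj₂ sp) (pos-<-down x (proj₁ sp) db)))

    ≤D⇒down : ∀ {a} → posn a ≤ D → up a ≡ false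
    ≤D⇒down {a} le with bool (up a)
    ... | inj₂ d = d
    ... | inj₁ u = ⊥-elim (<⇒≱ (up⇒>D u) le)

    0-born : ∀ {p q a b} → Chord p q a b → q ≡ suc p → p < D → Born 0 a b
    0-born (from-up x y u ea eb) refl p<D = ⊥-elim (<⇒≱ (subst (D <_) ea (up⇒>D u)) p<D)
    0-born {a = a} {b} (from-down x y d refl eb) refl p<D = (λ l _ → ⊥-elim (no-L _ l)) , λ j l → ⊥-elim (no-L j l)
      where
      no-L : ∀ j → ¬ InL a b j
      no-L j (ij , a≤j , j≤b , r) with zone a b j
      ... | left p = true≢false (trans (sym (R-left p)) r) d
      ... | right p = true≢false (trans (sym (R-right x p)) r) (≤D⇒down (subst (_≤ D) (sym eb) p<D))
      ... | mid p q = <⇒≱ (pos-<-down p (≤-trans (<⇒≤ q) y) d)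
              (≤-pred (subst (posn j <_) eb (pos-<-down q y (trans (sym (Bool.not-involutive (up j))) (cong not (trans (sym (R-mid p q)) r))))))

    size-born-0 : size (born? 0) ≡ + D
    size-born-0 = trans (size≡ (born? 0)) (trans (∑₂-cong N λ p q _ q< → χ-cong (chordPred? (born? 0) p q) ((q ≟ suc p) ×-dec (p <? D))
        (λ { (p<q , B) → born-0 (chord p<q q<) B })
        (λ { (refl , p<D) → ≤-refl , 0-born (chord ≤-refl q<) refl p<D }))
      (∑-sides N D D<N))

    Side? : ∀ p q → Dec (p < q × ¬ IsDiagonal (m ℕ.+ 2) p q)
    Side? p q = (p <? q) ×-dec ¬? (diagonal? p q)

    not-diagonal-Chk : ∀ {p q a b} → Chord p q a b → ¬ IsDiagonal (m ℕ.+ 2) p q → Chk K a b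
    not-diagonal-Chk c nd l u = ⊥-elim (nd (sides⇒diagonal c l u))

    size-chk : size (chk? K) ≡ ∑ N (λ p → ∑ N (λ q → ι (Tri K p q))) ℤ.+ ∑ N (λ p → ∑ N (λ q → χ (Side? p q)))
    size-chk = trans (size≡ (chk? K)) (trans (∑₂-cong N pointwise) (∑₂-+ N N (λ p q → ι (Tri K p q)) (λ p q → χ (Side? p q))))
      where
      pointwise : ∀ p q → p < N → q < N → χ (chordPred? (chk? K) p q) ≡ ι (Tri K p q) ℤ.+ χ (Side? p q)
      pointwise p q _ q< = trans (χ-⊎ (chordPred? (chk? K) p q) (Tri K p q Bool.≟ true) (Side? p q)
          (λ { (p<q , C) → fwd p<q C (diagonal? p q) })
          (λ t → let d , C = Tri⇒ {K} t in proj₁ (diagonal-< d) , C)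
          (λ { (p<q , nd) → p<q , not-diagonal-Chk (chord p<q q<) nd })
          (λ { (t , _ , nd) → nd (proj₁ (Tri⇒ {K} t)) }))
          (cong (λ z → z ℤ.+ χ (Side? p q)) (χ-≟ (Tri K p q)))
        where
        χ-≟ : ∀ b → χ (b Bool.≟ true) ≡ ι b
        χ-≟ true  = refl
        χ-≟ false = refl
        fwd : p < q → Chk K (lo p q) (hi p q) → Dec (IsDiagonal (m ℕ.+ 2) p q) → Tri K p q ≡ true ⊎ (p < q × ¬ IsDiagonal (m ℕ.+ 2) p q)
        fwd p<q C (yes d) = inj₁ (⇒Tri {K} d C)
        fwd p<q C (no nd) = inj₂ (p<q , nd)

    sides-count : ∑ N (λ p → ∑ N (λ q → χ (Side? p q))) ≡ + suc m ℤ.+ 1ℤ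
    sides-count = trans (∑₂-update N {g = λ p q → χ ((q ≟ suc p) ×-dec (p <? suc m))} 0 (suc m) (s≤s z≤n) ≤-refl off on)
                        (cong (λ z → z ℤ.+ 1ℤ) (∑-sides N (suc m) ≤-refl))
      where
      not-adjacent : ¬ (suc m ≡ 1)
      not-adjacent e = <⇒≢ 1≤m (sym (suc-injective e))
      off : ∀ p q → p < N → q < N → ¬ (p ≡ 0 × q ≡ suc m) → χ (Side? p q) ≡ χ ((q ≟ suc p) ×-dec (p <? suc m))
      off p q p< q< ne = χ-cong (Side? p q) ((q ≟ suc p) ×-dec (p <? suc m)) fwd
        (λ { (refl , _) → ≤-refl , λ d → <-irrefl refl (proj₁ d) })
        where
        fwd : p < q × ¬ IsDiagonal (m ℕ.+ 2) p q → q ≡ suc p × p < suc m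
        fwd (p<q , nd) with m≤n⇒m<n∨m≡n p<q
        ... | inj₂ refl = refl , ≤-pred q<
        ... | inj₁ lt = ⊥-elim (nd (lt , subst (q <_) (sym N≡) q< , λ { (e , e′) → ne (e , suc-injective (trans e′ N≡)) }))
      on : χ (Side? 0 (suc m)) ≡ χ ((suc m ≟ 1) ×-dec (0 <? suc m)) ℤ.+ 1ℤ
      on = trans (χ-yes (Side? 0 (suc m)) (s≤s z≤n , λ { (_ , _ , x) → x (refl , sym N≡) }))
                 (sym (cong (λ z → z ℤ.+ 1ℤ) (χ-no ((suc m ≟ 1) ×-dec (0 <? suc m)) (not-adjacent ∘ proj₁))))

    ∑-ι-cnt : ∀ k → ∑ k (ι ∘ up ∘ suc) ≡ + cu k
    ∑-ι-cnt zero = refl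
    ∑-ι-cnt (suc k) = trans (∑-last k (ι ∘ up ∘ suc)) (trans (cong (λ z → z ℤ.+ ι (up (suc k))) (∑-ι-cnt k)) lem)
      where
      lem : + cu k ℤ.+ ι (up (suc k)) ≡ + cu (suc k)
      lem with bool (up (suc k))
      ... | inj₁ u = trans (cong (λ v → + cu k ℤ.+ ι v) u) (cong +_ (trans (+-comm (cu k) 1) (sym (cnt-true up u))))
      ... | inj₂ d = trans (cong (λ v → + cu k ℤ.+ ι v) d) (cong +_ (trans (+-identityʳ (cu k)) (sym (cnt-false up d))))

    -- At a threshold beyond all weights every checked chord is born: `D` from the lower boundary,
    -- one for each label, and one more for each up label.
    size-chk′ : size (chk? K) ≡ + D ℤ.+ (+ m ℤ.+ + cu m)
    size-chk′ with bound K (suc m)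
    ... | B , lt = trans (size-cong (chk? K) (born? B) (λ _ _ C → C , λ j l → lt j (s≤s (proj₂ (proj₁ l)))) (λ _ _ → proj₁))
        (trans (size-born B) (cong₂ ℤ._+_ size-born-0
          (trans (∑-cong m λ i i<m → if-true (below-true K (lt (suc i) (s≤s i<m))))
            (trans (∑-+ m (λ _ → 1ℤ) (ι ∘ up ∘ suc)) (cong₂ ℤ._+_ (trans (∑-const m 1ℤ) (ℤ.*-identityʳ (+ m))) (∑-ι-cnt m))))))

    -- The checked chords also comprise all `m + 2` sides, which have to be subtracted.
    Tri-count : countD (m ℕ.+ 2) (Tri K) ≡ m ∸ 1
    Tri-count = ℤ.+-injective (begin
      + countD (m ℕ.+ 2) (Tri K)                                ≡⟨ countD≡∑ (m ℕ.+ 2) (Tri K) (Tri-wellFormed K) ⟩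
      ∑ (m ℕ.+ 2) (λ p → ∑ (m ℕ.+ 2) (λ q → ι (Tri K p q)))     ≡⟨ cong (λ n → ∑ n (λ p → ∑ n (λ q → ι (Tri K p q)))) N≡ ⟩
      s                                                         ≡⟨ lem₁ s (+ suc m ℤ.+ 1ℤ) ⟩
      (s ℤ.+ (+ suc m ℤ.+ 1ℤ)) ℤ.- (+ suc m ℤ.+ 1ℤ)             ≡⟨ cong (λ z → z ℤ.- (+ suc m ℤ.+ 1ℤ)) all-edges ⟩
      (+ D ℤ.+ (+ m ℤ.+ + cu m)) ℤ.- (+ suc m ℤ.+ 1ℤ)           ≡⟨ cong (λ z → (+ z ℤ.+ (+ m ℤ.+ + cu m)) ℤ.- (+ suc m ℤ.+ 1ℤ)) cd-top ⟩
      (+ suc (cd m) ℤ.+ (+ m ℤ.+ + cu m)) ℤ.- (+ suc m ℤ.+ 1ℤ)  ≡⟨ lem₂ (+ cd m) (+ m) (+ cu m) ⟩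
      (+ cd m ℤ.+ + cu m) ℤ.- 1ℤ                                ≡⟨ cong (λ z → + z ℤ.- 1ℤ) (cd+cu m) ⟩
      + m ℤ.- 1ℤ                                                ≡⟨ ℤ.m-n≡m⊖n m 1 ⟩
      m ℤ.⊖ 1                                                   ≡⟨ ℤ.⊖-≥ 1≤m ⟩
      + (m ∸ 1)                                                ∎)
      where
      open ≡-Reasoning
      s = ∑ N (λ p → ∑ N (λ q → ι (Tri K p q)))
      all-edges : s ℤ.+ (+ suc m ℤ.+ 1ℤ) ≡ + D ℤ.+ (+ m ℤ.+ + cu m)
      all-edges = trans (cong (ℤ._+_ s) (sym sides-count)) (trans (sym size-chk) size-chk′)
      lem₁ : ∀ x y → x ≡ (x ℤ.+ y) ℤ.- y
      lem₁ = solve-∀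
      lem₂ : ∀ x y z → ((1ℤ ℤ.+ x) ℤ.+ (y ℤ.+ z)) ℤ.- ((1ℤ ℤ.+ y) ℤ.+ 1ℤ) ≡ (x ℤ.+ z) ℤ.- 1ℤ
      lem₂ = solve-∀

    Tri-isTriangulation : IsTriangulation m (Tri K)
    Tri-isTriangulation = Tri-wellFormed K , Tri-nonCrossing K , Tri-count

  -- The coordinates of T_K

  opaque
    coord : DiagSet → ℕ → ℤ
    coord T j = xcoord m dir T j

    coord≡ : ∀ T j → xcoord m dir T j ≡ coord T j
    coord≡ T j = refl

  _≐_ : DiagSet → DiagSet → Set
  S ≐ S′ = S ⊆D S′ × S′ ⊆D S

  module _ (K : ℕ → ℕ) (K-inj : ∀ {i j} → Inner i → Inner j → K i ≡ K j → i ≡ j)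
           (T : DiagSet) (T≐ : T ≐ Tri K) where

    edgeL≡ : ∀ a b → edgeL m dir T a b ≡ edgeP (m ℕ.+ 2) T (posn a) (posn b)
    edgeL≡ a b = cong₂ (edgeP (m ℕ.+ 2) T) (posn≡ a) (posn≡ b)

    edgeL⇒Chk : ∀ {a b} → a < b → b ≤ suc m → edgeL m dir T a b ≡ true → Chk K a b
    edgeL⇒Chk {a} {b} a<b b≤ e = lem (∨-true {(suc p ≡ᵇ q) ∨ ((p ≡ᵇ 0) ∧ (suc q ≡ᵇ m ℕ.+ 2))} (trans (sym (edgeL≡ a b)) e))
      where
      p = posn a ⊓ posn b
      q = posn a ⊔ posn b
      c = chord-of a<b b≤
      not-diagonal : ¬ IsDiagonal (m ℕ.+ 2) p q → Chk K a b
      not-diagonal nd l u = ⊥-elim (nd (sides⇒diagonal c l u))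
      lem : (suc p ≡ᵇ q) ∨ ((p ≡ᵇ 0) ∧ (suc q ≡ᵇ m ℕ.+ 2)) ≡ true ⊎ T p q ≡ true → Chk K a b
      lem (inj₂ t) = Tri-chord c (proj₁ T≐ p q t)
      lem (inj₁ t) with ∨-true {suc p ≡ᵇ q} t
      ... | inj₁ x = not-diagonal λ d → <⇒≱ (proj₁ d) (≤-reflexive (sym (≡ᵇ⇒ {suc p} {q} x)))
      ... | inj₂ x with ∧-true {p ≡ᵇ 0} x
      ...   | y , z = not-diagonal λ d → proj₂ (proj₂ d) (≡ᵇ⇒ {p} {0} y , ≡ᵇ⇒ {suc q} {m ℕ.+ 2} z)

    Chk⇒edgeL : ∀ {a b} → a < b → b ≤ suc m → Chk K a b → edgeL m dir T a b ≡ true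
    Chk⇒edgeL {a} {b} a<b b≤ C = trans (edgeL≡ a b) (lem (diagonal? p q))
      where
      p = posn a ⊓ posn b
      q = posn a ⊔ posn b
      c = chord-of a<b b≤
      p<q = proj₁ (chord-pos< c)
      q< = proj₂ (chord-pos< c)
      lem : Dec (IsDiagonal (m ℕ.+ 2) p q) → edgeP (m ℕ.+ 2) T (posn a) (posn b) ≡ true
      lem (yes d) = ∨-introʳ {(suc p ≡ᵇ q) ∨ ((p ≡ᵇ 0) ∧ (suc q ≡ᵇ m ℕ.+ 2))} (proj₂ T≐ p q (chord-Tri c d C))
      lem (no nd) with m≤n⇒m<n∨m≡n p<q
      ... | inj₂ x = ∨-introˡ (∨-introˡ {suc p ≡ᵇ q} (≡ᵇ-true {suc p} {q} x))
      ... | inj₁ x with p ≟ 0 | suc q ≟ m ℕ.+ 2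
      ...   | yes y | yes z = ∨-introˡ (∨-introʳ {suc p ≡ᵇ q} (cong₂ _∧_ (≡ᵇ-true {p} {0} y) (≡ᵇ-true {suc q} {m ℕ.+ 2} z)))
      ...   | no y | _ = ⊥-elim (nd (x , subst (q <_) (sym N≡) q< , y ∘ proj₁))
      ...   | yes _ | no z = ⊥-elim (nd (x , subst (q <_) (sym N≡) q< , z ∘ proj₂))

    module At (j : ℕ) (ij : Inner j) (a b : ℕ)
              (La : LeftNbr (below K (K j)) j a) (Rb : RightNbr (below K (K j)) j b) where

      private
        j≤ : j ≤ suc m
        j≤ = ≤-trans (proj₂ ij) (n≤1+n m)
        Js : ℕ → Bool
        Js = below K (K j)

        -- An end `j` of a checked chord lies on the side `up j`. The labels on the other side are
        -- then all heavier or all lighter than `j`, which fixes their membership in `{K < K j}`.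
        side-of-end : ∀ {e f} → Chk K e f → e ≤ j → j ≤ f → R e f j ≡ up j →
                      ∀ i → Inner i → e ≤ i → i ≤ f → R e f i ≡ not (up j) → Js i ≡ not (up j)
        side-of-end C e≤j j≤f rj i ii e≤i i≤f ri with bool (up j)
        ... | inj₁ u = trans (below-false K (<⇒≤ (C (ij , e≤j , j≤f , trans rj u) (ii , e≤i , i≤f , trans ri (cong not u))))) (sym (cong not u))
        ... | inj₂ u = trans (below-true K (C (ii , e≤i , i≤f , trans ri (cong not u)) (ij , e≤j , j≤f , trans rj u))) (sym (cong not u))

        b≢not : ∀ {u v : Bool} → u ≡ v → u ≡ not v → ⊥
        b≢not {true} refl ()
        b≢not {false} refl ()

        ≡-dec : ∀ (u v : Bool) → u ≡ v ⊎ u ≡ not v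
        ≡-dec true  true  = inj₁ refl
        ≡-dec true  false = inj₂ refl
        ≡-dec false true  = inj₂ refl
        ≡-dec false false = inj₁ refl

      -- Restricts the kinds of the competitors for the maximum in `pℓ`; by the monotonicity of `ρ`
      -- none of them beats the neighbour `a` on the path. A label of the wrong kind would be dead
      -- where it is alive, or conversely, by `side-of-end`.
      left-closer : ∀ {a′} → a′ < j → Chk K a′ j → (a′ < a → up a ≡ not (up j)) × (a < a′ → up a′ ≡ up j)
      left-closer {a′} a′<j C = nearer , farther
        where
        nearer : a′ < a → up a ≡ not (up j)
        nearer a′<a with ≡-dec (up a) (up j)
        ... | inj₂ e = e
        ... | inj₁ e = ⊥-elim (b≢not (trans (alive⇒ Js ia (LeftNbr.alive-a La)) e)
              (side-of-end C (<⇒≤ a′<j) ≤-refl (R-right a′<j ≤-refl) a ia (<⇒≤ a′<a) (<⇒≤ (LeftNbr.a<j La))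
                (trans (R-mid a′<a (LeftNbr.a<j La)) (cong not e))))
          where ia = between-inner j≤ a′<a (LeftNbr.a<j La)
        farther : a < a′ → up a′ ≡ up j
        farther a<a′ with ≡-dec (up a′) (up j)
        ... | inj₁ e = e
        ... | inj₂ e = ⊥-elim (b≢not (trans (side-of-end C (<⇒≤ a′<j) ≤-refl (R-right a′<j ≤-refl) a′ ia ≤-refl (<⇒≤ a′<j) (trans (R-left ≤-refl) e)) (sym e))
              (dead⇒ Js ia (LeftNbr.dead La a′ a<a′ a′<j)))
          where ia = between-inner j≤ a<a′ a′<j

      right-closer : ∀ {b′} → j < b′ → b′ ≤ suc m → Chk K j b′ → (b < b′ → up b ≡ not (up j)) × (b′ < b → up b′ ≡ up j)
      right-closer {b′} j<b′ b′≤ C = nearer , farther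
        where
        nearer : b < b′ → up b ≡ not (up j)
        nearer b<b′ with ≡-dec (up b) (up j)
        ... | inj₂ e = e
        ... | inj₁ e = ⊥-elim (b≢not (trans (alive⇒ Js ib (RightNbr.alive-b Rb)) e)
              (side-of-end C ≤-refl (<⇒≤ j<b′) (R-left ≤-refl) b ib (<⇒≤ (RightNbr.j<b Rb)) (<⇒≤ b<b′)
                (trans (R-mid (RightNbr.j<b Rb) b<b′) (cong not e))))
          where ib = between-inner b′≤ (RightNbr.j<b Rb) b<b′
        farther : b′ < b → up b′ ≡ up j
        farther b′<b with ≡-dec (up b′) (up j)
        ... | inj₁ e = e
        ... | inj₂ e = ⊥-elim (b≢not (trans (side-of-end C ≤-refl (<⇒≤ j<b′) (R-left ≤-refl) b′ ib (<⇒≤ j<b′) ≤-refl (trans (R-right j<b′ ≤-refl) e)) (sym e))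
              (dead⇒ Js ib (RightNbr.dead Rb b′ j<b′ b′<b)))
          where ib = between-inner (RightNbr.b≤ Rb) j<b′ b′<b

      private
        chks = nbrs-Chk K K-inj ij La Rb

      left-max : ∀ {a′} → a′ < j → Chk K a′ j → μ m dir j a′ ≤ μ m dir j a
      left-max {a′} a′<j C = ℤ.drop‿+≤+ (subst₂ ℤ._≤_ (sym (μ-left a′<j (proj₂ ij))) (sym (μ-left (LeftNbr.a<j La) (proj₂ ij))) main)
        where
        cl = left-closer a′<j C
        a≤ = ≤-trans (<⇒≤ (LeftNbr.a<j La)) j≤
        main : (if up j then ρ a′ ℤ.- ρ j else ρ j ℤ.- ρ a′) ℤ.≤ (if up j then ρ a ℤ.- ρ j else ρ j ℤ.- ρ a)
        main with bool (up j) | <-cmp a′ a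
        ... | _ | tri≈ _ refl _ = ℤ.≤-refl
        ... | inj₁ u | tri< lt _ _ rewrite u = ℤ.+-monoˡ-≤ (ℤ.- ρ j) (ℤ.<⇒≤ (ρ-down lt a≤ (trans (proj₁ cl lt) (cong not u))))
        ... | inj₁ u | tri> _ _ gt rewrite u = ℤ.+-monoˡ-≤ (ℤ.- ρ j) (ℤ.<⇒≤ (ρ-up gt (≤-trans (<⇒≤ a′<j) j≤) (trans (proj₂ cl gt) u)))
        ... | inj₂ u | tri< lt _ _ rewrite u = -‿monoʳ (ρ j) (ℤ.<⇒≤ (ρ-up lt a≤ (trans (proj₁ cl lt) (cong not u))))
        ... | inj₂ u | tri> _ _ gt rewrite u = -‿monoʳ (ρ j) (ℤ.<⇒≤ (ρ-down gt (≤-trans (<⇒≤ a′<j) j≤) (trans (proj₂ cl gt) u)))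

      right-max : ∀ {b′} → j < b′ → b′ ≤ suc m → Chk K j b′ → μ m dir j b′ ≤ μ m dir j b
      right-max {b′} j<b′ b′≤ C = ℤ.drop‿+≤+ (subst₂ ℤ._≤_ (sym (μ-right j<b′ b′≤)) (sym (μ-right (RightNbr.j<b Rb) (RightNbr.b≤ Rb))) main)
        where
        cl = right-closer j<b′ b′≤ C
        main : (if up j then π j ℤ.- π b′ else π b′ ℤ.- π j) ℤ.≤ (if up j then π j ℤ.- π b else π b ℤ.- π j)
        main with bool (up j) | <-cmp b b′
        ... | _ | tri≈ _ refl _ = ℤ.≤-refl
        ... | inj₁ u | tri< lt _ _ rewrite u = -‿monoʳ (π j) (ℤ.<⇒≤ (π-down lt b′≤ (trans (proj₁ cl lt) (cong not u))))
        ... | inj₁ u | tri> _ _ gt rewrite u = -‿monoʳ (π j) (ℤ.<⇒≤ (π-up gt (RightNbr.b≤ Rb) (trans (proj₂ cl gt) u)))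
        ... | inj₂ u | tri< lt _ _ rewrite u = ℤ.+-monoˡ-≤ (ℤ.- π j) (ℤ.<⇒≤ (π-up lt b′≤ (trans (proj₁ cl lt) (cong not u))))
        ... | inj₂ u | tri> _ _ gt rewrite u = ℤ.+-monoˡ-≤ (ℤ.- π j) (ℤ.<⇒≤ (π-down gt (RightNbr.b≤ Rb) (trans (proj₂ cl gt) u)))

      pℓ≡ : pℓ m dir T j ≡ μ m dir j a
      pℓ≡ = ≤-antisym
        (maxL-filter-≤ p (μ m dir j) (μ m dir j a) (λ k → 0 ℕ.+ k) (suc (j ∸ 1)) λ i i< e →
          left-max (<-≤-trans i< (≤-reflexive j≡)) (edgeL⇒Chk (<-≤-trans i< (≤-reflexive j≡)) j≤ e))
        (≤-maxL-filter p (μ m dir j) (λ k → 0 ℕ.+ k) (suc (j ∸ 1)) a (<-≤-trans (LeftNbr.a<j La) (≤-reflexive (sym j≡)))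
          (Chk⇒edgeL (LeftNbr.a<j La) j≤ (proj₁ (proj₂ chks))))
        where
        p : ℕ → Bool
        p i = edgeL m dir T i j
        j≡ : suc (j ∸ 1) ≡ j
        j≡ = m+[n∸m]≡n (proj₁ ij)

      pr≡ : pr m dir T j ≡ μ m dir j b
      pr≡ = ≤-antisym
        (maxL-filter-≤ p (μ m dir j) (μ m dir j b) (λ k → suc j ℕ.+ k) (suc m ∸ j) λ i i< e →
          right-max (s≤s (m≤m+n j i)) (lt i i<) (edgeL⇒Chk (s≤s (m≤m+n j i)) (lt i i<) e))
        (subst (λ z → μ m dir j z ≤ mx) b≡ (≤-maxL-filter p (μ m dir j) (λ k → suc j ℕ.+ k) (suc m ∸ j) (b ∸ suc j)
          (∸-monoˡ-< (s≤s (RightNbr.b≤ Rb)) (RightNbr.j<b Rb))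
          (subst (λ z → p z ≡ true) (sym b≡) (Chk⇒edgeL (RightNbr.j<b Rb) (RightNbr.b≤ Rb) (proj₂ (proj₂ chks))))))
        where
        p : ℕ → Bool
        p i = edgeL m dir T j i
        mx = maxL (List.map (μ m dir j) (filter (λ z → p z Bool.≟ true) (applyUpTo (λ k → suc j ℕ.+ k) (suc m ∸ j))))
        b≡ : suc j ℕ.+ (b ∸ suc j) ≡ b
        b≡ = m+[n∸m]≡n (RightNbr.j<b Rb)
        lt : ∀ i → i < suc m ∸ j → suc j ℕ.+ i ≤ suc m
        lt i i< = ≤-trans (≤-reflexive (trans (cong suc (+-comm j i)) refl))
                    (≤-trans (+-monoˡ-≤ j i<) (≤-reflexive (m∸n+n≡m j≤)))

      ω≡ : + ω m dir T j ≡ ω-area j a b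
      ω≡ = trans (ℤ.pos-* (pℓ m dir T j) (pr m dir T j)) (trans (cong₂ (λ x y → + x ℤ.* + y) pℓ≡ pr≡)
        (trans (cong₂ ℤ._*_ (μ-left (LeftNbr.a<j La) (proj₂ ij)) (μ-right (RightNbr.j<b Rb) (RightNbr.b≤ Rb))) lem))
        where
        lem : (if up j then ρ a ℤ.- ρ j else ρ j ℤ.- ρ a) ℤ.* (if up j then π j ℤ.- π b else π b ℤ.- π j) ≡ ω-area j a b
        lem with bool (up j)
        ... | inj₁ u rewrite u = flip-product (ρ j) (ρ a) (π j) (π b)
        ... | inj₂ u rewrite u = refl

      coord≡gain : coord T j ≡ gain j a b
      coord≡gain = trans (sym (coord≡ T j)) (trans (cong (λ v → if not v then + ω m dir T j else + suc m ℤ.- + ω m dir T j) (up≡ j))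
        (trans (cong (λ w → if not (up j) then w else + suc m ℤ.- w) ω≡) (if-not (up j))))
        where
        if-not : ∀ u {x y : ℤ} → (if not u then x else y) ≡ (if u then y else x)
        if-not true  = refl
        if-not false = refl

    coord-tight : ∀ J → Tight K (coord T) J
    coord-tight = greedy-tight K K-inj (coord T) λ {j} {a} {b} ij La Rb → At.coord≡gain j ij a b La Rb

  -- The half turn

  module Symmetry (n : ℕ) (m≡ : m ≡ n ℕ.+ n) (1≤n : 1 ≤ n)
    (dir-sym : ∀ i → 1 ≤ i → i ≤ m ∸ 2 → dir (m ∸ i ∸ 1) ≡ not (dir i)) where

    2≤m : 2 ≤ m
    2≤m = subst (2 ≤_) (sym m≡) (+-mono-≤ 1≤n 1≤n)

    bar : ℕ → ℕ
    bar i = suc m ∸ i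

    bar-bar : ∀ {i} → i ≤ suc m → bar (bar i) ≡ i
    bar-bar = m∸[m∸n]≡n

    bar-< : ∀ {i j} → i < j → j ≤ suc m → bar j < bar i
    bar-< p q = ∸-monoʳ-< p q

    bar-≤ : ∀ {i j} → i ≤ j → bar j ≤ bar i
    bar-≤ p = ∸-monoʳ-≤ (suc m) p

    bar-m : bar m ≡ 1
    bar-m = m+n∸n≡m 1 m

    bar-inner : ∀ {i} → Inner i → Inner (bar i)
    bar-inner {i} (p , q) = subst (_≤ bar i) bar-m (bar-≤ q) , bar-≤ p

    bar-mid : ∀ {i} → 1 < i → i < m → 1 < bar i × bar i < m
    bar-mid {i} p q = subst (_< bar i) bar-m (bar-< q (n≤1+n m)) , bar-< p (≤-trans (<⇒≤ q) (n≤1+n m))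

    up-bar : ∀ {i} → 1 < i → i < m → up (bar i) ≡ not (up i)
    up-bar {suc i} (s≤s p) q = begin
      up (bar (suc i))       ≡⟨ up-mid (proj₁ bm) (proj₂ bm) ⟩
      not (dir (m ∸ i ∸ 1))  ≡⟨ cong not (dir-sym i p (∸-monoˡ-≤ 2 q)) ⟩
      not (not (dir i))      ≡⟨ cong not (sym (up-mid (s≤s p) q)) ⟩
      not (up (suc i))       ∎
      where
      open ≡-Reasoning
      bm = bar-mid (s≤s p) q

    down-m : up m ≡ false
    down-m = down-≥m ≤-refl

    down-top : up (suc m) ≡ false
    down-top = down-≥m (n≤1+n m)

    -- The half turn on labels: besides i ↦ m + 1 − i it exchanges 0 with m and 1 with m + 1.
    opaque
      σ : ℕ → ℕ
      σ i = if does (i ≟ 0) then m else if does (i ≟ 1) then suc m else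
            if does (i ≟ m) then 0 else if does (i ≟ suc m) then 1 else bar i

      σ-0 : σ 0 ≡ m
      σ-0 = refl

      σ-1 : σ 1 ≡ suc m
      σ-1 = refl

      σ-m : σ m ≡ 0
      σ-m rewrite dec-false (m ≟ 0) (>⇒≢ 1≤m) | dec-false (m ≟ 1) (>⇒≢ 2≤m) | dec-true (m ≟ m) refl = refl

      σ-top : σ (suc m) ≡ 1
      σ-top rewrite dec-false (suc m ≟ 1) (>⇒≢ 1≤m ∘ suc-injective) | dec-false (suc m ≟ m) (>⇒≢ (n<1+n m))
        | dec-true (suc m ≟ suc m) refl = refl

      σ-mid : ∀ {i} → 1 < i → i < m → σ i ≡ bar i
      σ-mid {i} p q rewrite dec-false (i ≟ 0) (>⇒≢ (<-trans (s≤s z≤n) p)) | dec-false (i ≟ 1) (>⇒≢ p)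
        | dec-false (i ≟ m) (<⇒≢ q) | dec-false (i ≟ suc m) (<⇒≢ (<-trans q (n<1+n m))) = refl

    data Place : ℕ → Set where
      at-0   : Place 0
      at-1   : Place 1
      at-m   : Place m
      at-top : Place (suc m)
      in-mid : ∀ {i} → 1 < i → i < m → Place i

    place : ∀ {i} → i ≤ suc m → Place i
    place {zero} _ = at-0
    place {suc zero} _ = at-1
    place {suc (suc i)} i≤ with <-cmp (suc (suc i)) m
    ... | tri< p _ _ = in-mid (s≤s (s≤s z≤n)) p
    ... | tri≈ _ refl _ = at-m
    ... | tri> _ _ p with ≤-antisym i≤ p
    ...   | refl = at-top

    σσ : ∀ {i} → i ≤ suc m → σ (σ i) ≡ i
    σσ i≤ with place i≤
    ... | at-0 = trans (cong σ σ-0) σ-m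
    ... | at-1 = trans (cong σ σ-1) σ-top
    ... | at-m = trans (cong σ σ-m) σ-0
    ... | at-top = trans (cong σ σ-top) σ-1
    ... | in-mid p q = trans (cong σ (σ-mid p q)) (trans (σ-mid (proj₁ (bar-mid p q)) (proj₂ (bar-mid p q))) (bar-bar i≤))

    σ≤ : ∀ {i} → i ≤ suc m → σ i ≤ suc m
    σ≤ {i} i≤ with place i≤
    ... | at-0 = subst (_≤ suc m) (sym σ-0) (n≤1+n m)
    ... | at-1 = subst (_≤ suc m) (sym σ-1) ≤-refl
    ... | at-m = subst (_≤ suc m) (sym σ-m) z≤n
    ... | at-top = subst (_≤ suc m) (sym σ-top) (s≤s z≤n)
    ... | in-mid p q = subst (_≤ suc m) (sym (σ-mid p q)) (m∸n≤m (suc m) i)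

    -- `σ` does not reverse the order at the extreme labels. What survives for a left end is its
    -- comparison with `bar`, which moves the labels of the chord; `high-σ` does the same for right
    -- ends.
    low-σ : ∀ {a} → a < m → 2 ≤ σ a × (∀ {j} → 1 ≤ j → a ≤ j → bar j ≤ σ a)
                          × (∀ {j} → 1 < j → a < j → j ≤ suc m → bar j < σ a)
    low-σ {a} a<m with place (≤-trans (<⇒≤ a<m) (n≤1+n m))
    ... | at-0 = subst (λ z → 2 ≤ z × (∀ {j} → 1 ≤ j → 0 ≤ j → bar j ≤ z) × (∀ {j} → 1 < j → 0 < j → j ≤ suc m → bar j < z)) (sym σ-0)
                   (2≤m , (λ p _ → bar-≤ p) , λ p _ q → bar-< p q)
    ... | at-1 = subst (λ z → 2 ≤ z × (∀ {j} → 1 ≤ j → 1 ≤ j → bar j ≤ z) × (∀ {j} → 1 < j → 1 < j → j ≤ suc m → bar j < z)) (sym σ-1)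
                   (≤-trans 2≤m (n≤1+n m) , (λ {j} _ _ → m∸n≤m (suc m) j) , λ p _ q → <-trans (bar-< p q) (n<1+n m))
    ... | at-m = ⊥-elim (<-irrefl refl a<m)
    ... | at-top = ⊥-elim (<-asym a<m (n<1+n m))
    ... | in-mid p q = subst (λ z → 2 ≤ z × (∀ {j} → 1 ≤ j → a ≤ j → bar j ≤ z) × (∀ {j} → 1 < j → a < j → j ≤ suc m → bar j < z)) (sym (σ-mid p q))
                   (proj₁ (bar-mid p q) , (λ _ → bar-≤) , λ _ → bar-<)

    high-σ : ∀ {b} → 2 ≤ b → b ≤ suc m → σ b < m × (∀ {j} → j ≤ m → j ≤ b → σ b ≤ bar j)
                          × (∀ {j} → j < m → j < b → σ b < bar j)
    high-σ {b} 2≤b b≤ with place b≤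
    ... | at-1 = ⊥-elim (<-irrefl refl 2≤b)
    ... | at-m = subst (λ z → z < m × (∀ {j} → j ≤ m → j ≤ m → z ≤ bar j) × (∀ {j} → j < m → j < m → z < bar j)) (sym σ-m)
                   (1≤m , (λ _ _ → z≤n) , λ p _ → m<n⇒0<n∸m (<-trans p (n<1+n m)))
    ... | at-top = subst (λ z → z < m × (∀ {j} → j ≤ m → j ≤ suc m → z ≤ bar j) × (∀ {j} → j < m → j < suc m → z < bar j)) (sym σ-top)
                   (2≤m , (λ p _ → m<n⇒0<n∸m (s≤s p)) , λ {j} p _ → subst (_< bar j) bar-m (bar-< p (n≤1+n m)))
    ... | in-mid p q = subst (λ z → z < m × (∀ {j} → j ≤ m → j ≤ b → z ≤ bar j) × (∀ {j} → j < m → j < b → z < bar j)) (sym (σ-mid p q))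
                   (proj₂ (bar-mid p q) , (λ _ → bar-≤) , λ _ r → bar-< r b≤)

    -- Excludes just the sides `{0, 1}` and `{m, m + 1}`, which the half turn exchanges without
    -- reversing the order of their labels.
    Proper : ℕ → ℕ → Set
    Proper a b = a < b × b ≤ suc m × 2 ≤ b × a < m

    σ-< : ∀ {a b} → Proper a b → σ b < σ a
    σ-< {a} {b} (a<b , b≤ , 2≤b , a<m) with place b≤
    ... | at-0 = ⊥-elim (n≮0 a<b)
    ... | at-1 = ⊥-elim (<-irrefl refl 2≤b)
    ... | at-m = subst (_< σ a) (sym σ-m) (≤-trans (s≤s z≤n) (proj₁ (low-σ a<m)))
    ... | at-top = subst (_< σ a) (sym σ-top) (proj₁ (low-σ a<m))
    ... | in-mid r s = subst (_< σ a) (sym (σ-mid r s)) (proj₂ (proj₂ (low-σ a<m)) 2≤b a<b b≤)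

    σ-proper : ∀ {a b} → Proper a b → Proper (σ b) (σ a)
    σ-proper P@(a<b , b≤ , 2≤b , a<m) =
      σ-< P , σ≤ (≤-trans (<⇒≤ a<b) b≤) , proj₁ (low-σ a<m) , proj₁ (high-σ 2≤b b≤)

    -- The half turn exchanges above and below. As middle labels of triangles even 1 and `m` move by
    -- `bar`, whereas as vertices they move by `σ`; hence the separate cases.
    R-bar : ∀ {a b j} → Proper a b → Inner j → R (σ b) (σ a) (bar j) ≡ not (R a b j)
    R-bar {a} {b} {j} P@(a<b , b≤ , 2≤b , a<m) ij with zone a b j
    ... | left p with place (≤-trans (<⇒≤ a<m) (n≤1+n m))
    ...   | at-0 = ⊥-elim (<⇒≱ (proj₁ ij) p)
    ...   | at-m = ⊥-elim (<-irrefl refl a<m)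
    ...   | at-top = ⊥-elim (<-asym a<m (n<1+n m))
    ...   | in-mid r s = trans (R-right (σ-< P) (≤-trans (≤-reflexive (σ-mid r s)) (bar-≤ p)))
                           (trans (cong up (σ-mid r s)) (trans (up-bar r s) (cong not (sym (R-left p)))))
    ...   | at-1 with ≤-antisym p (proj₁ ij)
    ...     | refl = trans (R-mid (proj₁ (high-σ 2≤b b≤)) (subst (m <_) (sym σ-1) ≤-refl))
                       (trans (cong not down-m) (sym (trans (cong not (R-left p)) (cong not down-1))))
    R-bar {a} {b} {j} P@(a<b , b≤ , 2≤b , a<m) ij | right p with place b≤
    ...   | at-1 = ⊥-elim (<-irrefl refl 2≤b)
    ...   | at-top = ⊥-elim (<⇒≱ (s≤s (proj₂ ij)) p)
    ...   | in-mid r s = trans (R-left (≤-trans (bar-≤ p) (≤-reflexive (sym (σ-mid r s)))))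
                           (trans (cong up (σ-mid r s)) (trans (up-bar r s) (cong not (sym (R-right a<b p)))))
    ...   | at-m with ≤-antisym p (proj₂ ij)
    ...     | refl = trans (cong (R (σ m) (σ a)) bar-m)
                       (trans (R-mid (subst (_< 1) (sym σ-m) ≤-refl) (proj₁ (low-σ a<m)))
                         (trans (cong not down-1) (sym (trans (cong not (R-right a<b p)) (cong not down-m)))))
    R-bar {a} {b} {j} P@(a<b , b≤ , 2≤b , a<m) ij | mid p q with place (≤-trans (proj₂ ij) (n≤1+n m))
    ...   | at-top = ⊥-elim (1+n≰n (proj₂ ij))
    ...   | in-mid r s = trans (R-mid (proj₂ (proj₂ (high-σ 2≤b b≤)) s q) (proj₂ (proj₂ (low-σ a<m)) r p (≤-trans (<⇒≤ q) b≤)))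
                           (trans (cong not (up-bar r s)) (cong not (sym (R-mid p q))))
    ...   | at-1 = trans (cong (λ z → R (σ b) z m) σa)
                     (trans (R-right (proj₁ (high-σ 2≤b b≤)) ≤-refl)
                       (trans down-m (sym (trans (cong not (R-mid p q)) (cong (λ v → not (not v)) down-1)))))
      where
      σa : σ a ≡ m
      σa = trans (cong σ (n<1⇒n≡0 p)) σ-0
    ...   | at-m = trans (cong₂ (λ z w → R z (σ a) w) σb bar-m)
                     (trans (R-left ≤-refl) (trans down-1 (sym (trans (cong not (R-mid p q)) (cong (λ v → not (not v)) down-m)))))
      where
      σb : σ b ≡ 1
      σb = trans (cong σ (≤-antisym b≤ q)) σ-top

    side-bar : ∀ {a b j u} → Proper a b → Side u a b j → Side (not u) (σ b) (σ a) (bar j)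
    side-bar P@(a<b , b≤ , 2≤b , a<m) (ij , a≤j , j≤b , e) =
      bar-inner ij , proj₁ (proj₂ (high-σ 2≤b b≤)) (proj₂ ij) j≤b , proj₁ (proj₂ (low-σ a<m)) (proj₁ ij) a≤j
      , trans (R-bar P ij) (cong not e)

    side-bar′ : ∀ {a b j u} → Proper a b → Side u (σ b) (σ a) j → Side (not u) a b (bar j)
    side-bar′ {a} {b} {j} {u} P@(a<b , b≤ , _ , _) s =
      subst₂ (λ x y → Side (not u) x y (bar j)) (σσ (≤-trans (<⇒≤ a<b) b≤)) (σσ b≤) (side-bar (σ-proper P) s)

    diagonal-proper : ∀ {p q a b} → Chord p q a b → IsDiagonal (m ℕ.+ 2) p q → Proper a b
    diagonal-proper {p} {q} {a} {b} c d = a<b , b≤ , 2≤b , a<m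
      where
      a<b = chord-< c
      b≤ = chord-≤ c
      sides = diagonal⇒sides c d
      2≤b : 2 ≤ b
      2≤b with b ≤? 1 | sides
      ... | no x | _ = ≰⇒> x
      ... | yes x | (j , ij , _ , j≤b , e) , _ = ⊥-elim (true≢false e (trans (R-right a<b b≤j) (trans (cong up b≡1) down-1)))
        where
        b≡1 : b ≡ 1
        b≡1 = ≤-antisym x (≤-trans (proj₁ ij) j≤b)
        b≤j = ≤-trans x (proj₁ ij)
      a<m : a < m
      a<m with m ≤? a | sides
      ... | no x | _ = ≰⇒> x
      ... | yes x | (j , ij , a≤j , _ , e) , _ = ⊥-elim (true≢false e (trans (R-left (≤-trans (proj₂ ij) x)) (down-≥m x)))

    -- The sum is constant because `bar` exchanges the kinds: when `i` advances, the second count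
    -- gains a down label exactly when the first loses an up one.
    cu+cd : ∀ i → 1 ≤ i → i < m → cu (m ∸ i) ℕ.+ cd i ≡ cu (m ∸ 1) ℕ.+ 1
    cu+cd (suc zero) _ _ = cong (cu (m ∸ 1) ℕ.+_) (cnt-true (not ∘ up) {0} (cong not down-1))
    cu+cd (suc (suc i)) _ q = trans (sym lem) (cu+cd (suc i) (s≤s z≤n) (<-trans (n<1+n _) q))
      where
      k = m ∸ suc (suc i)
      sk : m ∸ suc i ≡ suc k
      sk = +-∸-assoc 1 (<⇒≤ q)
      ub : up (suc k) ≡ not (up (suc (suc i)))
      ub = trans (cong up (sym sk)) (up-bar (s≤s (s≤s z≤n)) q)
      lem : cu (m ∸ suc i) ℕ.+ cd (suc i) ≡ cu k ℕ.+ cd (suc (suc i))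
      lem with bool (up (suc (suc i)))
      ... | inj₁ u = cong₂ ℕ._+_ (trans (cong cu sk) (cnt-false up (trans ub (cong not u)))) (sym (cnt-false (not ∘ up) (cong not u)))
      ... | inj₂ d = trans (cong (ℕ._+ cd (suc i)) (trans (cong cu sk) (cnt-true up (trans ub (cong not d)))))
                       (trans (sym (+-suc (cu k) (cd (suc i)))) (cong (cu k ℕ.+_) (sym (cnt-true (not ∘ up) (cong not d)))))

    m≡suc : m ≡ suc (m ∸ 1)
    m≡suc = sym (m+[n∸m]≡n 1≤m)

    cu-m : cu m ≡ cu (m ∸ 1)
    cu-m = trans (cong cu m≡suc) (cnt-false up (trans (cong up (sym m≡suc)) down-m))

    cd-m : cd m ≡ suc (cd (m ∸ 1))
    cd-m = trans (cong cd m≡suc) (cnt-true (not ∘ up) (cong not (trans (cong up (sym m≡suc)) down-m)))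

    cd-m∸1 : cd (m ∸ 1) ≡ cu (m ∸ 1) ℕ.+ 1
    cd-m∸1 = trans (cong (ℕ._+ cd (m ∸ 1)) (sym zero-up)) (cu+cd (m ∸ 1) (∸-monoˡ-≤ 1 2≤m) (≤-reflexive (sym m≡suc)))
      where
      zero-up : cu (m ∸ (m ∸ 1)) ≡ 0
      zero-up = trans (cong cu (m∸[m∸n]≡n 1≤m)) (cnt-false up {0} down-1)

    half : cu (m ∸ 1) ℕ.+ 1 ≡ n
    half = double-injective (trans (sym m≡2c) m≡)
      where
      c = cu (m ∸ 1)
      m≡2c : m ≡ (c ℕ.+ 1) ℕ.+ (c ℕ.+ 1)
      m≡2c = trans (sym (cd+cu m)) (trans (cong₂ ℕ._+_ (trans cd-m (cong suc cd-m∸1)) cu-m)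
               (trans (sym (+-suc (c ℕ.+ 1) c)) (cong ((c ℕ.+ 1) ℕ.+_) (+-comm 1 c))))
      double-injective : ∀ {x y} → x ℕ.+ x ≡ y ℕ.+ y → x ≡ y
      double-injective {x} {y} e with <-cmp x y
      ... | tri< p _ _ = ⊥-elim (<-irrefl e (+-mono-< p p))
      ... | tri≈ _ p _ = p
      ... | tri> _ _ p = ⊥-elim (<-irrefl (sym e) (+-mono-< p p))

    cu+cd≡n : ∀ {i} → 1 ≤ i → i < m → cu (m ∸ i) ℕ.+ cd i ≡ n
    cu+cd≡n p q = trans (cu+cd _ p q) half

    cd-m≡ : cd m ≡ suc n
    cd-m≡ = trans cd-m (cong suc (trans cd-m∸1 half))

    N≡2n : suc n ℕ.+ suc n ≡ N
    N≡2n = cong suc (trans (+-suc n n) (cong suc (sym m≡)))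

    -- An alternative of two exact equations, rather than a congruence modulo `N`, is what the
    -- unrolled positions can use.
    half-turn : ∀ {i} → i ≤ suc m → posn (σ i) ≡ posn i ℕ.+ suc n ⊎ posn (σ i) ℕ.+ suc n ≡ posn i
    half-turn {i} i≤ with place i≤
    ... | at-0 = inj₁ (trans (cong posn σ-0) (trans posn-m (sym (cong (ℕ._+ suc n) pos-zero))))
      where
      posn-m : posn m ≡ suc n
      posn-m = trans (pos-down (n≤1+n m) down-m) cd-m≡
    ... | at-1 = inj₁ (trans (cong posn σ-1) (trans (pos-down ≤-refl down-top) (trans cd-top (trans (cong suc cd-m≡)
                   (sym (cong (ℕ._+ suc n) (trans (pos-down (s≤s z≤n) down-1) (cnt-true (not ∘ up) {0} (cong not down-1)))))))))
    ... | at-m = inj₂ (trans (cong (λ z → posn z ℕ.+ suc n) σ-m) (trans (cong (ℕ._+ suc n) pos-zero)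
                   (sym (trans (pos-down (n≤1+n m) down-m) cd-m≡))))
    ... | at-top = inj₂ (trans (cong (λ z → posn z ℕ.+ suc n) σ-top)
                   (trans (cong (ℕ._+ suc n) (trans (pos-down (s≤s z≤n) down-1) (cnt-true (not ∘ up) {0} (cong not down-1))))
                     (sym (trans (pos-down ≤-refl down-top) (trans cd-top (cong suc cd-m≡))))))
    ... | in-mid p q with bool (up i)
    ...   | inj₂ d = inj₁ (trans (cong posn (σ-mid p q)) (+-cancelʳ-≡ (cu (bar i)) _ _ (trans (pos-up ub) (sym eq))))
      where
      ub : up (bar i) ≡ true
      ub = trans (up-bar p q) (cong not d)
      bs : bar i ≡ suc (m ∸ i)
      bs = +-∸-assoc 1 (<⇒≤ q)
      cub : cu (bar i) ≡ suc (cu (m ∸ i))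
      cub = trans (cong cu bs) (cnt-true up (trans (cong up (sym bs)) ub))
      eq : (posn i ℕ.+ suc n) ℕ.+ cu (bar i) ≡ N
      eq = trans (cong₂ (λ x y → (x ℕ.+ suc n) ℕ.+ y) (pos-down i≤ d) cub)
             (trans (cong (ℕ._+ suc (cu (m ∸ i))) (+-comm (cd i) (suc n)))
               (trans (+-assoc (suc n) (cd i) _) (trans (cong (suc n ℕ.+_)
                 (trans (+-suc (cd i) _) (cong suc (trans (+-comm (cd i) _) (cu+cd≡n (<⇒≤ p) q))))) N≡2n)))
    ...   | inj₁ u = inj₂ (trans (cong (λ z → posn z ℕ.+ suc n) (σ-mid p q)) (+-cancelʳ-≡ (cu i) _ _ (trans eq (sym (pos-up u)))))
      where
      db : up (bar i) ≡ false
      db = trans (up-bar p q) (cong not u)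
      bs : bar i ≡ suc (m ∸ i)
      bs = +-∸-assoc 1 (<⇒≤ q)
      cdb : cd (bar i) ≡ suc (cd (m ∸ i))
      cdb = trans (cong cd bs) (cnt-true (not ∘ up) (trans (cong (not ∘ up) (sym bs)) (cong not db)))
      comp : cd (m ∸ i) ℕ.+ cu i ≡ n
      comp = trans (+-comm (cd (m ∸ i)) (cu i)) (trans (cong (λ z → cu z ℕ.+ cd (m ∸ i)) (sym (m∸[m∸n]≡n (<⇒≤ q))))
               (cu+cd≡n (m<n⇒0<n∸m q) (∸-monoʳ-< (<-trans (s≤s z≤n) p) (<⇒≤ q))))
      eq : (posn (bar i) ℕ.+ suc n) ℕ.+ cu i ≡ N
      eq = trans (cong (λ z → (z ℕ.+ suc n) ℕ.+ cu i) (trans (pos-down (m∸n≤m (suc m) i) db) cdb))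
             (trans (cong (ℕ._+ cu i) (+-comm (suc (cd (m ∸ i))) (suc n)))
               (trans (+-assoc (suc n) (suc (cd (m ∸ i))) (cu i)) (trans (cong (λ z → suc n ℕ.+ suc z) comp) N≡2n)))

    rot-posn : ∀ {i} → i ≤ suc m → (posn i ℕ.+ suc n) % N ≡ posn (σ i)
    rot-posn {i} i≤ with half-turn i≤
    ... | inj₁ e = trans (cong (_% N) (sym e)) (m<n⇒m%n≡m (pos< (σ≤ i≤)))
    ... | inj₂ e = trans (cong (_% N) (trans (cong (ℕ._+ suc n) (sym e)) (trans (+-assoc (posn (σ i)) (suc n) (suc n)) (cong (posn (σ i) ℕ.+_) N≡2n))))
                     (trans ([m+n]%n≡m%n (posn (σ i)) N) (m<n⇒m%n≡m (pos< (σ≤ i≤))))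

    posn-top≡n : posn (suc m) ≡ suc (suc n)
    posn-top≡n = trans (pos-down ≤-refl down-top) (trans cd-top (cong suc cd-m≡))

    posn-up> : ∀ {i} → up i ≡ true → suc (suc n) < posn i
    posn-up> u = subst (_< posn _) posn-top≡n (pos-<-up (<-trans (proj₂ (up⇒inner u)) (n<1+n m)) ≤-refl u)

    large-posn : ∀ {i} → 2 ≤ i → i ≤ suc m → up (σ i) ≡ false → suc n ≤ posn i
    large-posn {i} 2≤i i≤ d with place i≤
    ... | at-1 = ⊥-elim (<-irrefl refl 2≤i)
    ... | at-m = ≤-reflexive (sym (trans (pos-down (n≤1+n m) down-m) cd-m≡))
    ... | at-top = ≤-trans (n≤1+n (suc n)) (≤-reflexive (sym posn-top≡n))
    ... | in-mid p q = ≤-trans (n≤1+n (suc n)) (<⇒≤ (posn-up> ui))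
      where
      ui : up i ≡ true
      ui = trans (sym (not-involutive (up i))) (cong not (trans (sym (up-bar p q)) (trans (cong up (sym (σ-mid p q))) d)))

    -- The half turn makes right ends into left ends, hence `π` into `ρ`. For 0 and 1 the equation
    -- would be off by a full turn, since their images `m` and `m + 1` have positive `ρ`.
    ρ-σ : ∀ {i} → 2 ≤ i → i ≤ suc m → ρ (σ i) ≡ π i ℤ.- + suc n
    ρ-σ {i} 2≤i i≤ with bool (up (σ i)) | half-turn i≤
    ... | inj₂ d | inj₂ e = trans (sym (π-down≡ (σ≤ i≤) d)) (trans (π≡ (σ i)) (trans (+-move e) (cong (λ z → z ℤ.- + suc n) (sym (π≡ i)))))
    ... | inj₂ d | inj₁ e = ⊥-elim (<⇒≱ (pos< (σ≤ i≤)) (≤-trans (≤-reflexive (sym N≡2n))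
            (≤-trans (+-monoˡ-≤ (suc n) (large-posn 2≤i i≤ d)) (≤-reflexive (sym e)))))
    ... | inj₁ u | inj₂ e = ⊥-elim (<⇒≱ (pos< i≤) (≤-trans (≤-reflexive (sym N≡2n))
            (≤-trans (+-monoˡ-≤ (suc n) (≤-trans (n≤1+n (suc n)) (<⇒≤ (posn-up> u)))) (≤-reflexive e))))
    ... | inj₁ u | inj₁ e = begin
        ρ (σ i)                                      ≡⟨ lem₁ (ρ (σ i)) (+ N) ⟩
        (ρ (σ i) ℤ.+ + N) ℤ.- + N                    ≡⟨ cong (λ z → z ℤ.- + N) (sym (π-up≡ (σ≤ i≤) u)) ⟩
        π (σ i) ℤ.- + N                              ≡⟨ cong₂ ℤ._-_ (trans (π≡ (σ i)) (trans (cong +_ e) (cong (λ z → z ℤ.+ + suc n) (sym (π≡ i))))) (cong +_ (sym N≡2n)) ⟩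
        (π i ℤ.+ + suc n) ℤ.- (+ suc n ℤ.+ + suc n)  ≡⟨ lem₂ (π i) (+ suc n) ⟩
        π i ℤ.- + suc n                              ∎
      where
      open ≡-Reasoning
      lem₁ : ∀ x y → x ≡ (x ℤ.+ y) ℤ.- y
      lem₁ = solve-∀
      lem₂ : ∀ x y → (x ℤ.+ y) ℤ.- (y ℤ.+ y) ≡ x ℤ.- y
      lem₂ = solve-∀

    π-σ : ∀ {i} → i < m → π (σ i) ≡ ρ i ℤ.+ + suc n
    π-σ {i} i<m = trans (lem (π (σ i)) (+ suc n)) (cong (λ z → z ℤ.+ + suc n)
        (trans (sym (ρ-σ (proj₁ (low-σ i<m)) (σ≤ i≤))) (cong ρ (σσ i≤))))
      where
      i≤ = ≤-trans (<⇒≤ i<m) (n≤1+n m)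
      lem : ∀ x y → x ≡ (x ℤ.- y) ℤ.+ y
      lem = solve-∀

    -- Centrally symmetric triangulations and their coordinates

    record Key (K : ℕ → ℕ) : Set where
      field
        injective : ∀ {i j} → Inner i → Inner j → K i ≡ K j → i ≡ j
        reversing : ∀ {i j} → Inner i → Inner j → K i < K j → K (bar j) < K (bar i)

    Antisymmetric : (ℕ → ℕ) → Set
    Antisymmetric c = ∀ {i j} → Inner i → Inner j → c i < c j → c (bar j) < c (bar i)

    CS : DiagSet → Set
    CS S = ∀ p q → (p , q) ∈D S → memU S ((p ℕ.+ suc n) % N) ((q ℕ.+ suc n) % N) ≡ true

    memU-comm : ∀ S x y → memU S x y ≡ memU S y x
    memU-comm S x y = cong₂ S (⊓-comm x y) (⊔-comm x y)

    memU-turn : ∀ S {p q a b} → Chord p q a b →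
                memU S ((p ℕ.+ suc n) % N) ((q ℕ.+ suc n) % N) ≡ memU S (posn (σ b)) (posn (σ a))
    memU-turn S (from-down x y _ refl refl) =
      trans (cong₂ (memU S) (rot-posn (≤-trans (<⇒≤ x) y)) (rot-posn y)) (memU-comm S _ _)
    memU-turn S (from-up x y _ refl refl) = cong₂ (memU S) (rot-posn y) (rot-posn (≤-trans (<⇒≤ x) y))

    σ-chord : ∀ {a b} → Proper a b → Chord (posn (σ b) ⊓ posn (σ a)) (posn (σ b) ⊔ posn (σ a)) (σ b) (σ a)
    σ-chord P = let lt , le , _ = σ-proper P in chord-of lt le

    Tri-symmetric : ∀ {c} → Antisymmetric c → CS (Tri c)
    Tri-symmetric {c} anti p q t = trans (memU-turn (Tri c) ch)
        (chord-Tri {c} (σ-chord P) (sides⇒diagonal (σ-chord P) (side-bar P (proj₂ (proj₂ sides))) (side-bar P (proj₂ (proj₁ sides)))) chk)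
      where
      d = Tri-wellFormed c p q t
      ch = diagonal-chord d
      P = diagonal-proper ch d
      sides = diagonal⇒sides ch d
      chk : Chk c (σ _) (σ _)
      chk {j} {k} l u = subst₂ (λ x y → c x < c y) (bar-bar (i≤ l)) (bar-bar (i≤ u))
          (anti (bar-inner (proj₁ u)) (bar-inner (proj₁ l)) (Tri-chord {c} ch t (side-bar′ P u) (side-bar′ P l)))
        where
        i≤ : ∀ {v j} → Side v (σ (hi p q)) (σ (lo p q)) j → j ≤ suc m
        i≤ s = ≤-trans (proj₂ (proj₁ s)) (n≤1+n m)

    record IsTri (T : DiagSet) : Set where
      constructor isTri
      field
        triangulation : IsTriangulation m T
        symmetric     : CS T

    Tri-isTri : ∀ {K} → Key K → IsTri (Tri K)
    Tri-isTri {K} κ = isTri (Tri-isTriangulation K (Key.injective κ)) (Tri-symmetric {K} (Key.reversing κ))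

    -- Apart from the label `j` itself, `bar` carries a threshold set to the complement of the
    -- opposite one. Complementing the set compensates the exchange of up and down, so paths go to
    -- paths.
    below-bar : ∀ {K} → Key K → ∀ {i j} → Inner i → Inner j → i ≢ j →
                below K (K (bar j)) (bar i) ≡ not (below K (K j) i)
    below-bar {K} κ {i} {j} ii ij ne with <-cmp (K i) (K j)
    ... | tri< p _ _ = trans (below-false K (<⇒≤ (Key.reversing κ ii ij p))) (cong not (sym (below-true K p)))
    ... | tri≈ _ e _ = ⊥-elim (ne (Key.injective κ ii ij e))
    ... | tri> _ _ p = trans (below-true K (Key.reversing κ ij ii p)) (cong not (sym (below-false K (<⇒≤ p))))

    module _ {K : ℕ → ℕ} (κ : Key K) where

      private
        P : ℕ → ℕ → Bool
        P j = below K (K j)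

      alive-bar : ∀ {i j} → 1 < i → i < m → Inner j → i ≢ j → alive (P (bar j)) (bar i) ≡ alive (P j) i
      alive-bar {i} {j} p q ij ne = trans (alive-inner (P (bar j)) (bar-inner ii))
          (trans (cong₂ agree (up-bar p q) (below-bar κ ii ij ne)) (trans (lem (up i) (P j i)) (sym (alive-inner (P j) ii))))
        where
        ii : Inner i
        ii = <⇒≤ p , <⇒≤ q
        lem : ∀ u v → agree (not u) (not v) ≡ agree u v
        lem true  v = not-involutive v
        lem false v = refl

      i1 : Inner 1
      i1 = ≤-refl , 1≤m

      im : Inner m
      im = 1≤m , ≤-refl

      -- 1 and `m` are both down, so complementation flips whether they are visited. This matches
      -- `σ`, which exchanges 1 with `m + 1` and `m` with 0.
      alive-1 : ∀ {j} → Inner j → m ≢ j → alive (P (bar j)) 1 ≡ not (alive (P j) m)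
      alive-1 {j} ij ne = trans (alive-inner (P (bar j)) i1)
        (trans (cong₂ agree down-1 (trans (cong (P (bar j)) (sym bar-m)) (below-bar κ im ij ne)))
          (cong not (sym (trans (alive-inner (P j) im) (cong (λ u → agree u (P j m)) down-m)))))

      alive-m : ∀ {j} → Inner j → 1 ≢ j → alive (P (bar j)) m ≡ not (alive (P j) 1)
      alive-m {j} ij ne = trans (alive-inner (P (bar j)) im)
        (trans (cong₂ agree down-m (below-bar κ i1 ij ne))
          (cong not (sym (trans (alive-inner (P j) i1) (cong (λ u → agree u (P j 1)) down-1)))))

      -- The triangle at `j` is turned onto the triangle at `bar j`. At `j = m` the conclusion would
      -- fail, since `σ (m + 1)` and `bar m` are both 1.
      right⇒left : ∀ {j b} → Inner j → j < m → RightNbr (P j) j b → LeftNbr (P (bar j)) (bar j) (σ b)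
      right⇒left {j} {b} ij j<m (rightNbr j<b b≤ al dead) = leftNbr (proj₂ (proj₂ (high-σ 2≤b b≤)) j<m j<b) al′ dead′
        where
        2≤b = ≤-trans (s≤s (proj₁ ij)) j<b
        al′ : alive (P (bar j)) (σ b) ≡ true
        al′ with place b≤
        ... | at-1 = ⊥-elim (<-irrefl refl 2≤b)
        ... | at-m = trans (cong (alive (P (bar j))) σ-m) (alive-zero (P (bar j)))
        ... | at-top = trans (cong (alive (P (bar j))) σ-top) (trans (alive-1 ij (>⇒≢ j<m)) (cong not (dead m j<m (n<1+n m))))
        ... | in-mid p q = trans (cong (alive (P (bar j))) (σ-mid p q)) (trans (alive-bar p q ij (>⇒≢ j<b)) al)
        dead-1 : σ b < 1 → alive (P (bar j)) 1 ≡ false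
        dead-1 lt = trans (alive-1 ij (>⇒≢ j<m)) (cong not (trans (cong (alive (P j)) (sym b≡m)) al))
          where
          b≡m : b ≡ m
          b≡m = trans (sym (σσ b≤)) (trans (cong σ (n<1⇒n≡0 lt)) σ-0)
        dead′ : ∀ i → σ b < i → i < bar j → alive (P (bar j)) i ≡ false
        dead′ zero p q = ⊥-elim (n≮0 p)
        dead′ (suc zero) p q = dead-1 p
        dead′ i@(suc (suc i₀)) p q = trans (cong (alive (P (bar j))) (sym bb))
            (trans (alive-bar (proj₁ bm) (proj₂ bm) ij (>⇒≢ j<bi)) (dead (bar i) j<bi bi<b))
          where
          i<m : i < m
          i<m = <-≤-trans q (bar-≤ (proj₁ ij))
          bm = bar-mid (s≤s (s≤s z≤n)) i<m
          bb = bar-bar (≤-trans (<⇒≤ i<m) (n≤1+n m))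
          j<bi : j < bar i
          j<bi = subst (_< bar i) (bar-bar (≤-trans (proj₂ ij) (n≤1+n m))) (bar-< q (m∸n≤m (suc m) j))
          bi<b : bar i < b
          bi<b = ≰⇒> λ le → <⇒≱ p (subst (_≤ σ b) bb (lem le))
            where
            lem : b ≤ bar i → bar (bar i) ≤ σ b
            lem le = subst (bar (bar i) ≤_) (sym (σ-mid 2≤b (≤-<-trans le (proj₂ bm)))) (bar-≤ le)

      left⇒right : ∀ {j a} → Inner j → 1 < j → LeftNbr (P j) j a → RightNbr (P (bar j)) (bar j) (σ a)
      left⇒right {j} {a} ij 1<j (leftNbr a<j al dead) =
          rightNbr (proj₂ (proj₂ (low-σ a<m)) 1<j a<j j≤) (σ≤ a≤) al′ dead′
        where
        j≤ = ≤-trans (proj₂ ij) (n≤1+n m)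
        a<m = <-≤-trans a<j (proj₂ ij)
        a≤ = ≤-trans (<⇒≤ a<m) (n≤1+n m)
        al′ : alive (P (bar j)) (σ a) ≡ true
        al′ with place a≤
        ... | at-0 = trans (cong (alive (P (bar j))) σ-0) (trans (alive-m ij (<⇒≢ 1<j)) (cong not (dead 1 (s≤s z≤n) 1<j)))
        ... | at-1 = trans (cong (alive (P (bar j))) σ-1) (alive-top (P (bar j)))
        ... | at-m = ⊥-elim (<-irrefl refl a<m)
        ... | at-top = ⊥-elim (<-asym a<m (n<1+n m))
        ... | in-mid p q = trans (cong (alive (P (bar j))) (σ-mid p q)) (trans (alive-bar p q ij (<⇒≢ a<j)) al)
        dead′ : ∀ i → bar j < i → i < σ a → alive (P (bar j)) i ≡ false
        dead′ i p q with <-cmp i m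
        ... | tri> _ _ m<i = ⊥-elim (<⇒≱ q (≤-trans (σ≤ a≤) m<i))
        ... | tri≈ _ refl _ = trans (alive-m ij (<⇒≢ 1<j)) (cong not (trans (cong (alive (P j)) (sym a≡1)) al))
          where
          a≡1 : a ≡ 1
          a≡1 = trans (sym (σσ a≤)) (trans (cong σ (≤-antisym (σ≤ a≤) q)) σ-top)
        ... | tri< i<m _ _ = trans (cong (alive (P (bar j))) (sym bb))
              (trans (alive-bar (proj₁ bm) (proj₂ bm) ij (<⇒≢ bi<j)) (dead (bar i) a<bi bi<j))
          where
          1<i : 1 < i
          1<i = ≤-<-trans (proj₁ (bar-inner ij)) p
          bm = bar-mid 1<i i<m
          bb = bar-bar (≤-trans (<⇒≤ i<m) (n≤1+n m))
          bi<j : bar i < j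
          bi<j = subst (bar i <_) (bar-bar j≤) (bar-< p (≤-trans (<⇒≤ i<m) (n≤1+n m)))
          a<bi : a < bar i
          a<bi = ≰⇒> λ le → <⇒≱ q (subst (σ a ≤_) bb (lem le))
            where
            lem : bar i ≤ a → σ a ≤ bar (bar i)
            lem le = subst (_≤ bar (bar i)) (sym (σ-mid (<-≤-trans (proj₁ bm) le) a<m)) (bar-≤ le)

      -- The turned triangle has the same area product, and exactly one of `j` and `bar j` is up.
      gain-mid : ∀ {j a b} → 1 < j → j < m → a < j → j < b → b ≤ suc m →
                 gain j a b ℤ.+ gain (bar j) (σ b) (σ a) ≡ + suc m
      gain-mid {j} {a} {b} 1<j j<m a<j j<b b≤ = trans (cong (ℤ._+_ (gain j a b)) g′) (lem (up j))
        where
        j≤ = ≤-trans (<⇒≤ j<m) (n≤1+n m)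
        ω= : ω-area (bar j) (σ b) (σ a) ≡ ω-area j a b
        ω= = trans (cong₂ ℤ._*_
                (cong₂ ℤ._-_ (trans (cong ρ (sym (σ-mid 1<j j<m))) (ρ-σ 1<j j≤)) (ρ-σ (<-trans 1<j j<b) b≤))
                (cong₂ ℤ._-_ (π-σ (<-trans a<j j<m)) (trans (cong π (sym (σ-mid 1<j j<m))) (π-σ j<m))))
              (ring (ρ a) (ρ j) (π j) (π b) (+ suc n))
          where
          ring : ∀ ra rj pj pb k → ((pj ℤ.- k) ℤ.- (pb ℤ.- k)) ℤ.* ((ra ℤ.+ k) ℤ.- (rj ℤ.+ k)) ≡ (rj ℤ.- ra) ℤ.* (pb ℤ.- pj)
          ring = solve-∀
        g′ : gain (bar j) (σ b) (σ a) ≡ (if not (up j) then N-1 ℤ.- ω-area j a b else ω-area j a b)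
        g′ = cong₂ (λ u w → if u then N-1 ℤ.- w else w) (up-bar 1<j j<m) ω=
        lem : ∀ u → (if u then N-1 ℤ.- ω-area j a b else ω-area j a b) ℤ.+ (if not u then N-1 ℤ.- ω-area j a b else ω-area j a b) ≡ + suc m
        lem true  = ring₁ N-1 (ω-area j a b)
          where
          ring₁ : ∀ x y → (x ℤ.- y) ℤ.+ y ≡ x
          ring₁ = solve-∀
        lem false = ring₂ N-1 (ω-area j a b)
          where
          ring₂ : ∀ x y → y ℤ.+ (x ℤ.- y) ≡ x
          ring₂ = solve-∀

      -- The triangle at label 1 is {0, 1, b}; its image {σ b, m, m + 1} is the triangle at m.
      gain-1 : ∀ {b} → 2 ≤ b → b ≤ suc m → gain 1 0 b ℤ.+ gain m (σ b) (suc m) ≡ + suc m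
      gain-1 {b} 2≤b b≤ = trans (cong₂ ℤ._+_ g₁ g₂) (trans (ring (π b) (+ suc n)) (cong (λ z → + z ℤ.- 1ℤ) N≡2n))
        where
        ρ0 : ρ 0 ≡ 0ℤ
        ρ0 = trans (ρ≡down down-0) refl
        π1 : π 1 ≡ 1ℤ
        π1 = trans (π≡ 1) (cong +_ (trans (pos-down (s≤s z≤n) down-1) (cnt-true (not ∘ up) {0} (cong not down-1))))
        ρ1 : ρ 1 ≡ 1ℤ
        ρ1 = trans (sym (π-down≡ (s≤s z≤n) down-1)) π1
        πm : π m ≡ + suc n
        πm = trans (π≡ m) (cong +_ (trans (pos-down (n≤1+n m) down-m) cd-m≡))
        ρm : ρ m ≡ + suc n
        ρm = trans (sym (π-down≡ (n≤1+n m) down-m)) πm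
        πt : π (suc m) ≡ 1ℤ ℤ.+ + suc n
        πt = trans (π≡ (suc m)) (cong +_ posn-top≡n)
        g₁ : gain 1 0 b ≡ (1ℤ ℤ.- 0ℤ) ℤ.* (π b ℤ.- 1ℤ)
        g₁ = trans (if-false down-1) (cong₂ ℤ._*_ (cong₂ ℤ._-_ ρ1 ρ0) (cong (ℤ._-_ (π b)) π1))
        g₂ : gain m (σ b) (suc m) ≡ (+ suc n ℤ.- (π b ℤ.- + suc n)) ℤ.* ((1ℤ ℤ.+ + suc n) ℤ.- + suc n)
        g₂ = trans (if-false down-m) (cong₂ ℤ._*_ (cong₂ ℤ._-_ ρm (ρ-σ 2≤b b≤)) (cong₂ ℤ._-_ πt πm))
        ring : ∀ p k → (1ℤ ℤ.- 0ℤ) ℤ.* (p ℤ.- 1ℤ) ℤ.+ (k ℤ.- (p ℤ.- k)) ℤ.* ((1ℤ ℤ.+ k) ℤ.- k) ≡ (k ℤ.+ k) ℤ.- 1ℤ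
        ring = solve-∀

      module _ (T : DiagSet) (T≐ : T ≐ Tri K) where

        x≡gain : ∀ {j a b} → Inner j → LeftNbr (P j) j a → RightNbr (P j) j b → coord T j ≡ gain j a b
        x≡gain ij L R′ = At.coord≡gain K (Key.injective κ) T T≐ _ ij _ _ L R′

        x-bar-1 : coord T 1 ℤ.+ coord T m ≡ + suc m
        x-bar-1 with right-exists (P 1) 1 (proj₂ i1)
        ... | b , Rb = trans (cong₂ ℤ._+_ (x≡gain i1 L₁ Rb) (x≡gain im L₂ R₂)) (gain-1 (RightNbr.j<b Rb) (RightNbr.b≤ Rb))
          where
          L₁ : LeftNbr (P 1) 1 0
          L₁ = leftNbr (s≤s z≤n) (alive-zero (P 1)) λ i p q → ⊥-elim (<⇒≱ p (≤-pred q))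
          L₂ : LeftNbr (P m) m (σ b)
          L₂ = right⇒left i1 2≤m Rb
          R₂ : RightNbr (P m) m (suc m)
          R₂ = rightNbr (n<1+n m) ≤-refl (alive-top (P m)) λ i p q → ⊥-elim (<⇒≱ p (≤-pred q))

        x-bar : ∀ j → Inner j → coord T j ℤ.+ coord T (bar j) ≡ + suc m
        x-bar j ij with m≤n⇒m<n∨m≡n (proj₁ ij) | m≤n⇒m<n∨m≡n (proj₂ ij)
        ... | inj₂ refl | _ = x-bar-1
        ... | inj₁ _ | inj₂ refl = trans (cong (λ z → coord T m ℤ.+ coord T z) bar-m)
                                     (trans (ℤ.+-comm (coord T m) _) x-bar-1)
        ... | inj₁ 1<j | inj₁ j<m with left-exists (P j) j (proj₁ ij) | right-exists (P j) j (proj₂ ij)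
        ...   | a , La | b , Rb = trans (cong₂ ℤ._+_ (x≡gain ij La Rb) (x≡gain (bar-inner ij) (right⇒left ij j<m Rb) (left⇒right ij 1<j La)))
                  (gain-mid 1<j j<m (LeftNbr.a<j La) (RightNbr.j<b Rb) (RightNbr.b≤ Rb))

    -- Balanced weights, tie-breaks and the triangulations containing a symmetric set

    Balanced : (ℕ → ℕ) → Set
    Balanced w = ∃ λ W → ∀ {j} → Inner j → w j ℕ.+ w (bar j) ≡ W

    Balanced⇒Antisymmetric : ∀ {w} → Balanced w → Antisymmetric w
    Balanced⇒Antisymmetric {w} (W , h) {i} {j} ii ij lt =
      +-flip-< (trans (+-comm (w (bar i)) (w i)) (h ii)) (trans (+-comm (w (bar j)) (w j)) (h ij)) lt

    -- The base `N` exceeds every value of a tie-break, so the comparison is lexicographic.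
    lex : (ℕ → ℕ) → (ℕ → ℕ) → ℕ → ℕ
    lex w t j = w j ℕ.* N ℕ.+ t j

    record TieBreak (t : ℕ → ℕ) : Set where
      field
        bounded  : ∀ {j} → Inner j → t j < N
        distinct : ∀ {i j} → Inner i → Inner j → t i ≡ t j → i ≡ j
        reversed : ∀ {i j} → Inner i → Inner j → t i < t j → t (bar j) < t (bar i)

    module _ {w t : ℕ → ℕ} (τ : TieBreak t) where

      lex-< : ∀ {i j} → Inner i → w i < w j → lex w t i < lex w t j
      lex-< {i} {j} ii lt = <-≤-trans (+-monoʳ-< (w i ℕ.* N) (TieBreak.bounded τ ii))
        (≤-trans (≤-reflexive (+-comm (w i ℕ.* N) N)) (≤-trans (*-monoˡ-≤ N lt) (m≤m+n (w j ℕ.* N) (t j))))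

      lex-tie : ∀ {i j} → w i ≡ w j → t i < t j → lex w t i < lex w t j
      lex-tie {i} {j} e lt rewrite e = +-monoʳ-< (w j ℕ.* N) lt

      lex⁻¹ : ∀ {i j} → Inner i → Inner j → lex w t i < lex w t j → w i < w j ⊎ (w i ≡ w j × t i < t j)
      lex⁻¹ {i} {j} ii ij lt with <-cmp (w i) (w j)
      ... | tri< p _ _ = inj₁ p
      ... | tri> _ _ p = ⊥-elim (<-asym lt (lex-< ij p))
      ... | tri≈ _ e _ = inj₂ (e , +-cancelˡ-< (w j ℕ.* N) _ _ (subst (λ z → z ℕ.* N ℕ.+ t i < lex w t j) e lt))

      -- Ties call for balance rather than mere antisymmetry: equal weights stay equal under `bar`,
      -- so the tie-break decides the mirror images too.
      lex-key : Balanced w → Key (lex w t)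
      lex-key b = record { injective = inj ; reversing = rev }
        where
        inj : ∀ {i j} → Inner i → Inner j → lex w t i ≡ lex w t j → i ≡ j
        inj {i} {j} ii ij e with <-cmp (w i) (w j)
        ... | tri< p _ _ = ⊥-elim (<-irrefl e (lex-< ii p))
        ... | tri> _ _ p = ⊥-elim (<-irrefl (sym e) (lex-< ij p))
        ... | tri≈ _ q _ = TieBreak.distinct τ ii ij (+-cancelˡ-≡ (w j ℕ.* N) _ _ (subst (λ z → z ℕ.* N ℕ.+ t i ≡ lex w t j) q e))
        rev : ∀ {i j} → Inner i → Inner j → lex w t i < lex w t j → lex w t (bar j) < lex w t (bar i)
        rev {i} {j} ii ij lt with lex⁻¹ ii ij lt
        ... | inj₁ p = lex-< (bar-inner ij) (Balanced⇒Antisymmetric b ii ij p)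
        ... | inj₂ (e , p) = lex-tie (+-cancelˡ-≡ (w j) _ _ (trans (proj₂ b ij)
                (sym (trans (cong (ℕ._+ w (bar i)) (sym e)) (proj₂ b ii))))) (TieBreak.reversed τ ii ij p)

    ascending : TieBreak (λ j → j)
    ascending = record
      { bounded = λ ij → ≤-trans (s≤s (proj₂ ij)) (n≤1+n (suc m))
      ; distinct = λ _ _ e → e
      ; reversed = λ _ ij lt → bar-< lt (≤-trans (proj₂ ij) (n≤1+n m)) }

    descending : TieBreak bar
    descending = record
      { bounded = λ {j} _ → s≤s (m∸n≤m (suc m) j)
      ; distinct = λ {i} {j} ii ij e → trans (sym (bb ii)) (trans (cong bar e) (bb ij))
      ; reversed = λ ii ij lt → bar-< lt (≤-trans (proj₂ (bar-inner ij)) (n≤1+n m)) }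
      where
      bb : ∀ {i} → Inner i → bar (bar i) ≡ i
      bb ii = bar-bar (≤-trans (proj₂ ii) (n≤1+n m))

    module Weights (S : DiagSet) where

      -- With the default `true`, pairs outside `S` contribute nothing to `missing`.
      J : ℕ → ℕ → ℕ → Bool
      J p q j = if S p q then R (lo p q) (hi p q) j else true

      wt : ℕ → ℕ
      wt j = ∣ missing N N J j ∣

      wt≡ : ∀ j → + wt j ≡ missing N N J j
      wt≡ j = ℤ.0≤i⇒+∣i∣≡i (missing-≥0 N N J j)

      C : ℕ
      C = proj₁ (bound wt (suc m))

      wt< : ∀ {j} → Inner j → wt j < C
      wt< ij = proj₂ (bound wt (suc m)) _ (s≤s (proj₂ ij))

      opaque
        -- The second summand gives balance by construction, with no reindexing of the sum over the
        -- diagonals by the half turn.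
        symWt : ℕ → ℕ
        symWt j = wt j ℕ.+ (C ∸ wt (bar j))

        symWt≡ : ∀ j → symWt j ≡ wt j ℕ.+ (C ∸ wt (bar j))
        symWt≡ j = refl

      symWt-balanced : Balanced symWt
      symWt-balanced = C ℕ.+ C , λ {j} ij → trans (cong₂ ℕ._+_ (symWt≡ j) (symWt≡ (bar j)))
          (trans (cong (λ z → (wt j ℕ.+ (C ∸ wt (bar j))) ℕ.+ (wt (bar j) ℕ.+ (C ∸ wt z))) (bar-bar (≤-trans (proj₂ ij) (n≤1+n m))))
            (trans (lem (wt j) (C ∸ wt (bar j)) (wt (bar j)) (C ∸ wt j))
              (cong₂ ℕ._+_ (m+[n∸m]≡n (<⇒≤ (wt< ij))) (m∸n+n≡m (<⇒≤ (wt< (bar-inner ij)))))))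
        where
        lem : ∀ a b c d → (a ℕ.+ b) ℕ.+ (c ℕ.+ d) ≡ (a ℕ.+ d) ℕ.+ (b ℕ.+ c)
        lem a b c d = trans (+-assoc a b (c ℕ.+ d)) (trans (cong (a ℕ.+_) (trans (sym (+-assoc b c d)) (+-comm (b ℕ.+ c) d))) (sym (+-assoc a d (b ℕ.+ c))))

      J-in : ∀ {p q} → (p , q) ∈D S → ∀ j → J p q j ≡ R (lo p q) (hi p q) j
      J-in t j = if-true t

      wt-mono : ∀ {i j} → (∀ p q → (p , q) ∈D S → R (lo p q) (hi p q) j ≡ true → R (lo p q) (hi p q) i ≡ true) → wt i ≤ wt j
      wt-mono {i} {j} h = ℤ.drop‿+≤+ (subst₂ ℤ._≤_ (sym (wt≡ i)) (sym (wt≡ j)) (missing-mono N N J lem))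
        where
        lem : ∀ p q → J p q j ≡ true → J p q i ≡ true
        lem p q e with bool (S p q)
        ... | inj₁ t = trans (J-in t i) (h p q t (trans (sym (J-in t j)) e))
        ... | inj₂ t = if-false t

      module _ (wf : WellFormed (m ℕ.+ 2) S) (nc : NonCrossing S) where

        S-chord : ∀ {p q} → (p , q) ∈D S → Chord p q (lo p q) (hi p q)
        S-chord t = diagonal-chord (wf _ _ t)

        -- By `noncrossing-mono` the diagonals below `l` are among those below `u`, and `{p, q}`
        -- itself lies below `u` only.
        wt-separates : ∀ {p q l u} → (p , q) ∈D S → InL (lo p q) (hi p q) l → InU (lo p q) (hi p q) u → wt l < wt u
        wt-separates {p} {q} {l} {u} t L U = ≤∧≢⇒< (wt-mono mono) λ e →
            true≢false (proj₂ (proj₂ (proj₂ L))) (trans (sym (J-in t l)) (trans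
              (missing-tight N N J mono′ (trans (sym (wt≡ l)) (trans (cong +_ e) (wt≡ u))) p< q<) (trans (J-in t u) (proj₂ (proj₂ (proj₂ U))))))
          where
          q< = proj₂ (chord-pos< (S-chord t))
          p< = <-trans (proj₁ (chord-pos< (S-chord t))) q<
          mono : ∀ p′ q′ → (p′ , q′) ∈D S → R (lo p′ q′) (hi p′ q′) u ≡ true → R (lo p′ q′) (hi p′ q′) l ≡ true
          mono p′ q′ t′ = noncrossing-mono (chord-< (S-chord t)) (chord-< (S-chord t′))
            (λ X → nc p q p′ q′ t t′ (CrossL⇒Cross (S-chord t) (S-chord t′) X)) L U
          mono′ : ∀ p′ q′ → J p′ q′ u ≡ true → J p′ q′ l ≡ true
          mono′ p′ q′ e with bool (S p′ q′)
          ... | inj₁ t′ = trans (J-in t′ l) (mono p′ q′ t′ (trans (sym (J-in t′ u)) e))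
          ... | inj₂ t′ = if-false t′

        module _ (cs : CS S) where

          S-turn : ∀ {p q a b} → (p , q) ∈D S → Chord p q a b → (posn (σ b) ⊓ posn (σ a) , posn (σ b) ⊔ posn (σ a)) ∈D S
          S-turn t c = trans (sym (memU-turn S c)) (cs _ _ t)

          S-proper : ∀ {p q} → (p , q) ∈D S → Proper (lo p q) (hi p q)
          S-proper t = diagonal-proper (S-chord t) (wf _ _ t)

          turned-labels : ∀ {a b} (P : Proper a b) → let p = posn (σ b) ⊓ posn (σ a); q = posn (σ b) ⊔ posn (σ a) in
                          lo p q ≡ σ b × hi p q ≡ σ a
          turned-labels P = chord-labels (σ-chord P)

          -- Both summands respect the separation: the turned diagonal, again in `S`, has `bar u`
          -- below it and `bar l` above it.
          symWt-separates : ∀ {p q l u} → (p , q) ∈D S → InL (lo p q) (hi p q) l → InU (lo p q) (hi p q) u → symWt l < symWt u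
          symWt-separates {p} {q} {l} {u} t L U = subst₂ _<_ (sym (symWt≡ l)) (sym (symWt≡ u))
              (+-mono-<-≤ (wt-separates t L U) (∸-monoʳ-≤ C (<⇒≤ (wt-separates t′ L′ U′))))
            where
            P = S-proper t
            t′ = S-turn t (S-chord t)
            ls = turned-labels P
            L′ = subst₂ (λ x y → InL x y (bar u)) (sym (proj₁ ls)) (sym (proj₂ ls)) (side-bar P U)
            U′ = subst₂ (λ x y → InU x y (bar l)) (sym (proj₁ ls)) (sym (proj₂ ls)) (side-bar P L)

          module _ {t : ℕ → ℕ} (τ : TieBreak t) where

            key : Key (lex symWt t)
            key = lex-key {symWt} τ symWt-balanced

            S⊆Tri : S ⊆D Tri (lex symWt t)
            S⊆Tri p q s = chord-Tri {lex symWt t} (S-chord s) (wf p q s) λ L U → lex-< {symWt} τ (proj₁ L) (symWt-separates s L U)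

          -- The labels j and k of the triangles on the two sides of a chord outside S have equal weight,
          -- so that the tie-break decides between them.
          Tri∩Tri⊆S : ∀ {p q} → (p , q) ∈D Tri (lex symWt (λ j → j)) → (p , q) ∈D Tri (lex symWt bar) → (p , q) ∈D S
          Tri∩Tri⊆S {p} {q} t₁ t₂ with bool (S p q)
          ... | inj₁ s = s
          ... | inj₂ s = ⊥-elim (absurd (argmax-L K₁ a b) (argmin-U K₁ a b))
            where
            K₁ = lex symWt (λ j → j)
            d = Tri-wellFormed K₁ p q t₁
            c = diagonal-chord d
            a = lo p q
            b = hi p q
            absurd : (∃ λ j → InL a b j × (∀ i → InL a b i → K₁ i ≤ K₁ j)) ⊎ (∀ i → ¬ InL a b i) →
                     (∃ λ j → InU a b j × (∀ i → InU a b i → K₁ j ≤ K₁ i)) ⊎ (∀ i → ¬ InU a b i) → ⊥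
            absurd (inj₂ none) _ = let (j , x) , _ = diagonal⇒sides c d in none j x
            absurd (inj₁ _) (inj₂ none) = let _ , (j , x) = diagonal⇒sides c d in none j x
            absurd (inj₁ (j , L , jmax)) (inj₁ (k , U , kmin)) = absurd-order (lex⁻¹ {symWt} ascending (proj₁ L) (proj₁ U) (Tri-chord {K₁} c t₁ L U))
              where
              unseparated : ∀ {p′ q′ e f} → (p′ , q′) ∈D S → Chord p′ q′ e f → R e f j ≡ true → R e f k ≡ true
              unseparated t′ c′ = Chk-unseparated (chord-< c) (chord-≤ c) (chord-< c′) (chord-≤ c′)
                (Tri-chord {K₁} c t₁) (Tri-chord {K₁} c′ (S⊆Tri ascending _ _ t′))
                (λ { (refl , refl) → let e₁ , e₂ = chord-unique c c′ in
                     true≢false t′ (trans (sym (cong₂ S e₁ e₂)) s) }) L jmax U kmin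
              -- By `unseparated` the diagonals of `S` below `k` are among those below `j`. Applied
              -- to turned diagonals, it compares the mirror images in `wt-bar`.
              wt-jk : wt k ≤ wt j
              wt-jk = wt-mono λ p′ q′ t′ → unseparated t′ (S-chord t′)
              wt-bar : wt (bar j) ≤ wt (bar k)
              wt-bar = wt-mono λ p′ q′ t′ e → lem t′ e
                where
                lem : ∀ {p′ q′} → (p′ , q′) ∈D S → R (lo p′ q′) (hi p′ q′) (bar k) ≡ true → R (lo p′ q′) (hi p′ q′) (bar j) ≡ true
                lem {p′} {q′} t′ e with bool (R (lo p′ q′) (hi p′ q′) (bar j))
                ... | inj₁ x = x
                ... | inj₂ x = ⊥-elim (true≢false (unseparated (S-turn t′ (S-chord t′)) (σ-chord P) (trans (flipR (proj₁ L)) (cong not x)))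
                                                  (trans (flipR (proj₁ U)) (cong not e)))
                  where
                  P = S-proper t′
                  flipR : ∀ {i} → Inner i → R (σ (hi p′ q′)) (σ (lo p′ q′)) i ≡ not (R (lo p′ q′) (hi p′ q′) (bar i))
                  flipR {i} ii = trans (cong (R (σ (hi p′ q′)) (σ (lo p′ q′))) (sym (bar-bar (≤-trans (proj₂ ii) (n≤1+n m))))) (R-bar P (bar-inner ii))
              symWt-kj : symWt k ≤ symWt j
              symWt-kj = subst₂ _≤_ (sym (symWt≡ k)) (sym (symWt≡ j)) (+-mono-≤ wt-jk (∸-monoʳ-≤ C wt-bar))
              absurd-order : symWt j < symWt k ⊎ (symWt j ≡ symWt k × j < k) → ⊥
              absurd-order (inj₁ lt) = <⇒≱ lt symWt-kj
              absurd-order (inj₂ (e , j<k)) with lex⁻¹ {symWt} descending (proj₁ L) (proj₁ U) (Tri-chord {lex symWt bar} c t₂ L U)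
              ... | inj₁ lt = <⇒≱ lt symWt-kj
              ... | inj₂ (_ , lt) = <-asym lt (bar-< j<k (≤-trans (proj₂ (proj₁ U)) (n≤1+n m)))

    IsTri⇒Tri : ∀ {T} → IsTri T → ∃ λ K → Key K × (T ≐ Tri K)
    IsTri⇒Tri {T} (isTri (wf , nc , count) cs) = K , κ , sub , ⊆D-countD (m ℕ.+ 2) wf (Tri-wellFormed K) sub
        (trans count (sym (proj₂ (proj₂ (IsTri.triangulation (Tri-isTri κ))))))
      where
      open Weights T
      K = lex symWt (λ j → j)
      κ = key wf nc cs ascending
      sub = S⊆Tri wf nc cs ascending

    -- Faces

    Contains : (ℕ → Bool) → DiagSet → Set
    Contains J T = ∀ p q a b → Chord p q a b → IsDiagonal (m ℕ.+ 2) p q → Edge J a b → (p , q) ∈D T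

    EdgesIn⇒Contains : ∀ {K J T} → T ≐ Tri K → EdgesIn K J → Contains J T
    EdgesIn⇒Contains {K} T≐ h p q a b c d E = proj₂ T≐ p q (chord-Tri {K} c d (h a b E))

    Contains⇒EdgesIn : ∀ {K J T} → T ≐ Tri K → Contains J T → EdgesIn K J
    Contains⇒EdgesIn {K} {J} T≐ h a b E {j} {k} L U =
      Tri-chord {K} c (proj₁ T≐ _ _ (h _ _ a b c (sides⇒diagonal c L U) E)) L U
      where
      c : Chord (posn a ⊓ posn b) (posn a ⊔ posn b) a b
      c = chord-of (Edge.a<b E) (Edge.b≤ E)

    everything : ℕ → Bool
    everything _ = true

    -- No label lies above an edge of this path, so all its edges are sides. Tightness there fixes
    -- the sum of all coordinates.
    Contains-everything : ∀ T → Contains everything T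
    Contains-everything T p q a b c d E with diagonal⇒sides c d
    ... | _ , (k , U) = ⊥-elim (true≢false refl (Edge-inU E U))

    value : (ℕ → ℤ) → DiagSet → ℤ
    value c T = ∑ m (λ i → c (suc i) ℤ.* coord T (suc i))

    value-cong : ∀ {c c′} T → (∀ j → Inner j → c j ≡ c′ j) → value c T ≡ value c′ T
    value-cong T h = ∑-cong m λ i i<m → cong (ℤ._* coord T (suc i)) (h (suc i) (s≤s z≤n , i<m))

    module _ {T : DiagSet} (tri : IsTri T) where

      private
        x : ℕ → ℤ
        x = coord T
        K = proj₁ (IsTri⇒Tri tri)
        κ = proj₁ (proj₂ (IsTri⇒Tri tri))
        T≐ = proj₂ (proj₂ (IsTri⇒Tri tri))

      tight-at : ∀ J → Tight K x J
      tight-at J = coord-tight K (Key.injective κ) T T≐ J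

      excess≥0 : ∀ J → 0ℤ ℤ.≤ excess x J
      excess≥0 J = Tight.excess≥0 (tight-at J)

      excess≡0⇒Contains : ∀ J → excess x J ≡ 0ℤ → Contains J T
      excess≡0⇒Contains J e = EdgesIn⇒Contains T≐ (Tight.excess≡0⇒ (tight-at J) e)

      Contains⇒excess≡0 : ∀ J → Contains J T → excess x J ≡ 0ℤ
      Contains⇒excess≡0 J h = Tight.⇒excess≡0 (tight-at J) (Contains⇒EdgesIn T≐ h)

      x-sum : ∀ j → Inner j → x j ℤ.+ x (bar j) ≡ + suc m
      x-sum = x-bar κ T T≐

      -- The inequality for `J` bounds its partial sum from below. Subtracted from the constant
      -- total it bounds the sum over the complement from above, which is the form suited to
      -- maximisers.
      total-missing : ∀ J → + 2 ℤ.* ∑ m (λ i → ι (not (J (suc i))) ℤ.* x (suc i)) ≡ (f everything ℤ.- f J) ℤ.- excess x J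
      total-missing J = trans (lem₁ (total x J) s (total x everything) (f everything) (f J) (f (λ _ → false)) split)
          (trans (cong (λ e → ((f everything ℤ.- f J) ℤ.- excess x J) ℤ.+ e) (Contains⇒excess≡0 everything (Contains-everything T))) (ℤ.+-identityʳ _))
        where
        s = ∑ m (λ i → ι (not (J (suc i))) ℤ.* x (suc i))
        split : total x J ℤ.+ s ≡ total x everything
        split = trans (sym (∑-+ m (restrict J x ∘ suc) (λ i → ι (not (J (suc i))) ℤ.* x (suc i)))) (∑-cong m λ i _ → pointwise (J (suc i)) (x (suc i)))
          where
          pointwise : ∀ b y → (if b then y else 0ℤ) ℤ.+ ι (not b) ℤ.* y ≡ y
          pointwise true  y = ℤ.+-identityʳ y
          pointwise false y = trans (ℤ.+-identityˡ (1ℤ ℤ.* y)) (ℤ.*-identityˡ y)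
        lem₁ : ∀ t s a F G z → t ℤ.+ s ≡ a →
               + 2 ℤ.* s ≡ ((F ℤ.- G) ℤ.- (+ 2 ℤ.* t ℤ.- (G ℤ.- z))) ℤ.+ (+ 2 ℤ.* a ℤ.- (F ℤ.- z))
        lem₁ t s _ F G z refl = ring t s F G z
          where
          ring : ∀ t s F G z → + 2 ℤ.* s ≡ ((F ℤ.- G) ℤ.- (+ 2 ℤ.* t ℤ.- (G ℤ.- z))) ℤ.+ (+ 2 ℤ.* (t ℤ.+ s) ℤ.- (F ℤ.- z))
          ring = solve-∀

    Optimal : (ℕ → ℤ) → DiagSet → Set
    Optimal c T = IsTri T × (∀ T′ → IsTri T′ → value c T′ ℤ.≤ value c T)

    module Family (B M : ℕ) (J : ℕ → ℕ → ℕ → Bool) where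

      slack : DiagSet → ℤ
      slack T = ∑ B (λ p → ∑ M (λ q → excess (coord T) (J p q)))

      top : ℤ
      top = ∑ B (λ p → ∑ M (λ q → f everything ℤ.- f (J p q)))

      value-missing : ∀ T → value (missing B M J) T ≡
                     ∑ B (λ p → ∑ M (λ q → ∑ m (λ i → ι (not (J p q (suc i))) ℤ.* coord T (suc i))))
      value-missing T = trans (∑-cong m λ i _ → pull i)
        (trans (∑-swap m B (λ i p → ∑ M (λ q → ι (not (J p q (suc i))) ℤ.* x (suc i))))
          (∑-cong B λ p _ → ∑-swap m M (λ i q → ι (not (J p q (suc i))) ℤ.* x (suc i))))
        where
        x = coord T
        pull : ∀ i → missing B M J (suc i) ℤ.* x (suc i) ≡ ∑ B (λ p → ∑ M (λ q → ι (not (J p q (suc i))) ℤ.* x (suc i)))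
        pull i = trans (ℤ.*-comm (missing B M J (suc i)) (x (suc i)))
          (trans (sym (∑-*ˡ B (x (suc i)) (λ p → ∑ M (λ q → ι (not (J p q (suc i)))))))
            (∑-cong B λ p _ → trans (sym (∑-*ˡ M (x (suc i)) (λ q → ι (not (J p q (suc i))))))
              (∑-cong M λ q _ → ℤ.*-comm (x (suc i)) (ι (not (J p q (suc i)))))))

      -- Value and slack trade off against a constant, so once some triangulation has slack 0 the
      -- maximisers are exactly those of slack 0.
      balance : ∀ {T} → IsTri T → + 2 ℤ.* value (missing B M J) T ℤ.+ slack T ≡ top
      balance {T} tri = trans (cong (λ z → + 2 ℤ.* z ℤ.+ slack T) (value-missing T))
        (trans (cong (λ z → z ℤ.+ slack T) (trans (sym (∑-*ˡ B (+ 2) _)) (∑-cong B λ p _ → sym (∑-*ˡ M (+ 2) _))))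
          (trans (sym (∑₂-+ B M _ (λ p q → excess x (J p q))))
            (∑-cong B λ p _ → ∑-cong M λ q _ → trans (cong (λ z → z ℤ.+ excess x (J p q)) (total-missing tri (J p q))) (cancel _ (excess x (J p q))))))
        where
        x = coord T
        cancel : ∀ a b → (a ℤ.- b) ℤ.+ b ≡ a
        cancel = solve-∀

      AllIn : DiagSet → Set
      AllIn T = ∀ p q → p < B → q < M → Contains (J p q) T

      slack≥0 : ∀ {T} → IsTri T → 0ℤ ℤ.≤ slack T
      slack≥0 tri = ∑-≥0 B λ p _ → ∑-≥0 M λ q _ → excess≥0 tri (J p q)

      AllIn⇒slack≡0 : ∀ {T} → IsTri T → AllIn T → slack T ≡ 0ℤ
      AllIn⇒slack≡0 tri h = trans (∑-cong B λ p p< → trans (∑-cong M λ q q< → Contains⇒excess≡0 tri (J p q) (h p q p< q<)) (∑-0 M)) (∑-0 B)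

      slack≡0⇒AllIn : ∀ {T} → IsTri T → slack T ≡ 0ℤ → AllIn T
      slack≡0⇒AllIn {T} tri e p q p< q< = excess≡0⇒Contains tri (J p q) (sym
          (∑-tight M (λ q _ → excess≥0 tri (J p q)) row q q<))
        where
        row : ∑ M (λ _ → 0ℤ) ≡ ∑ M (λ q → excess (coord T) (J p q))
        row = trans (∑-0 M) (∑-tight B {f = λ _ → 0ℤ} (λ p _ → ∑-≥0 M λ q _ → excess≥0 tri (J p q)) (trans (∑-0 B) (sym e)) p p<)

      AllIn⇒Optimal : ∀ {T} → IsTri T → AllIn T → Optimal (missing B M J) T
      AllIn⇒Optimal {T} tri h = tri , λ T′ tri′ → ℤ.*-cancelˡ-≤-pos (value (missing B M J) T′) (value (missing B M J) T) (+ 2) (begin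
          + 2 ℤ.* value (missing B M J) T′                  ≡⟨ sym (ℤ.+-identityʳ _) ⟩
          + 2 ℤ.* value (missing B M J) T′ ℤ.+ 0ℤ           ≤⟨ ℤ.+-monoʳ-≤ (+ 2 ℤ.* value (missing B M J) T′) (slack≥0 tri′) ⟩
          + 2 ℤ.* value (missing B M J) T′ ℤ.+ slack T′  ≡⟨ trans (balance tri′) (sym (balance tri)) ⟩
          + 2 ℤ.* value (missing B M J) T ℤ.+ slack T    ≡⟨ cong (ℤ._+_ (+ 2 ℤ.* value (missing B M J) T)) (AllIn⇒slack≡0 tri h) ⟩
          + 2 ℤ.* value (missing B M J) T ℤ.+ 0ℤ         ≡⟨ ℤ.+-identityʳ _ ⟩
          + 2 ℤ.* value (missing B M J) T                   ∎)
        where open ℤ.≤-Reasoning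

      -- The witness `T₀` shows that the bound `top` is attained.
      Optimal⇒AllIn : ∀ {T₀ T} → IsTri T₀ → AllIn T₀ → Optimal (missing B M J) T → AllIn T
      Optimal⇒AllIn {T₀} {T} tri₀ h (tri , best) = slack≡0⇒AllIn tri (ℤ.≤-antisym le (slack≥0 tri))
        where
        open ℤ.≤-Reasoning
        a = + 2 ℤ.* value (missing B M J) T
        le : slack T ℤ.≤ 0ℤ
        le = +-cancelʳ-≤-ℤ a (subst₂ ℤ._≤_ (ℤ.+-comm a (slack T)) (ℤ.+-comm a 0ℤ) (begin
          a ℤ.+ slack T                                         ≡⟨ trans (balance tri) (sym (balance tri₀)) ⟩
          + 2 ℤ.* value (missing B M J) T₀ ℤ.+ slack T₀          ≤⟨ ℤ.+-mono-≤ (ℤ.*-monoˡ-≤-nonNeg (+ 2) (best T₀ tri₀)) (ℤ.≤-reflexive (AllIn⇒slack≡0 tri₀ h)) ⟩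
          a ℤ.+ 0ℤ                                              ∎))

    -- The path of {j : R a b j} consists of the chord {a, b} and sides of the polygon.
    Contains-R : ∀ {p q a b T} → Chord p q a b → (p , q) ∈D T → Contains (R a b) T
    Contains-R {p} {q} {a} {b} {T} c t p′ q′ e f c′ d E = main (a ≟ e) (b ≟ f)
      where
      self : Edge (R a b) a b
      self = R⇒Edge (chord-< c) (chord-≤ c) λ _ _ _ _ → refl
      sides = diagonal⇒sides c′ d
      L = proj₂ (proj₁ sides)
      U = proj₂ (proj₂ sides)
      absurd : b ≤ e ⊎ f ≤ a → ⊥
      absurd (inj₁ b≤e) = true≢false (trans (sym (R-right (chord-< c) (≤-trans b≤e (proj₁ (proj₂ L))))) (Edge-inL E L))
                                     (trans (sym (R-right (chord-< c) (≤-trans b≤e (proj₁ (proj₂ U))))) (Edge-inU E U))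
      absurd (inj₂ f≤a) = true≢false (trans (sym (R-left (≤-trans (proj₁ (proj₂ (proj₂ L))) f≤a))) (Edge-inL E L))
                                     (trans (sym (R-left (≤-trans (proj₁ (proj₂ (proj₂ U))) f≤a))) (Edge-inU E U))
      main : Dec (a ≡ e) → Dec (b ≡ f) → (p′ , q′) ∈D T
      main (yes refl) (yes refl) with chord-unique c c′
      ... | refl , refl = t
      main (no x) _ = ⊥-elim (absurd (Edge-disjoint self E (x ∘ proj₁)))
      main (yes _) (no x) = ⊥-elim (absurd (Edge-disjoint self E (x ∘ proj₂)))

    module Cell (S : DiagSet) (wf : WellFormed (m ℕ.+ 2) S) (nc : NonCrossing S) (cs : CS S) where
      open Weights S

      open Family N N J using (AllIn)

      ⊆⇒AllIn : ∀ {T} → S ⊆D T → AllIn T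
      ⊆⇒AllIn {T} sub p q _ _ with bool (S p q)
      ... | inj₁ t = subst (λ P → Contains P T) (sym (lem t)) (Contains-R (S-chord wf nc t) (sub p q t))
        where
        lem : S p q ≡ true → J p q ≡ R (lo p q) (hi p q)
        lem e rewrite e = refl
      ... | inj₂ t = subst (λ P → Contains P T) (sym (lem t)) (Contains-everything T)
        where
        lem : S p q ≡ false → J p q ≡ everything
        lem e rewrite e = refl

      AllIn⇒⊆ : ∀ {T} → AllIn T → S ⊆D T
      AllIn⇒⊆ {T} h p q t = h p q (<-trans (proj₁ pq) (proj₂ pq)) (proj₂ pq) p q (lo p q) (hi p q) c (wf p q t)
          (R⇒Edge (chord-< c) (chord-≤ c) λ j _ _ _ → J-in t j)
        where
        c = S-chord wf nc t
        pq = chord-pos< c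

      T₀ : DiagSet
      T₀ = Tri (lex symWt (λ j → j))

      T₀-tri : IsTri T₀
      T₀-tri = Tri-isTri (key wf nc cs ascending)

      S⊆T₀ : S ⊆D T₀
      S⊆T₀ = S⊆Tri wf nc cs ascending

      Optimal⇒⊆ : ∀ {T} → Optimal (missing N N J) T → S ⊆D T
      Optimal⇒⊆ {T} o = AllIn⇒⊆ {T} (Family.Optimal⇒AllIn N N J {T₀} {T} T₀-tri (⊆⇒AllIn {T₀} S⊆T₀) o)

      ⊆⇒Optimal : ∀ {T} → IsTri T → S ⊆D T → Optimal (missing N N J) T
      ⊆⇒Optimal {T} tri sub = Family.AllIn⇒Optimal N N J {T} tri (⊆⇒AllIn {T} sub)

    module Layers (c : ℕ → ℕ) (bal : Balanced c) where

      -- When `c` has ties this may be only a symmetric dissection; it is the one whose face the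
      -- functional `c` cuts out.
      S : DiagSet
      S = Tri c

      S-wf : WellFormed (m ℕ.+ 2) S
      S-wf = Tri-wellFormed c

      S-nc : NonCrossing S
      S-nc = Tri-nonCrossing c

      S-cs : CS S
      S-cs = Tri-symmetric {c} (Balanced⇒Antisymmetric bal)

      B : ℕ
      B = proj₁ (bound c (suc m))

      c<B : ∀ {j} → Inner j → c j < B
      c<B ij = proj₂ (bound c (suc m)) _ (s≤s (proj₂ ij))

      J : ℕ → ℕ → ℕ → Bool
      J t _ = below c (suc t)

      -- Layer-cake decomposition: `c j` counts the `t < B` for which `j` has not entered
      -- `{c < t + 1}`.
      c≡missing : ∀ {j} → Inner j → + c j ≡ missing B 1 J j
      c≡missing {j} ij = trans (sym (∑-χ< B (c j) (<⇒≤ (c<B ij)))) (∑-cong B λ t _ → trans (lem t) (sym (ℤ.+-identityʳ _)))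
        where
        lem : ∀ t → χ (t <? c j) ≡ ι (not (below c (suc t) j))
        lem t with bool (below c (suc t) j)
        ... | inj₁ e = trans (χ-no (t <? c j) (≤⇒≯ (≤-pred (below⇒< c e)))) (cong (ι ∘ not) (sym e))
        ... | inj₂ e = trans (χ-yes (t <? c j) (below⇒≥ c e)) (cong (ι ∘ not) (sym e))

      open Family B 1 J using (AllIn)

      ⊆⇒AllIn : ∀ {T} → S ⊆D T → AllIn T
      ⊆⇒AllIn sub t _ _ _ p q a b ch d E = sub p q (chord-Tri {c} ch d (Edge-below⇒Chk E))

      -- A diagonal has a lower label, so its first threshold is some `c j + 1`, which is one of the
      -- layers.
      AllIn⇒⊆ : ∀ {T} → AllIn T → S ⊆D T
      AllIn⇒⊆ {T} h p q s = lem (Chk⇒Edge (chord-< ch) (chord-≤ ch) (Tri-chord {c} ch s))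
        where
        ch = diagonal-chord (S-wf p q s)
        lem : (∃ λ t → Edge (below c t) (lo p q) (hi p q) × (t ≡ 0 ⊎ ∃ λ j → InL (lo p q) (hi p q) j × t ≡ suc (c j))) → (p , q) ∈D T
        lem (_ , E , inj₂ (j , L , refl)) = h (c j) 0 (c<B (proj₁ L)) (s≤s z≤n) p q (lo p q) (hi p q) ch (S-wf p q s) E
        lem (_ , E , inj₁ refl) = let (j , L) , _ = diagonal⇒sides ch (S-wf p q s) in
          ⊥-elim (n≮0 (below⇒< c (Edge-inL E L)))

      value≡ : ∀ T → value (λ j → + c j) T ≡ value (missing B 1 J) T
      value≡ T = value-cong {λ j → + c j} {missing B 1 J} T λ j ij → c≡missing ij

      module C = Cell S S-wf S-nc S-cs

      to-missing : ∀ {T} → Optimal (λ j → + c j) T → Optimal (missing B 1 J) T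
      to-missing {T} (tri , best) = tri , λ T′ tri′ → subst₂ ℤ._≤_ (value≡ T′) (value≡ T) (best T′ tri′)

      from-missing : ∀ {T} → Optimal (missing B 1 J) T → Optimal (λ j → + c j) T
      from-missing {T} (tri , best) = tri , λ T′ tri′ → subst₂ ℤ._≤_ (sym (value≡ T′)) (sym (value≡ T)) (best T′ tri′)

      Optimal⇒⊆ : ∀ {T} → Optimal (λ j → + c j) T → S ⊆D T
      Optimal⇒⊆ {T} o = AllIn⇒⊆ {T} (Family.Optimal⇒AllIn B 1 J {C.T₀} {T} C.T₀-tri (⊆⇒AllIn {C.T₀} C.S⊆T₀) (to-missing {T} o))

      ⊆⇒Optimal : ∀ {T} → IsTri T → S ⊆D T → Optimal (λ j → + c j) T
      ⊆⇒Optimal {T} tri sub = from-missing {T} (Family.AllIn⇒Optimal B 1 J {T} tri (⊆⇒AllIn {T} sub))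

    -- Since x j + x (m + 1 − j) is constant, a functional z may be replaced by z − z ∘ bar, and then
    -- shifted by a constant to take values in ℕ.
    module Balance (z : ℕ → ℤ) where

      diff : ℕ → ℤ
      diff j = z j ℤ.- z (bar j)

      A : ℕ
      A = proj₁ (bound (λ j → ∣ diff j ∣) (suc m))

      opaque
        ĉ : ℕ → ℕ
        ĉ j = ∣ diff j ℤ.+ + A ∣

        ĉ≡ : ∀ {j} → Inner j → + ĉ j ≡ diff j ℤ.+ + A
        ĉ≡ {j} ij = ℤ.0≤i⇒+∣i∣≡i (ℤ.≤-trans (ℤ.≤-reflexive (sym (ℤ.+-inverseˡ (+ A))))
            (ℤ.+-monoˡ-≤ (+ A) (ℤ.≤-trans (ℤ.neg-mono-≤ (ℤ.+≤+ (<⇒≤ lt))) (neg-abs (diff j)))))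
          where
          lt : ∣ diff j ∣ < A
          lt = proj₂ (bound (λ j → ∣ diff j ∣) (suc m)) j (s≤s (proj₂ ij))
          neg-abs : ∀ i → ℤ.- (+ ∣ i ∣) ℤ.≤ i
          neg-abs (+ k) = neg≤pos k k
          neg-abs ℤ.-[1+ k ] = ℤ.≤-refl

      ĉ-balanced : Balanced ĉ
      ĉ-balanced = A ℕ.+ A , λ {j} ij → ℤ.+-injective (trans (cong₂ ℤ._+_ (ĉ≡ ij) (ĉ≡ (bar-inner ij)))
          (trans (cong (λ i → (diff j ℤ.+ + A) ℤ.+ ((z (bar j) ℤ.- z i) ℤ.+ + A)) (bar-bar (≤-trans (proj₂ ij) (n≤1+n m))))
                 (ring (z j) (z (bar j)) (+ A))))
        where
        ring : ∀ x y a → ((x ℤ.- y) ℤ.+ a) ℤ.+ ((y ℤ.- x) ℤ.+ a) ≡ a ℤ.+ a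
        ring = solve-∀

      ones : ℤ
      ones = ∑ m (λ i → z (bar (suc i)))

      weight : DiagSet → ℤ
      weight T = ∑ m (λ i → coord T (suc i))

      -- Reversing the summation replaces `x j` by `x (bar j) = m + 1 - x j`.
      value-z : ∀ {T} → IsTri T → value z T ≡ + suc m ℤ.* ones ℤ.- value (z ∘ bar) T
      value-z {T} tri = trans (∑-reverse m (λ i → z (suc i) ℤ.* x (suc i)))
          (trans (∑-cong m term) (trans (∑-+ m (λ i → + suc m ℤ.* z (bar (suc i))) (λ i → ℤ.- 1ℤ ℤ.* (z (bar (suc i)) ℤ.* x (suc i))))
            (cong₂ ℤ._+_ (∑-*ˡ m (+ suc m) (λ i → z (bar (suc i)))) (trans (∑-*ˡ m (ℤ.- 1ℤ) (λ i → z (bar (suc i)) ℤ.* x (suc i))) (ℤ.-1*i≡-i _)))))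
        where
        x = coord T
        ring : ∀ y a b k → a ℤ.+ b ≡ k → y ℤ.* b ≡ k ℤ.* y ℤ.+ ℤ.- 1ℤ ℤ.* (y ℤ.* a)
        ring y a b _ refl = ring′ y a b
          where
          ring′ : ∀ y a b → y ℤ.* b ≡ (a ℤ.+ b) ℤ.* y ℤ.+ ℤ.- 1ℤ ℤ.* (y ℤ.* a)
          ring′ = solve-∀
        term : ∀ i → i < m → z (suc (m ∸ suc i)) ℤ.* x (suc (m ∸ suc i)) ≡ + suc m ℤ.* z (bar (suc i)) ℤ.+ ℤ.- 1ℤ ℤ.* (z (bar (suc i)) ℤ.* x (suc i))
        term i i<m = trans (cong (λ k → z k ℤ.* x k) (sym (+-∸-assoc 1 i<m)))
                           (ring (z (bar (suc i))) (x (suc i)) (x (bar (suc i))) (+ suc m) (x-sum tri (suc i) (s≤s z≤n , i<m)))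

      weight-const : ∀ {T T′} → IsTri T → IsTri T′ → weight T ≡ weight T′
      weight-const tri tri′ = ℤ.*-cancelˡ-≡ (+ 2) _ _ (trans (twice tri) (sym (twice tri′)))
        where
        twice : ∀ {T} → IsTri T → + 2 ℤ.* weight T ≡ f everything ℤ.- f (λ _ → false)
        twice {T} tri = ℤ.i-j≡0⇒i≡j _ _ (Contains⇒excess≡0 tri everything (Contains-everything T))

      value-ĉ : ∀ {T} → IsTri T → value (λ j → + ĉ j) T ≡ + 2 ℤ.* value z T ℤ.+ (+ A ℤ.* weight T ℤ.- + suc m ℤ.* ones)
      value-ĉ {T} tri = trans (∑-cong m term)
          (trans (∑-+ m _ (λ i → + A ℤ.* x (suc i))) (trans (cong₂ ℤ._+_ (∑-+ m (λ i → z (suc i) ℤ.* x (suc i)) (λ i → ℤ.- 1ℤ ℤ.* (z (bar (suc i)) ℤ.* x (suc i)))) (∑-*ˡ m (+ A) (x ∘ suc)))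
            (trans (cong (λ w → (value z T ℤ.+ w) ℤ.+ + A ℤ.* weight T) (∑-*ˡ m (ℤ.- 1ℤ) (λ i → z (bar (suc i)) ℤ.* x (suc i))))
              (ring₂ (value z T) (value (z ∘ bar) T) (+ A ℤ.* weight T) (+ suc m ℤ.* ones) (value-z tri)))))
        where
        x = coord T
        ring₁ : ∀ u v a y → ((u ℤ.- v) ℤ.+ a) ℤ.* y ≡ (u ℤ.* y ℤ.+ ℤ.- 1ℤ ℤ.* (v ℤ.* y)) ℤ.+ a ℤ.* y
        ring₁ = solve-∀
        term : ∀ i → i < m → + ĉ (suc i) ℤ.* x (suc i) ≡ (z (suc i) ℤ.* x (suc i) ℤ.+ ℤ.- 1ℤ ℤ.* (z (bar (suc i)) ℤ.* x (suc i))) ℤ.+ + A ℤ.* x (suc i)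
        term i i<m = trans (cong (ℤ._* x (suc i)) (ĉ≡ (s≤s z≤n , i<m))) (ring₁ (z (suc i)) (z (bar (suc i))) (+ A) (x (suc i)))
        ring₂ : ∀ c d w k → c ≡ k ℤ.- d → (c ℤ.+ ℤ.- 1ℤ ℤ.* d) ℤ.+ w ≡ + 2 ℤ.* c ℤ.+ (w ℤ.- k)
        ring₂ _ d w k refl = ring₃ d w k
          where
          ring₃ : ∀ d w k → ((k ℤ.- d) ℤ.+ ℤ.- 1ℤ ℤ.* d) ℤ.+ w ≡ + 2 ℤ.* (k ℤ.- d) ℤ.+ (w ℤ.- k)
          ring₃ = solve-∀

      shift≡ : ∀ {T T′} → IsTri T → IsTri T′ → + A ℤ.* weight T ℤ.- + suc m ℤ.* ones ≡ + A ℤ.* weight T′ ℤ.- + suc m ℤ.* ones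
      shift≡ tri tri′ = cong (λ w → + A ℤ.* w ℤ.- + suc m ℤ.* ones) (weight-const tri tri′)

      z⇒ĉ : ∀ {T} → Optimal z T → Optimal (λ j → + ĉ j) T
      z⇒ĉ (tri , best) = tri , λ T′ tri′ → subst₂ ℤ._≤_ (sym (value-ĉ tri′)) (sym (value-ĉ tri))
        (ℤ.+-mono-≤ (ℤ.*-monoˡ-≤-nonNeg (+ 2) (best T′ tri′)) (ℤ.≤-reflexive (shift≡ tri′ tri)))

      ĉ⇒z : ∀ {T} → Optimal (λ j → + ĉ j) T → Optimal z T
      ĉ⇒z {T} (tri , best) = tri , λ T′ tri′ → ℤ.*-cancelˡ-≤-pos (value z T′) (value z T) (+ 2)
        (+-cancelʳ-≤-ℤ (+ A ℤ.* weight T ℤ.- + suc m ℤ.* ones) (subst₂ ℤ._≤_ (trans (value-ĉ tri′) (cong (ℤ._+_ (+ 2 ℤ.* value z T′)) (shift≡ tri′ tri))) (value-ĉ tri) (best T′ tri′)))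

    -- Rational functionals and the poset of faces

    vertex : DiagSet → Vec ℚ m
    vertex T = map toℚ (M m dir T)

    IsTri′ : DiagSet → Set
    IsTri′ T = IsTriangulation m T × CS T

    OnFace : Vec ℚ m → DiagSet → Set
    OnFace c T = IsTri′ T × (∀ T′ → IsTri′ T′ → dot c (vertex T′) ℚ.≤ dot c (vertex T))

    -- Multiplication by the positive `suc d` preserves and reflects the order, so integral and
    -- rational maximisers agree.
    Optimal⇔OnFace : ∀ c z (d : ℕ) → (∀ T → dot c (vertex T) ℚ.* toℚ (+ suc d) ≡ toℚ (value z T)) →
                     ∀ T → (Optimal z T → OnFace c T) × (OnFace c T → Optimal z T)
    Optimal⇔OnFace c z d scaled T = from , to
      where
      to : OnFace c T → Optimal z T
      to ((t , s) , best) = isTri t s , λ T′ tri′ → toℚ-cancel (subst₂ ℚ._≤_ (scaled T′) (scaled T)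
        (ℚ.*-monoʳ-≤-nonNeg (toℚ (+ suc d)) {{ℚ.pos⇒nonNeg (toℚ (+ suc d)) {{pos-toℚ d}}}}
          (best T′ (IsTri.triangulation tri′ , IsTri.symmetric tri′))))
      from : Optimal z T → OnFace c T
      from (isTri t s , best) = (t , s) , λ T′ ts′ → ℚ.*-cancelʳ-≤-pos (toℚ (+ suc d)) {{pos-toℚ d}}
        (subst₂ ℚ._≤_ (sym (scaled T′)) (sym (scaled T)) (toℚ-mono (best T′ (isTri (proj₁ ts′) (proj₂ ts′)))))

    CSNC : DiagSet → Set
    CSNC S = WellFormed (m ℕ.+ 2) S × NonCrossing S × CS S

    -- The sum over the chords of S of the indicators of the labels above the chord.
    functional : DiagSet → Vec ℚ m
    functional S = tabulate λ i → toℚ (missing N N (Weights.J S) (suc (toℕ i)))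

    value≡∑ : ∀ c T → ∑ m (λ i → c (suc i) ℤ.* xcoord m dir T (suc i)) ≡ value c T
    value≡∑ c T = ∑-cong m λ i _ → cong (ℤ._*_ (c (suc i))) (coord≡ T (suc i))

    dot-functional : ∀ S T → dot (functional S) (vertex T) ℚ.* toℚ (+ 1) ≡ toℚ (value (missing N N (Weights.J S)) T)
    dot-functional S T = trans (ℚ.*-identityʳ (dot (functional S) (vertex T)))
      (trans (dot-toℚ m (λ i → missing N N (Weights.J S) (suc i)) (λ i → xcoord m dir T (suc i)))
        (cong toℚ (value≡∑ (missing N N (Weights.J S)) T)))

    OnFace⇒⊆ : ∀ {S T} → CSNC S → OnFace (functional S) T → S ⊆D T
    OnFace⇒⊆ {S} {T} (wf , nc , cs) F = Cell.Optimal⇒⊆ S wf nc cs {T} (proj₂ (Optimal⇔OnFace (functional S) (missing N N (Weights.J S)) 0 (dot-functional S) T) F)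

    ⊆⇒OnFace : ∀ {S T} → CSNC S → IsTri′ T → S ⊆D T → OnFace (functional S) T
    ⊆⇒OnFace {S} {T} (wf , nc , cs) (t , s) sub = proj₁ (Optimal⇔OnFace (functional S) (missing N N (Weights.J S)) 0 (dot-functional S) T) (Cell.⊆⇒Optimal S wf nc cs {T} (isTri t s) sub)

    -- The diagonal set is `Tri` of the balanced natural weight obtained from `c` by clearing
    -- denominators and antisymmetrising. Both `c` and the functional of this set have as maximisers
    -- the triangulations containing it.
    every-face : ∀ (c : Vec ℚ m) → ∃ λ S → CSNC S × (OnFace c ⊆F OnFace (functional S)) × (OnFace (functional S) ⊆F OnFace c)
    every-face c = L.S , csnc
        , (λ T F → ⊆⇒OnFace {L.S} {T} csnc (proj₁ F) (L.Optimal⇒⊆ {T} (B.z⇒ĉ {T} (proj₂ (iff T) F))))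
        , (λ T F → proj₁ (iff T) (B.ĉ⇒z {T} (L.⊆⇒Optimal {T} (isTri (proj₁ (proj₁ F)) (proj₂ (proj₁ F))) (OnFace⇒⊆ {L.S} {T} csnc F))))
      where
      cleared = clear-denominators m c
      d = proj₁ cleared
      z : ℕ → ℤ
      -- Vector entries are numbered from 0, labels from 1.
      z j = proj₁ (proj₂ cleared) (j ∸ 1)
      module B = Balance z
      module L = Layers B.ĉ B.ĉ-balanced
      csnc : CSNC L.S
      csnc = L.S-wf , L.S-nc , L.S-cs
      iff : ∀ T → (Optimal z T → OnFace c T) × (OnFace c T → Optimal z T)
      iff = Optimal⇔OnFace c z d λ T → trans (proj₂ (proj₂ cleared) (λ i → xcoord m dir T (suc i))) (cong toℚ (value≡∑ z T))

    -- Two test points suffice: the triangulations of the two tie-breaks lie on the face of `S′`,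
    -- hence on that of `S`, hence contain `S`, while all their common diagonals lie in `S′`.
    ⊆F⇒⊆D : ∀ S S′ → CSNC S → CSNC S′ → OnFace (functional S′) ⊆F OnFace (functional S) → S ⊆D S′
    ⊆F⇒⊆D S S′ CS₁ CS₂@(wf , nc , cs) h p q t =
        W.Tri∩Tri⊆S wf nc cs (chord-of-both ascending) (chord-of-both descending)
      where
      module W = Weights S′
      tri′ : ∀ {t : ℕ → ℕ} (τ : TieBreak t) → IsTri′ (Tri (lex W.symWt t))
      tri′ τ = IsTri.triangulation tri , IsTri.symmetric tri
        where tri = Tri-isTri (W.key wf nc cs τ)
      chord-of-both : ∀ {t : ℕ → ℕ} (τ : TieBreak t) → (p , q) ∈D Tri (lex W.symWt t)
      chord-of-both {t′} τ = OnFace⇒⊆ {S} {Tri (lex W.symWt t′)} CS₁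
        (h (Tri (lex W.symWt t′)) (⊆⇒OnFace {S′} {Tri (lex W.symWt t′)} CS₂ (tri′ τ) (W.S⊆Tri wf nc cs τ))) p q t

    realizes : Σ (DiagSet → Vec ℚ m) λ φ →
      (∀ c → ∃ λ S → CSNC S × (OnFace c ⊆F OnFace (φ S)) × (OnFace (φ S) ⊆F OnFace c)) ×
      (∀ S S′ → CSNC S → CSNC S′ → (S ⊆D S′ ⇔ (OnFace (φ S′) ⊆F OnFace (φ S))))
    realizes = functional , every-face , λ S S′ CS₁ CS₂ → mk⇔
      (λ sub T F → ⊆⇒OnFace {S} {T} CS₁ (proj₁ F) λ p q t → OnFace⇒⊆ {S′} {T} CS₂ F p q (sub p q t))
      (⊆F⇒⊆D S S′ CS₁ CS₂)

theorem1p5 : ∀ (n : ℕ) → 1 ≤ n → (dir : Orientation) → SymmetricOrientation n dir →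
    RealizesCyclohedron n (λ T → map toℚ (M (2 * n) dir T))
theorem1p5 n 1≤n dir sym-dir =
  -- At `m = 2 * n` the local predicates unfold to those of `RealizesCyclohedron`; integrality is
  -- carried by the type of `M`.
  Polygon.Symmetry.realizes (2 * n) dir (≤-trans 1≤n (m≤m+n n (n ℕ.+ 0))) n (cong (n ℕ.+_) (+-identityʳ n)) 1≤n sym-dir
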